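{- Let $C\subseteq\mathbb{R}^d$ be the attractor of an iterated function system $F=(f_1,\ldots,f_J)$ with contraction rates $\tau_j\in(0,1)$. Let $\tau=\max_{1\leq j\leq J}\tau_j\in(0,1)$ and $D=-\log J/\log\tau>0$. For positive integers $N,n$, let $\mathcal{S}(C,N,n)$ be the set of vectors in $C$ whose entries are real algebraic numbers of degree at most $n$ and height at most $N$. Then $$|\mathcal{S}(C,N,n)|\ll_{C,n}N^{2nD},$$ where the implied constant depends only on $C$ (the iterated function system) and $n$.
   Context: $\mathbb{R}^d$ carries the supremum norm $\Vert\cdot\Vert$. A contraction is a map $f:\mathbb{R}^d\to\mathbb{R}^d$ for which there is $\tau\in(0,1)$ (contraction rate) with $\Vert f(\underline{x})-f(\underline{y})\Vert\leq\tau\Vert\underline{x}-\underline{y}\Vert$ for all $\underline{x},\underline{y}$. An iterated function system (IFS) is a finite set of contractions; its attractor is the unique nonempty compact set $C$ with $\bigcup_{j}f_j(C)=C$. The height $H(\alpha)$ of an algebraic number $\alpha$ is the maximum absolute value of the coefficients of its minimal polynomial over $\mathbb{Z}$ (irreducible, with coprime integer coefficients). -}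

module Defs where

open import Data.Bool.Base using (if_then_else_)
open import Data.Fin.Base using (Fin; zero; suc)
open import Data.Nat.Base as ℕ using (ℕ; zero; suc; z≤n; s≤s)
import Data.Nat.Properties as ℕₚ
open import Data.Integer.Base as ℤ using (ℤ; -[1+_]; 0ℤ; 1ℤ)
import Data.Integer.GCD as ℤ
import Data.Integer.Properties as ℤₚ
open import Data.List.Base using (List; []; _∷_)
import Data.List.Base as List
open import Data.List.Relation.Unary.All using (All; all?)
open import Data.List.Relation.Unary.Any using (Any)
open import Data.Rational.Base as ℚ using (ℚ; mkℚ; 0ℚ; 1ℚ; ½)
import Data.Rational.Properties as ℚₚ
import Data.Rational.Unnormalised.Base as ℚᵘ
import Data.Rational.Unnormalised.Properties as ℚᵘₚ
open import Data.Rational.Solver using (module +-*-Solver)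
open import Data.Product.Base using (∃-syntax; _×_; _,_; proj₁; proj₂)
open import Data.Sum.Base using (_⊎_; inj₁; inj₂)
open import Data.Vec.Functional using (Vector; foldr; zipWith)
open import Algebra.Bundles.Raw using (RawSemiring)
import Algebra.Definitions.RawSemiring as RawSemiringDefinitions
open import Function.Definitions using (Injective)
open import Level using (Level; 0ℓ)
open import Relation.Nullary using (Dec; does; yes; no; ¬_)
open import Relation.Nullary.Negation using (contradiction)
open import Relation.Unary using (Pred; _∈_; _≐_)
open import Relation.Binary.PropositionalEquality hiding (J)

ℕtoℚ : ℕ → ℚ
ℕtoℚ n = ℤ.+ n ℚ./ 1

module RationalLemmas where
  open import Data.Rational.Base
  open import Data.Rational.Properties
  open +-*-Solver using (solve; _:=_; _:+_; _:*_; :-_; _:-_; con)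

  ι : ℕ → ℚ
  ι = ℕtoℚ

  ι-suc : ∀ n → ι (suc n) ≡ 1ℚ + ι n
  ι-suc n = toℚᵘ-injective (begin
    toℚᵘ (ι (suc n))              ≈⟨ toℚᵘ-fromℚᵘ (ℚᵘ.mkℚᵘ (ℤ.+ suc n) 0) ⟩
    ℚᵘ.mkℚᵘ (ℤ.+ suc n) 0           ≈⟨ ℚᵘ.*≡* (cong (ℤ._* 1ℤ) (cong (λ z → 1ℤ ℤ.+ z) (sym (ℤₚ.*-identityʳ (ℤ.+ n))))) ⟩
    ℚᵘ.mkℚᵘ (ℤ.+ 1) 0 ℚᵘ.+ ℚᵘ.mkℚᵘ (ℤ.+ n) 0
      ≈⟨ ℚᵘₚ.+-cong (ℚᵘₚ.≃-refl {toℚᵘ 1ℚ}) (ℚᵘₚ.≃-sym (toℚᵘ-fromℚᵘ (ℚᵘ.mkℚᵘ (ℤ.+ n) 0))) ⟩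
    toℚᵘ 1ℚ ℚᵘ.+ toℚᵘ (ι n)       ≈⟨ ℚᵘₚ.≃-sym (toℚᵘ-homo-+ 1ℚ (ι n)) ⟩
    toℚᵘ (1ℚ + ι n)               ∎)
    where open import Relation.Binary.Reasoning.Setoid ℚᵘₚ.≃-setoid

  ι-nonNeg : ∀ n → 0ℚ ≤ ι n
  ι-nonNeg n = nonNegative⁻¹ (ι n) {{normalize-nonNeg n 1}}

  recip : ℕ → ℚ
  recip k = 1ℤ / suc k

  0<recip : ∀ k → 0ℚ < recip k
  0<recip k = positive⁻¹ (recip k) {{normalize-pos 1 (suc k)}}

  recip-inv : ∀ k → recip k * ι (suc k) ≡ 1ℚ
  recip-inv k = toℚᵘ-injective (begin
    toℚᵘ (recip k * ι (suc k))    ≈⟨ toℚᵘ-homo-* (recip k) (ι (suc k)) ⟩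
    toℚᵘ (recip k) ℚᵘ.* toℚᵘ (ι (suc k))
      ≈⟨ ℚᵘₚ.*-cong (toℚᵘ-fromℚᵘ (ℚᵘ.mkℚᵘ (ℤ.+ 1) k)) (toℚᵘ-fromℚᵘ (ℚᵘ.mkℚᵘ (ℤ.+ suc k) 0)) ⟩
    ℚᵘ.mkℚᵘ (ℤ.+ 1) k ℚᵘ.* ℚᵘ.mkℚᵘ (ℤ.+ suc k) 0
      ≈⟨ ℚᵘ.*≡* (trans (ℤₚ.*-identityʳ (1ℤ ℤ.* ℤ.+ suc k)) (sym (cong (λ m → 1ℤ ℤ.* ℤ.+ m) (ℕₚ.*-identityʳ (suc k))))) ⟩
    toℚᵘ 1ℚ                       ∎)
    where open import Relation.Binary.Reasoning.Setoid ℚᵘₚ.≃-setoid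

  p≤ι : ∀ p → p ≤ ι ℤ.∣ ↥ p ∣
  p≤ι p@(mkℚ n d _) = toℚᵘ-cancel-≤ (ℚᵘₚ.≤-trans
    (ℚᵘ.*≤* {q = ℚᵘ.mkℚᵘ (ℤ.+ ℤ.∣ n ∣) 0} (num n))
    (ℚᵘₚ.≤-reflexive (ℚᵘₚ.≃-sym (toℚᵘ-fromℚᵘ (ℚᵘ.mkℚᵘ (ℤ.+ ℤ.∣ n ∣) 0)))))
    where
    num : ∀ n → n ℤ.* ℤ.+ 1 ℤ.≤ ℤ.+ ℤ.∣ n ∣ ℤ.* ℤ.+ suc d
    num (ℤ.+ n)    = subst (ℤ._≤ (ℤ.+ n ℤ.* ℤ.+ suc d)) (ℤₚ.pos-* n 1)
                     (subst (ℤ.+ (n ℕ.* 1) ℤ.≤_) (ℤₚ.pos-* n (suc d)) (ℤ.+≤+ (ℕₚ.*-monoʳ-≤ n (s≤s z≤n))))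
    num -[1+ n ] = ℤ.-≤+

  0≤1 : 0ℚ ≤ 1ℚ
  0≤1 = nonNegative⁻¹ 1ℚ

  0<½ : 0ℚ < ½
  0<½ = positive⁻¹ ½

  *-pos : ∀ {p q} → 0ℚ < p → 0ℚ < q → 0ℚ < p * q
  *-pos {p} {q} 0<p 0<q = positive⁻¹ (p * q) {{pos*pos⇒pos p {{positive 0<p}} q {{positive 0<q}}}}

  *-nonNeg : ∀ {p q} → 0ℚ ≤ p → 0ℚ ≤ q → 0ℚ ≤ p * q
  *-nonNeg {p} {q} 0≤p 0≤q =
    nonNegative⁻¹ (p * q) {{nonNeg*nonNeg⇒nonNeg p {{nonNegative 0≤p}} q {{nonNegative 0≤q}}}}

  *-monoʳ : ∀ {p q r} → 0ℚ ≤ r → p ≤ q → p * r ≤ q * r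
  *-monoʳ {r = r} 0≤r = *-monoʳ-≤-nonNeg r {{nonNegative 0≤r}}

  *-monoˡ : ∀ {p q r} → 0ℚ ≤ r → p ≤ q → r * p ≤ r * q
  *-monoˡ {r = r} 0≤r = *-monoˡ-≤-nonNeg r {{nonNegative 0≤r}}

  *-mono : ∀ {p q r s} → 0ℚ ≤ p → 0ℚ ≤ s → p ≤ q → r ≤ s → p * r ≤ q * s
  *-mono 0≤p 0≤s p≤q r≤s = ≤-trans (*-monoˡ 0≤p r≤s) (*-monoʳ 0≤s p≤q)

  half+half : ∀ p → p * ½ + p * ½ ≡ p
  half+half p = trans (sym (*-distribˡ-+ p ½ ½)) (*-identityʳ p)

  half-pos : ∀ {p} → 0ℚ < p → 0ℚ < p * ½
  half-pos 0<p = *-pos 0<p 0<½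

  ι-mono : ∀ {m n} → m ℕ.≤ n → ι m ≤ ι n
  ι-mono {n = n} z≤n = ι-nonNeg n
  ι-mono {suc m} {suc n} (s≤s m≤n) =
    subst₂ _≤_ (sym (ι-suc m)) (sym (ι-suc n)) (+-monoʳ-≤ 1ℚ (ι-mono m≤n))

  archimedean : ∀ K {ε} → 0ℚ < ε → ∃[ j ] (∀ n → j ℕ.≤ n → K * recip n < ε)
  archimedean K {ε} 0<ε = j , bound
    where
    instance
      ε-pos : Positive ε
      ε-pos = positive 0<ε
      ε-nonZero : NonZero ε
      ε-nonZero = pos⇒nonZero ε
    j = ℤ.∣ ↥ (K * 1/ ε) ∣
    K<ε*suc : ∀ n → j ℕ.≤ n → K < ε * ι (suc n)
    K<ε*suc n j≤n = begin-strict
      K                 ≡⟨ sym (trans (*-assoc K (1/ ε) ε) (trans (cong (K *_) (*-inverseˡ ε)) (*-identityʳ K))) ⟩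
      K * 1/ ε * ε      ≤⟨ *-monoʳ (<⇒≤ 0<ε) (≤-trans (p≤ι (K * 1/ ε)) (ι-mono j≤n)) ⟩
      ι n * ε           ≡⟨ *-comm (ι n) ε ⟩
      ε * ι n           <⟨ *-monoʳ-<-pos ε (subst₂ _<_ (+-identityˡ (ι n)) (sym (ι-suc n)) (+-monoˡ-< (ι n) 0<1)) ⟩
      ε * ι (suc n)     ∎
      where
      open ≤-Reasoning
      0<1 : 0ℚ < 1ℚ
      0<1 = positive⁻¹ 1ℚ
    bound : ∀ n → j ℕ.≤ n → K * recip n < ε
    bound n j≤n = subst (K * recip n <_)
      (trans (*-assoc ε (ι (suc n)) (recip n))
        (trans (cong (ε *_) (trans (*-comm (ι (suc n)) (recip n)) (recip-inv n))) (*-identityʳ ε)))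
      (*-monoˡ-<-pos (recip n) {{positive (0<recip n)}} (K<ε*suc n j≤n))

  1≤ι-suc : ∀ n → 1ℚ ≤ ι (suc n)
  1≤ι-suc n = subst₂ _≤_ (+-identityʳ 1ℚ) (sym (ι-suc n)) (+-monoʳ-≤ 1ℚ (ι-nonNeg n))

  dist : ℚ → ℚ → ℚ
  dist p q = ∣ p - q ∣

  dist-sym : ∀ p q → dist p q ≡ dist q p
  dist-sym p q = trans (cong ∣_∣ (solve 2 (λ p q → p :- q := :- (q :- p)) refl p q)) (∣-p∣≡∣p∣ (q - p))

  dist-tri : ∀ p q r → dist p r ≤ dist p q + dist q r
  dist-tri p q r = subst (λ z → ∣ z ∣ ≤ dist p q + dist q r)
    (solve 3 (λ p q r → (p :- q) :+ (q :- r) := p :- r) refl p q r) (∣p+q∣≤∣p∣+∣q∣ (p - q) (q - r))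

  p≤∣p∣ : ∀ p → p ≤ ∣ p ∣
  p≤∣p∣ p with ≤-total 0ℚ p
  ... | inj₁ 0≤p = ≤-reflexive (sym (0≤p⇒∣p∣≡p 0≤p))
  ... | inj₂ p≤0 = ≤-trans p≤0 (0≤∣p∣ p)

  ≤-dist : ∀ p q → p ≤ q + dist p q
  ≤-dist p q = subst (_≤ q + dist p q) (solve 2 (λ p q → q :+ (p :- q) := p) refl p q)
    (+-monoʳ-≤ q (p≤∣p∣ (p - q)))

  sub≤ : ∀ {p q r} → p ≤ q + r → p - q ≤ r
  sub≤ {p} {q} {r} h = subst (p - q ≤_) (solve 2 (λ q r → (q :+ r) :- q := r) refl q r)
    (+-monoˡ-≤ (- q) h)

  dist≤ : ∀ {p q r} → p ≤ q + r → q ≤ p + r → dist p q ≤ r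
  dist≤ {p} {q} {r} h₁ h₂ with ∣p∣≡p∨∣p∣≡-p (p - q)
  ... | inj₁ e = subst (_≤ r) (sym e) (sub≤ h₁)
  ... | inj₂ e = subst (_≤ r) (sym (trans e (solve 2 (λ p q → :- (p :- q) := q :- p) refl p q))) (sub≤ h₂)

  dist-+ : ∀ p q r s → dist (p + q) (r + s) ≤ dist p r + dist q s
  dist-+ p q r s = subst (λ z → ∣ z ∣ ≤ dist p r + dist q s)
    (solve 4 (λ p q r s → (p :- r) :+ (q :- s) := (p :+ q) :- (r :+ s)) refl p q r s)
    (∣p+q∣≤∣p∣+∣q∣ (p - r) (q - s))

  dist-neg : ∀ p q → dist (- p) (- q) ≡ dist p q
  dist-neg p q = trans (cong ∣_∣ (solve 2 (λ p q → (:- p) :- (:- q) := :- (p :- q)) refl p q)) (∣-p∣≡∣p∣ (p - q))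

  dist-⊔ : ∀ p q r s → dist (p ⊔ q) (r ⊔ s) ≤ dist p r + dist q s
  dist-⊔ p q r s = dist≤ (bound p q r s)
    (subst₂ (λ y z → r ⊔ s ≤ p ⊔ q + (y + z)) (dist-sym r p) (dist-sym s q) (bound r s p q))
    where
    bound : ∀ p q r s → p ⊔ q ≤ r ⊔ s + (dist p r + dist q s)
    bound p q r s = ⊔-lub
      (≤-trans (≤-dist p r) (+-mono-≤ (p≤p⊔q r s) (p≤p+q (dist p r) (0≤∣p∣ (q - s)))))
      (≤-trans (≤-dist q s) (+-mono-≤ (p≤q⊔p r s) (subst (dist q s ≤_) (+-comm (dist q s) (dist p r)) (p≤p+q (dist q s) (0≤∣p∣ (p - r))))))
      where
      p≤p+q : ∀ p {q} → 0ℚ ≤ q → p ≤ p + q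
      p≤p+q p h = subst (_≤ p + _) (+-identityʳ p) (+-monoʳ-≤ p h)

  dist-* : ∀ p q r s → dist (p * q) (r * s) ≤ ∣ p ∣ * dist q s + ∣ s ∣ * dist p r
  dist-* p q r s = subst₂ _≤_
    (cong ∣_∣ (solve 4 (λ p q r s → p :* (q :- s) :+ s :* (p :- r) := p :* q :- r :* s) refl p q r s))
    (cong₂ _+_ (∣p*q∣≡∣p∣*∣q∣ p (q - s)) (∣p*q∣≡∣p∣*∣q∣ s (p - r)))
    (∣p+q∣≤∣p∣+∣q∣ (p * (q - s)) (s * (p - r)))

  dist-∣∣ : ∀ p q → dist ∣ p ∣ ∣ q ∣ ≤ dist p q
  dist-∣∣ p q = dist≤ (bound p q) (subst (λ d → ∣ q ∣ ≤ ∣ p ∣ + d) (dist-sym q p) (bound q p))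
    where
    bound : ∀ p q → ∣ p ∣ ≤ ∣ q ∣ + dist p q
    bound p q = subst (λ z → ∣ z ∣ ≤ ∣ q ∣ + dist p q) (solve 2 (λ p q → q :+ (p :- q) := p) refl p q)
      (∣p+q∣≤∣p∣+∣q∣ q (p - q))

module Limits where
  open import Data.Rational.Base
  open import Data.Rational.Properties
  open +-*-Solver using (solve; _:=_; _:+_; _:*_; :-_; _:-_; con)
  open RationalLemmas

  Small : (ℕ → ℕ → ℚ) → Set
  Small ω = ∀ ε → 0ℚ < ε → ∃[ N ] (∀ m n → N ℕ.≤ m → N ℕ.≤ n → ω m n < ε)

  Null : (ℕ → ℚ) → Set
  Null z = ∀ ε → 0ℚ < ε → ∃[ N ] (∀ n → N ℕ.≤ n → z n < ε)

  small-≤ : ∀ {ω ω′} N₀ → (∀ m n → N₀ ℕ.≤ m → N₀ ℕ.≤ n → ω m n ≤ ω′ m n) → Small ω′ → Small ω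
  small-≤ N₀ h s ε 0<ε with s ε 0<ε
  ... | N , b = N₀ ℕ.⊔ N , λ m n p q →
    ≤-<-trans (h m n (ℕₚ.m⊔n≤o⇒m≤o N₀ N p) (ℕₚ.m⊔n≤o⇒m≤o N₀ N q))
              (b m n (ℕₚ.m⊔n≤o⇒n≤o N₀ N p) (ℕₚ.m⊔n≤o⇒n≤o N₀ N q))

  small-+ : ∀ {ω ω′} → Small ω → Small ω′ → Small (λ m n → ω m n + ω′ m n)
  small-+ s s′ ε 0<ε with s (ε * ½) (half-pos 0<ε) | s′ (ε * ½) (half-pos 0<ε)
  ... | N , b | N′ , b′ = N ℕ.⊔ N′ , λ m n p q → subst (_ <_) (half+half ε)
    (+-mono-< (b m n (ℕₚ.m⊔n≤o⇒m≤o N N′ p) (ℕₚ.m⊔n≤o⇒m≤o N N′ q))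
              (b′ m n (ℕₚ.m⊔n≤o⇒n≤o N N′ p) (ℕₚ.m⊔n≤o⇒n≤o N N′ q)))

  small-* : ∀ {ω K} → 0ℚ < K → Small ω → Small (λ m n → K * ω m n)
  small-* {ω} {K} 0<K s ε 0<ε with s (1/K * ε) (*-pos 0<1/K 0<ε)
    where
    1/K = (1/ K) {{pos⇒nonZero K {{positive 0<K}}}}
    0<1/K : 0ℚ < 1/K
    0<1/K = positive⁻¹ 1/K {{1/pos⇒pos K {{positive 0<K}}}}
  ... | N , b = N , λ m n p q → subst (K * ω m n <_)
    (trans (sym (*-assoc K _ ε)) (trans (cong (_* ε) (*-inverseʳ K {{pos⇒nonZero K {{positive 0<K}}}})) (*-identityˡ ε)))
    (*-monoʳ-<-pos K {{positive 0<K}} (b m n p q))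

  null-recip : ∀ K → Null (λ n → K * recip n)
  null-recip K ε 0<ε = archimedean K 0<ε

  null-suc : ∀ {z} → Null (λ n → z (suc n)) → Null z
  null-suc h ε 0<ε with h ε 0<ε
  ... | N , b = suc N , λ { (suc n) (s≤s p) → b n p }

  small₁ : ∀ {z} → Null z → Small (λ m _ → z m)
  small₁ h ε 0<ε with h ε 0<ε
  ... | N , b = N , λ m _ p _ → b m p

  small₂ : ∀ {z} → Null z → Small (λ _ n → z n)
  small₂ h ε 0<ε with h ε 0<ε
  ... | N , b = N , λ _ n _ q → b n q

  diagonal : ∀ {ω} → Small ω → Null (λ n → ω n n)
  diagonal h ε 0<ε with h ε 0<ε
  ... | N , b = N , λ n p → b n n p p

  Cauchy : (ℕ → ℚ) → Set
  Cauchy s = Small (λ m n → ∣ s m - s n ∣)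

  0<1 : 0ℚ < 1ℚ
  0<1 = positive⁻¹ 1ℚ

  bounded : ∀ s → Cauchy s → ∃[ B ] 0ℚ < B × ∃[ N ] (∀ n → N ℕ.≤ n → ∣ s n ∣ ≤ B)
  bounded s c with c 1ℚ 0<1
  ... | N , b = ∣ s N ∣ + 1ℚ , +-mono-≤-< (0≤∣p∣ (s N)) 0<1 , N , λ n p → begin
    ∣ s n ∣                     ≡⟨ cong ∣_∣ (solve 2 (λ a b → a := b :+ (a :- b)) refl (s n) (s N)) ⟩
    ∣ s N + (s n - s N) ∣       ≤⟨ ∣p+q∣≤∣p∣+∣q∣ (s N) (s n - s N) ⟩
    ∣ s N ∣ + ∣ s n - s N ∣     ≤⟨ +-monoʳ-≤ ∣ s N ∣ (<⇒≤ (b n N p ℕₚ.≤-refl)) ⟩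
    ∣ s N ∣ + 1ℚ                ∎
    where open ≤-Reasoning

  abstract
    +-cauchy : ∀ s t → Cauchy s → Cauchy t → Cauchy (λ n → s n + t n)
    +-cauchy s t cs ct = small-≤ 0 (λ m n _ _ → dist-+ (s m) (t m) (s n) (t n)) (small-+ cs ct)

    neg-cauchy : ∀ s → Cauchy s → Cauchy (λ n → - s n)
    neg-cauchy s = small-≤ 0 (λ m n _ _ → ≤-reflexive (dist-neg (s m) (s n)))

  abstract
    ⊔-cauchy : ∀ s t → Cauchy s → Cauchy t → Cauchy (λ n → s n ⊔ t n)
    ⊔-cauchy s t cs ct = small-≤ 0 (λ m n _ _ → dist-⊔ (s m) (t m) (s n) (t n)) (small-+ cs ct)

    ∣∣-cauchy : ∀ s → Cauchy s → Cauchy (λ n → ∣ s n ∣)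
    ∣∣-cauchy s = small-≤ 0 (λ m n _ _ → dist-∣∣ (s m) (s n))

  abstract
    shift-cauchy : ∀ {s} N → Cauchy s → Cauchy (λ n → s (N ℕ.+ n))
    shift-cauchy N cs ε 0<ε = let (N′ , h) = cs ε 0<ε in
      N′ , λ m n p q → h (N ℕ.+ m) (N ℕ.+ n) (ℕₚ.m≤n⇒m≤o+n N p) (ℕₚ.m≤n⇒m≤o+n N q)

    const-cauchy : ∀ q → Cauchy (λ _ → q)
    const-cauchy q ε 0<ε = 0 , λ _ _ _ _ → subst (_< ε) (sym (cong ∣_∣ (+-inverseʳ q))) 0<ε

  dist-*-bound : ∀ p q r s {B B′} → ∣ p ∣ ≤ B → ∣ s ∣ ≤ B′ → dist (p * q) (r * s) ≤ B * dist q s + B′ * dist p r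
  dist-*-bound p q r s {B} {B′} hp hs = ≤-trans {dist (p * q) (r * s)} {∣ p ∣ * dist q s + ∣ s ∣ * dist p r} {B * dist q s + B′ * dist p r} (dist-* p q r s)
    (+-mono-≤ {∣ p ∣ * dist q s} {B * dist q s} {∣ s ∣ * dist p r} {B′ * dist p r} (*-monoʳ {∣ p ∣} {B} {dist q s} (0≤∣p∣ (q - s)) hp) (*-monoʳ {∣ s ∣} {B′} {dist p r} (0≤∣p∣ (p - r)) hs))

  EventuallyBounded : (ℕ → ℚ) → Set
  EventuallyBounded s = ∃[ B ] 0ℚ < B × ∃[ N ] (∀ n → N ℕ.≤ n → ∣ s n ∣ ≤ B)

  abstract
    *-cauchy : ∀ s t → Cauchy s → Cauchy t → Cauchy (λ n → s n * t n)
    *-cauchy s t cs ct = from (bounded s cs) (bounded t ct)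
      where
      from : EventuallyBounded s → EventuallyBounded t → Cauchy (λ n → s n * t n)
      from (B , 0<B , N , bs) (B′ , 0<B′ , N′ , bt) =
        small-≤ (N ℕ.⊔ N′)
          (λ m n p q → dist-*-bound (s m) (t m) (s n) (t n) (bs m (ℕₚ.m⊔n≤o⇒m≤o N N′ p)) (bt n (ℕₚ.m⊔n≤o⇒n≤o N N′ q)))
          (small-+ (small-* 0<B ct) (small-* 0<B′ cs))

  module Inverse (s : ℕ → ℚ) (cs : Cauchy s) {δ} (0<δ : 0ℚ < δ) (δ≤s : ∀ n → δ ≤ ∣ s n ∣) where
    s≢0 : ∀ n → NonZero (s n)
    s≢0 n = ≢-nonZero (λ e → <⇒≢ (<-≤-trans 0<δ (δ≤s n)) (sym (cong ∣_∣ e)))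

    inv : ℕ → ℚ
    inv n = (1/ s n) {{s≢0 n}}

    private
      1/δ = (1/ δ) {{pos⇒nonZero δ {{positive 0<δ}}}}
      0<1/δ : 0ℚ < 1/δ
      0<1/δ = positive⁻¹ 1/δ {{1/pos⇒pos δ {{positive 0<δ}}}}

      s*inv : ∀ n → s n * inv n ≡ 1ℚ
      s*inv n = *-inverseʳ (s n) {{s≢0 n}}

      ∣inv∣≤ : ∀ n → ∣ inv n ∣ ≤ 1/δ
      ∣inv∣≤ n = begin
        ∣ inv n ∣                 ≡⟨ sym (trans (cong (∣ inv n ∣ *_) (*-inverseʳ δ {{pos⇒nonZero δ {{positive 0<δ}}}})) (*-identityʳ _)) ⟩
        ∣ inv n ∣ * (δ * 1/δ)     ≤⟨ *-monoˡ (0≤∣p∣ (inv n)) (*-monoʳ (<⇒≤ 0<1/δ) (δ≤s n)) ⟩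
        ∣ inv n ∣ * (∣ s n ∣ * 1/δ) ≡⟨ sym (*-assoc ∣ inv n ∣ ∣ s n ∣ 1/δ) ⟩
        ∣ inv n ∣ * ∣ s n ∣ * 1/δ ≡⟨ cong (_* 1/δ) (sym (∣p*q∣≡∣p∣*∣q∣ (inv n) (s n))) ⟩
        ∣ inv n * s n ∣ * 1/δ     ≡⟨ cong (λ z → ∣ z ∣ * 1/δ) (trans (*-comm (inv n) (s n)) (s*inv n)) ⟩
        1ℚ * 1/δ                  ≡⟨ *-identityˡ 1/δ ⟩
        1/δ                       ∎
        where open ≤-Reasoning

    abstract
      inv-cauchy : Cauchy inv
      inv-cauchy = small-≤ 0 (λ m n _ _ → bound m n) (small-* (*-pos 0<1/δ 0<1/δ) cs)
        where
        difference : ∀ m n → inv m - inv n ≡ (inv m * inv n) * (s n - s m)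
        difference m n = sym (begin
          (inv m * inv n) * (s n - s m)
            ≡⟨ solve 4 (λ i j a b → (i :* j) :* (b :- a) := i :* (b :* j) :- j :* (a :* i)) refl (inv m) (inv n) (s m) (s n) ⟩
          inv m * (s n * inv n) - inv n * (s m * inv m)
            ≡⟨ cong₂ (λ y z → inv m * y - inv n * z) (s*inv n) (s*inv m) ⟩
          inv m * 1ℚ - inv n * 1ℚ
            ≡⟨ cong₂ _-_ (*-identityʳ (inv m)) (*-identityʳ (inv n)) ⟩
          inv m - inv n ∎)
          where open ≡-Reasoning
        bound : ∀ m n → ∣ inv m - inv n ∣ ≤ (1/δ * 1/δ) * ∣ s m - s n ∣
        bound m n = begin
          ∣ inv m - inv n ∣                          ≡⟨ cong ∣_∣ (difference m n) ⟩
          ∣ (inv m * inv n) * (s n - s m) ∣          ≡⟨ ∣p*q∣≡∣p∣*∣q∣ (inv m * inv n) (s n - s m) ⟩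
          ∣ inv m * inv n ∣ * ∣ s n - s m ∣          ≡⟨ cong₂ _*_ (∣p*q∣≡∣p∣*∣q∣ (inv m) (inv n)) (dist-sym (s n) (s m)) ⟩
          (∣ inv m ∣ * ∣ inv n ∣) * ∣ s m - s n ∣    ≤⟨ *-monoʳ (0≤∣p∣ (s m - s n)) (*-mono (0≤∣p∣ (inv m)) (<⇒≤ 0<1/δ) (∣inv∣≤ m) (∣inv∣≤ n)) ⟩
          (1/δ * 1/δ) * ∣ s m - s n ∣                ∎
          where open ≤-Reasoning

-- expTerm a k = aᵏ/k! and expSum a n = Σ_{k ≤ n} aᵏ/k!
expTerm : ℚ → ℕ → ℚ
expTerm a zero    = 1ℚ
expTerm a (suc k) = expTerm a k ℚ.* a ℚ.* (1ℤ ℚ./ suc k)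

expSum : ℚ → ℕ → ℚ
expSum a zero    = expTerm a 0
expSum a (suc n) = expSum a n ℚ.+ expTerm a (suc n)

module ExpLemmas where
  open import Data.Rational.Base
  open import Data.Rational.Properties
  open +-*-Solver using (solve; _:=_; _:+_; _:*_; :-_; _:-_; con)
  open RationalLemmas
  open Limits

  T = expTerm
  S = expSum

  0≤recip : ∀ k → 0ℚ ≤ recip k
  0≤recip k = <⇒≤ (0<recip k)

  T-nonNeg : ∀ {a} → 0ℚ ≤ a → ∀ k → 0ℚ ≤ T a k
  T-nonNeg 0≤a zero    = 0≤1
  T-nonNeg 0≤a (suc k) = *-nonNeg (*-nonNeg (T-nonNeg 0≤a k) 0≤a) (0≤recip k)

  S-nonNeg : ∀ {a} → 0ℚ ≤ a → ∀ k → 0ℚ ≤ S a k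
  S-nonNeg 0≤a zero    = 0≤1
  S-nonNeg 0≤a (suc k) = +-mono-≤ (S-nonNeg 0≤a k) (T-nonNeg 0≤a (suc k))

  T-abs : ∀ {a b} → ∣ a ∣ ≤ b → ∀ k → ∣ T a k ∣ ≤ T b k
  T-abs h zero = ≤-refl
  T-abs {a} {b} h (suc k) = begin
    ∣ T a k * a * recip k ∣        ≡⟨ ∣p*q∣≡∣p∣*∣q∣ (T a k * a) (recip k) ⟩
    ∣ T a k * a ∣ * ∣ recip k ∣    ≡⟨ cong₂ _*_ (∣p*q∣≡∣p∣*∣q∣ (T a k) a) (0≤p⇒∣p∣≡p (0≤recip k)) ⟩
    ∣ T a k ∣ * ∣ a ∣ * recip k    ≤⟨ *-monoʳ (0≤recip k) (*-mono (0≤∣p∣ (T a k)) (≤-trans (0≤∣p∣ a) h) (T-abs h k) h) ⟩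
    T b k * b * recip k            ∎
    where open ≤-Reasoning

  T-mono : ∀ {a b} → 0ℚ ≤ a → a ≤ b → ∀ k → T a k ≤ T b k
  T-mono 0≤a a≤b zero    = ≤-refl
  T-mono 0≤a a≤b (suc k) = *-monoʳ (0≤recip k) (*-mono (T-nonNeg 0≤a k) (≤-trans 0≤a a≤b) (T-mono 0≤a a≤b k) a≤b)

  T-one : ∀ a → T a 1 ≡ a
  T-one a = trans (*-identityʳ (1ℚ * a)) (*-identityˡ a)

  T-lipschitz : ∀ {a b c} → ∣ a ∣ ≤ c → ∣ b ∣ ≤ c → ∀ k → dist (T a (suc k)) (T b (suc k)) ≤ dist a b * T c k
  T-lipschitz {a} {b} ha hb zero =
    ≤-reflexive (trans (cong₂ dist (T-one a) (T-one b)) (sym (*-identityʳ (dist a b))))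
  T-lipschitz {a} {b} {c} ha hb (suc k) = begin
    ∣ T a (suc k) * a * r - T b (suc k) * b * r ∣
      ≡⟨ cong ∣_∣ (solve 3 (λ x y r → x :* r :- y :* r := (x :- y) :* r) refl (T a (suc k) * a) (T b (suc k) * b) r) ⟩
    ∣ (T a (suc k) * a - T b (suc k) * b) * r ∣
      ≡⟨ trans (∣p*q∣≡∣p∣*∣q∣ (T a (suc k) * a - T b (suc k) * b) r) (cong (∣ T a (suc k) * a - T b (suc k) * b ∣ *_) (0≤p⇒∣p∣≡p (0≤recip (suc k)))) ⟩
    dist (T a (suc k) * a) (T b (suc k) * b) * r
      ≤⟨ *-monoʳ (0≤recip (suc k)) (dist-* (T a (suc k)) a (T b (suc k)) b) ⟩
    (∣ T a (suc k) ∣ * D + ∣ b ∣ * dist (T a (suc k)) (T b (suc k))) * r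
      ≤⟨ *-monoʳ (0≤recip (suc k)) (+-mono-≤ (*-monoʳ (0≤∣p∣ (a - b)) (T-abs ha (suc k)))
           (*-mono (0≤∣p∣ b) (*-nonNeg (0≤∣p∣ (a - b)) (T-nonNeg 0≤c k)) hb (T-lipschitz ha hb k))) ⟩
    (T c (suc k) * D + c * (D * T c k)) * r
      ≡⟨ cong (λ z → (T c (suc k) * D + z) * r) c*T ⟩
    (T c (suc k) * D + (D * T c (suc k)) * ι (suc k)) * r
      ≡⟨ solve 4 (λ t D n r → (t :* D :+ (D :* t) :* n) :* r := (D :* t) :* (r :* (con 1ℚ :+ n))) refl (T c (suc k)) D (ι (suc k)) r ⟩
    (D * T c (suc k)) * (r * (1ℚ + ι (suc k)))
      ≡⟨ cong (λ z → (D * T c (suc k)) * (r * z)) (sym (ι-suc (suc k))) ⟩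
    (D * T c (suc k)) * (r * ι (suc (suc k)))
      ≡⟨ trans (cong ((D * T c (suc k)) *_) (recip-inv (suc k))) (*-identityʳ (D * T c (suc k))) ⟩
    D * T c (suc k) ∎
    where
    open ≤-Reasoning
    r = recip (suc k)
    D = dist a b
    0≤c : 0ℚ ≤ c
    0≤c = ≤-trans (0≤∣p∣ a) ha
    c*T : c * (D * T c k) ≡ (D * T c (suc k)) * ι (suc k)
    c*T = sym (trans
      (solve 5 (λ D t c r n → (D :* (t :* c :* r)) :* n := (c :* (D :* t)) :* (r :* n)) refl D (T c k) c (recip k) (ι (suc k)))
      (trans (cong ((c * (D * T c k)) *_) (recip-inv k)) (*-identityʳ _)))

  S-lipschitz : ∀ {a b c} → ∣ a ∣ ≤ c → ∣ b ∣ ≤ c → ∀ n → dist (S a (suc n)) (S b (suc n)) ≤ dist a b * S c n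
  S-lipschitz {a} {b} {c} ha hb zero = ≤-trans (dist-+ 1ℚ (T a 1) 1ℚ (T b 1))
    (subst (_≤ dist a b * 1ℚ) (sym (+-identityˡ (dist (T a 1) (T b 1)))) (T-lipschitz ha hb 0))
  S-lipschitz {a} {b} {c} ha hb (suc n) =
    ≤-trans (dist-+ (S a (suc n)) (T a (suc (suc n))) (S b (suc n)) (T b (suc (suc n))))
      (subst (_ ≤_) (sym (*-distribˡ-+ (dist a b) (S c n) (T c (suc n))))
        (+-mono-≤ (S-lipschitz ha hb n) (T-lipschitz ha hb (suc n))))

  S-tail : ∀ {a b} → ∣ a ∣ ≤ b → ∀ m j → dist (S a m) (S a (j ℕ.+ m)) ≤ S b (j ℕ.+ m) - S b m
  S-tail {a} {b} h m zero = ≤-reflexive (trans (cong ∣_∣ (+-inverseʳ (S a m))) (sym (+-inverseʳ (S b m))))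
  S-tail {a} {b} h m (suc j) = begin
    dist (S a m) (S a (j ℕ.+ m) + t)             ≤⟨ dist-tri (S a m) (S a (j ℕ.+ m)) (S a (j ℕ.+ m) + t) ⟩
    dist (S a m) (S a (j ℕ.+ m)) + dist (S a (j ℕ.+ m)) (S a (j ℕ.+ m) + t)
      ≡⟨ cong (dist (S a m) (S a (j ℕ.+ m)) +_) (trans (cong ∣_∣ (solve 2 (λ s t → s :- (s :+ t) := :- t) refl (S a (j ℕ.+ m)) t)) (∣-p∣≡∣p∣ t)) ⟩
    dist (S a m) (S a (j ℕ.+ m)) + ∣ t ∣         ≤⟨ +-mono-≤ (S-tail h m j) (T-abs h (suc (j ℕ.+ m))) ⟩
    (S b (j ℕ.+ m) - S b m) + T b (suc (j ℕ.+ m))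
      ≡⟨ solve 3 (λ x y t → (x :- y) :+ t := (x :+ t) :- y) refl (S b (j ℕ.+ m)) (S b m) (T b (suc (j ℕ.+ m))) ⟩
    S b (suc j ℕ.+ m) - S b m                    ∎
    where
    open ≤-Reasoning
    t = T a (suc (j ℕ.+ m))

  module Bound (b : ℚ) (0≤b : 0ℚ ≤ b) where
    M : ℕ
    M = proj₁ (archimedean b 0<½)

    T-halves : ∀ n → M ℕ.≤ n → T b (suc n) ≤ T b n * ½
    T-halves n p = subst (_≤ T b n * ½) (sym (*-assoc (T b n) b (recip n)))
      (*-monoˡ (T-nonNeg 0≤b n) (<⇒≤ (proj₂ (archimedean b 0<½) n p)))

    S+T-step : ∀ n → M ℕ.≤ n → S b (suc n) + T b (suc n) ≤ S b n + T b n
    S+T-step n p = begin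
      (S b n + T b (suc n)) + T b (suc n)   ≤⟨ +-mono-≤ (+-monoʳ-≤ (S b n) (T-halves n p)) (T-halves n p) ⟩
      (S b n + T b n * ½) + T b n * ½       ≡⟨ trans (+-assoc (S b n) (T b n * ½) (T b n * ½)) (cong (S b n +_) (half+half (T b n))) ⟩
      S b n + T b n                         ∎
      where open ≤-Reasoning

    S+T-antitone : ∀ m j → M ℕ.≤ m → S b (j ℕ.+ m) + T b (j ℕ.+ m) ≤ S b m + T b m
    S+T-antitone m zero    p = ≤-refl
    S+T-antitone m (suc j) p = ≤-trans (S+T-step (j ℕ.+ m) (ℕₚ.≤-trans p (ℕₚ.m≤n+m m j))) (S+T-antitone m j p)

    S≤S+T : ∀ n → S b n ≤ S b n + T b n
    S≤S+T n = subst (_≤ S b n + T b n) (+-identityʳ (S b n)) (+-monoʳ-≤ (S b n) (T-nonNeg 0≤b n))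

    tail≤ : ∀ m j → M ℕ.≤ m → S b (j ℕ.+ m) - S b m ≤ T b m
    tail≤ m j p = sub≤ (≤-trans (S≤S+T (j ℕ.+ m)) (S+T-antitone m j p))

    K : ℚ
    K = S b M + T b M

    0<K : 0ℚ < K
    0<K = <-≤-trans (positive⁻¹ 1ℚ) (≤-trans (1≤S M) (S≤S+T M))
      where
      1≤S : ∀ n → 1ℚ ≤ S b n
      1≤S zero    = ≤-refl
      1≤S (suc n) = subst (_≤ S b (suc n)) (+-identityʳ 1ℚ) (+-mono-≤ (1≤S n) (T-nonNeg 0≤b (suc n)))

    S≤K : ∀ n → M ℕ.≤ n → S b n ≤ K
    S≤K n p = ≤-trans (S≤S+T n) (subst (λ k → S b k + T b k ≤ K) (ℕₚ.m∸n+n≡m p) (S+T-antitone M (n ℕ.∸ M) ℕₚ.≤-refl))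

    T≤K : ∀ n → M ℕ.≤ n → T b n ≤ K
    T≤K n p = ≤-trans (subst (_≤ S b n + T b n) (+-identityˡ (T b n)) (+-monoˡ-≤ (T b n) (S-nonNeg 0≤b n)))
      (subst (λ k → S b k + T b k ≤ K) (ℕₚ.m∸n+n≡m p) (S+T-antitone M (n ℕ.∸ M) ℕₚ.≤-refl))

    T-null : Null (T b)
    T-null = null-suc λ ε 0<ε → let (N , h) = null-recip (K * b) ε 0<ε in
      M ℕ.⊔ N , λ n p → ≤-<-trans
        (*-monoʳ (0≤recip n) (*-monoʳ 0≤b (T≤K n (ℕₚ.m⊔n≤o⇒m≤o M N p))))
        (h n (ℕₚ.m⊔n≤o⇒n≤o M N p))

    -- the partial sums at m and n differ little, uniformly in |a| ≤ b
    S-uniform : ∀ {a} → ∣ a ∣ ≤ b → ∀ m n → M ℕ.≤ m → M ℕ.≤ n → dist (S a m) (S a n) ≤ T b m + T b n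
    S-uniform {a} h m n p q with ℕₚ.≤-total m n
    ... | inj₁ m≤n = ≤-trans (subst (λ k → dist (S a m) (S a k) ≤ T b m) (ℕₚ.m∸n+n≡m m≤n)
                        (≤-trans (S-tail h m (n ℕ.∸ m)) (tail≤ m (n ℕ.∸ m) p)))
                      (subst (_≤ T b m + T b n) (+-identityʳ (T b m)) (+-monoʳ-≤ (T b m) (T-nonNeg 0≤b n)))
    ... | inj₂ n≤m = ≤-trans (subst (_≤ T b n) (dist-sym (S a n) (S a m)) (subst (λ k → dist (S a n) (S a k) ≤ T b n) (ℕₚ.m∸n+n≡m n≤m)
                        (≤-trans (S-tail h n (m ℕ.∸ n)) (tail≤ n (m ℕ.∸ n) q))))
                      (subst (_≤ T b m + T b n) (+-identityˡ (T b n)) (+-monoˡ-≤ (T b n) (T-nonNeg 0≤b m)))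

    S-lip : ∀ {a c} → ∣ a ∣ ≤ b → ∣ c ∣ ≤ b → ∀ n → suc M ℕ.≤ n → dist (S a n) (S c n) ≤ K * dist a c
    S-lip {a} {c} ha hc (suc n) (s≤s p) = ≤-trans (S-lipschitz ha hc n)
      (subst (dist a c * S b n ≤_) (*-comm (dist a c) K) (*-monoˡ (0≤∣p∣ (a - c)) (S≤K n p)))

  abstract
    exp-cauchy : ∀ s → Cauchy s → Cauchy (λ n → S (s n) n)
    exp-cauchy s cs = from (bounded s cs)
      where
      from : EventuallyBounded s → Cauchy (λ n → S (s n) n)
      from (B , 0<B , N , h) = small-≤ (suc M ℕ.⊔ N)
        (λ m n p q → ≤-trans (dist-tri (S (s m) m) (S (s n) m) (S (s n) n)) (+-mono-≤
          (S-lip (h m (ℕₚ.m⊔n≤o⇒n≤o (suc M) N p)) (h n (ℕₚ.m⊔n≤o⇒n≤o (suc M) N q)) m (ℕₚ.m⊔n≤o⇒m≤o (suc M) N p))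
          (S-uniform (h n (ℕₚ.m⊔n≤o⇒n≤o (suc M) N q)) m n
            (ℕₚ.<⇒≤ (ℕₚ.m⊔n≤o⇒m≤o (suc M) N p)) (ℕₚ.<⇒≤ (ℕₚ.m⊔n≤o⇒m≤o (suc M) N q)))))
        (small-+ (small-* 0<K cs) (small-+ (small₁ T-null) (small₂ T-null)))
        where open Bound B (<⇒≤ 0<B)

  -- the partial sums have slope ≥ 1 on the non-negative rationals
  S-slope : ∀ {a b} → 0ℚ ≤ a → a ≤ b → ∀ n → S a (suc n) + (b - a) ≤ S b (suc n)
  S-slope {a} {b} 0≤a a≤b zero = ≤-reflexive (trans (cong (λ z → 1ℚ + z + (b - a)) (T-one a))
    (trans (solve 2 (λ a b → con 1ℚ :+ a :+ (b :- a) := con 1ℚ :+ b) refl a b) (cong (1ℚ +_) (sym (T-one b)))))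
  S-slope {a} {b} 0≤a a≤b (suc n) = subst (_≤ S b (suc (suc n)))
    (solve 3 (λ s d t → (s :+ d) :+ t := (s :+ t) :+ d) refl (S a (suc n)) (b - a) (T a (suc (suc n))))
    (+-mono-≤ (S-slope 0≤a a≤b n) (T-mono 0≤a a≤b (suc (suc n))))

  private
    expand : ∀ {a b} → 0ℚ ≤ a → a ≤ b → ∀ n → dist a b ≤ dist (S a (suc n)) (S b (suc n))
    expand {a} {b} 0≤a a≤b n = dist≤
      (≤-trans a≤b (subst (_≤ b + r) (+-identityʳ b) (+-monoʳ-≤ b (0≤∣p∣ _))))
      (subst (_≤ a + r) (solve 2 (λ a b → a :+ (b :- a) := b) refl a b) (+-monoʳ-≤ a b-a≤r))
      where
      s = S a (suc n)
      r = dist s (S b (suc n))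
      b-a≤r : b - a ≤ r
      b-a≤r = subst (_≤ r) (solve 2 (λ s d → (s :+ d) :- s := d) refl s (b - a))
        (sub≤ (≤-trans (S-slope 0≤a a≤b n)
          (subst (λ d → S b (suc n) ≤ s + d) (dist-sym (S b (suc n)) s) (≤-dist (S b (suc n)) s))))

  S-expands : ∀ {a b} → 0ℚ ≤ a → 0ℚ ≤ b → ∀ n → dist a b ≤ dist (S a (suc n)) (S b (suc n))
  S-expands {a} {b} 0≤a 0≤b n with ≤-total a b
  ... | inj₁ a≤b = expand 0≤a a≤b n
  ... | inj₂ b≤a = subst₂ _≤_ (dist-sym b a) (dist-sym (S b (suc n)) (S a (suc n))) (expand 0≤b b≤a n)

-- gridRoot x n M is the least i ≤ M with x ≤ Σ_{k ≤ n} (i/(n+1))ᵏ/k! (the right-hand side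
-- being increasing in i), so i/(n+1) approximates log x for x ≥ 1; M is chosen in
-- logApprox so large that, for n ≥ 1, the inequality holds at i = M.
gridPoint : ℕ → ℕ → ℚ
gridPoint n i = ℕtoℚ i ℚ.* (1ℤ ℚ./ suc n)

gridRoot : ℚ → ℕ → ℕ → ℕ
gridRoot x n zero    = 0
gridRoot x n (suc i) = if does (x ℚₚ.≤? expSum (gridPoint n i) n) then gridRoot x n i else suc i

logApprox : ℚ → ℕ → ℚ
logApprox x n = gridPoint n (gridRoot x n ℤ.∣ ℚ.↥ (x ℚ.* ℕtoℚ (suc n)) ∣)

module LogLemmas where
  open import Data.Rational.Base
  open import Data.Rational.Properties
  open +-*-Solver using (solve; _:=_; _:+_; _:*_; :-_; _:-_; con)
  open RationalLemmas
  open Limits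
  open ExpLemmas

  recip≤1 : ∀ n → recip n ≤ 1ℚ
  recip≤1 n = subst₂ _≤_ (*-identityʳ (recip n)) (recip-inv n)
    (*-monoˡ (0≤recip n) (1≤ι-suc n))

  grid-nonNeg : ∀ n i → 0ℚ ≤ gridPoint n i
  grid-nonNeg n i = *-nonNeg (ι-nonNeg i) (0≤recip n)

  grid-zero : ∀ n → gridPoint n 0 ≡ 0ℚ
  grid-zero n = *-zeroˡ (recip n)

  grid-suc : ∀ n i → gridPoint n (suc i) ≡ gridPoint n i + recip n
  grid-suc n i = trans (cong (_* recip n) (ι-suc i))
    (solve 2 (λ a r → (con 1ℚ :+ a) :* r := a :* r :+ r) refl (ι i) (recip n))

  T-zero : ∀ k → T 0ℚ (suc k) ≡ 0ℚ
  T-zero k = trans (cong (_* recip k) (*-zeroʳ (T 0ℚ k))) (*-zeroˡ (recip k))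

  S-zero : ∀ n → S 0ℚ n ≡ 1ℚ
  S-zero zero    = refl
  S-zero (suc n) = trans (cong₂ _+_ (S-zero n) (T-zero n)) (+-identityʳ 1ℚ)

  S-mono : ∀ {a b} → 0ℚ ≤ a → a ≤ b → ∀ n → S a n ≤ S b n
  S-mono 0≤a a≤b zero    = ≤-refl
  S-mono 0≤a a≤b (suc n) = +-mono-≤ (S-mono 0≤a a≤b n) (T-mono 0≤a a≤b (suc n))

  a≤S : ∀ {a} → 0ℚ ≤ a → ∀ n → a ≤ S a (suc n)
  a≤S {a} 0≤a n = ≤-trans
    (subst (_≤ S 0ℚ (suc n) + (a - 0ℚ)) (solve 1 (λ a → con 0ℚ :+ (a :- con 0ℚ) := a) refl a)
      (+-monoˡ-≤ (a - 0ℚ) (S-nonNeg ≤-refl (suc n))))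
    (S-slope ≤-refl 0≤a n)

  RootSpec : ℚ → ℕ → ℕ → Set
  RootSpec x n r = x ≤ S (gridPoint n r) n × (r ≡ 0 ⊎ ∃[ i ] (r ≡ suc i × S (gridPoint n i) n < x))

  root-spec : ∀ x n i → x ≤ S (gridPoint n i) n → RootSpec x n (gridRoot x n i)
  root-spec x n zero    h = h , inj₁ refl
  root-spec x n (suc i) h = step (x ≤? S (gridPoint n i) n)
    where
    step : (d : Dec (x ≤ S (gridPoint n i) n)) → RootSpec x n (if does d then gridRoot x n i else suc i)
    step (yes p) = root-spec x n i p
    step (no ¬p) = h , inj₂ (i , refl , ≰⇒> ¬p)

  log-spec : ∀ x n → ∃[ r ] (logApprox x (suc n) ≡ gridPoint (suc n) r × RootSpec x (suc n) r)
  log-spec x n = _ , refl , root-spec x (suc n) fuel (≤-trans x≤grid (a≤S (grid-nonNeg (suc n) fuel) n))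
    where
    fuel : ℕ
    fuel = ℤ.∣ ↥ (x * ι (suc (suc n))) ∣
    x≤grid : x ≤ gridPoint (suc n) fuel
    x≤grid = subst (_≤ gridPoint (suc n) fuel)
      (trans (*-assoc x (ι (suc (suc n))) (recip (suc n)))
        (trans (cong (x *_) (trans (*-comm (ι (suc (suc n))) (recip (suc n))) (recip-inv (suc n)))) (*-identityʳ x)))
      (*-monoʳ (0≤recip (suc n)) (p≤ι (x * ι (suc (suc n)))))

  log-nonNeg : ∀ x n → 0ℚ ≤ logApprox x n
  log-nonNeg x n = grid-nonNeg n (gridRoot x n ℤ.∣ ↥ (x * ι (suc n)) ∣)

  x≤exp-log : ∀ x n → x ≤ S (logApprox x (suc n)) (suc n)
  x≤exp-log x n = from (log-spec x n)
    where
    from : ∃[ r ] (logApprox x (suc n) ≡ gridPoint (suc n) r × RootSpec x (suc n) r) → x ≤ S (logApprox x (suc n)) (suc n)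
    from (r , e , h , _) = subst (λ q → x ≤ S q (suc n)) (sym e) h

  log≤ : ∀ x n {B} → 0ℚ ≤ B → x ≤ B → logApprox x (suc n) ≤ B + 1ℚ
  log≤ x n {B} 0≤B x≤B = from (log-spec x n)
    where
    open ≤-Reasoning
    from : ∃[ r ] (logApprox x (suc n) ≡ gridPoint (suc n) r × RootSpec x (suc n) r) → logApprox x (suc n) ≤ B + 1ℚ
    from (r , e , _ , inj₁ r≡0) = begin
      logApprox x (suc n)              ≡⟨ trans e (trans (cong (gridPoint (suc n)) r≡0) (grid-zero (suc n))) ⟩
      0ℚ                               ≤⟨ +-mono-≤ 0≤B 0≤1 ⟩
      B + 1ℚ                           ∎
    from (r , e , _ , inj₂ (i , r≡ , S<x)) = begin
      logApprox x (suc n)              ≡⟨ trans e (trans (cong (gridPoint (suc n)) r≡) (grid-suc (suc n) i)) ⟩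
      gridPoint (suc n) i + recip (suc n)
        ≤⟨ +-mono-≤ (≤-trans (a≤S (grid-nonNeg (suc n) i) n) (≤-trans (<⇒≤ S<x) x≤B)) (recip≤1 (suc n)) ⟩
      B + 1ℚ                           ∎

  exp-log≤ : ∀ x n {b} (0≤b : 0ℚ ≤ b) → logApprox x (suc n) ≤ b → Bound.M b 0≤b ℕ.≤ n →
    S (logApprox x (suc n)) (suc n) ≤ 1ℚ ⊎ S (logApprox x (suc n)) (suc n) ≤ x + Bound.K b 0≤b * recip (suc n)
  exp-log≤ x n {b} 0≤b q≤b M≤n = from (log-spec x n)
    where
    open ≤-Reasoning
    open Bound b 0≤b
    q = logApprox x (suc n)
    from : ∃[ r ] (q ≡ gridPoint (suc n) r × RootSpec x (suc n) r) → S q (suc n) ≤ 1ℚ ⊎ S q (suc n) ≤ x + K * recip (suc n)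
    from (r , e , _ , inj₁ r≡0) =
      inj₁ (≤-reflexive (trans (cong (λ a → S a (suc n)) (trans e (trans (cong (gridPoint (suc n)) r≡0) (grid-zero (suc n))))) (S-zero (suc n))))
    from (r , e , _ , inj₂ (i , r≡ , S<x)) = inj₂ (begin
      S q (suc n)                                    ≤⟨ ≤-dist (S q (suc n)) (S g (suc n)) ⟩
      S g (suc n) + dist (S q (suc n)) (S g (suc n)) ≤⟨ +-mono-≤ (<⇒≤ S<x) (S-lip ∣q∣≤b ∣g∣≤b (suc n) (s≤s M≤n)) ⟩
      x + K * dist q g                               ≡⟨ cong (λ z → x + K * z) dist≡ ⟩
      x + K * recip (suc n)                          ∎)
      where
      g = gridPoint (suc n) i
      q≡ : q ≡ g + recip (suc n)
      q≡ = trans e (trans (cong (gridPoint (suc n)) r≡) (grid-suc (suc n) i))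
      g≤q : g ≤ q
      g≤q = subst (g ≤_) (sym q≡) (subst (_≤ g + recip (suc n)) (+-identityʳ g) (+-monoʳ-≤ g (0≤recip (suc n))))
      ∣q∣≤b : ∣ q ∣ ≤ b
      ∣q∣≤b = subst (_≤ b) (sym (0≤p⇒∣p∣≡p (log-nonNeg x (suc n)))) q≤b
      ∣g∣≤b : ∣ g ∣ ≤ b
      ∣g∣≤b = subst (_≤ b) (sym (0≤p⇒∣p∣≡p (grid-nonNeg (suc n) i))) (≤-trans g≤q q≤b)
      dist≡ : dist q g ≡ recip (suc n)
      dist≡ = trans (cong (λ z → dist z g) q≡)
        (trans (cong ∣_∣ (solve 2 (λ g r → (g :+ r) :- g := r) refl g (recip (suc n)))) (0≤p⇒∣p∣≡p (0≤recip (suc n))))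

  EventuallyAbove1 : (ℕ → ℚ) → Set
  EventuallyAbove1 s = ∀ ε → 0ℚ < ε → ∃[ N ] (∀ n → N ℕ.≤ n → 1ℚ ≤ s n + ε)

  module Log (s : ℕ → ℚ) (cs : Cauchy s) (1≤s : EventuallyAbove1 s) where
    q : ℕ → ℚ
    q n = logApprox (s n) n

    b : ℚ
    b = proj₁ (bounded s cs) + 1ℚ

    0≤B : 0ℚ ≤ proj₁ (bounded s cs)
    0≤B = <⇒≤ (proj₁ (proj₂ (bounded s cs)))

    0≤b : 0ℚ ≤ b
    0≤b = +-mono-≤ 0≤B 0≤1

    N₀ : ℕ
    N₀ = suc (proj₁ (proj₂ (proj₂ (bounded s cs))))

    q≤b : ∀ n → N₀ ℕ.≤ n → q n ≤ b
    q≤b (suc n) (s≤s p) = log≤ (s (suc n)) n 0≤B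
      (≤-trans (p≤∣p∣ (s (suc n))) (proj₂ (proj₂ (proj₂ (bounded s cs))) (suc n) (ℕₚ.m≤n⇒m≤1+n p)))

    ∣q∣≤b : ∀ n → N₀ ℕ.≤ n → ∣ q n ∣ ≤ b
    ∣q∣≤b n p = subst (_≤ b) (sym (0≤p⇒∣p∣≡p (log-nonNeg (s n) n))) (q≤b n p)

    open Bound b 0≤b

    exp-log : Null (λ n → dist (S (q n) n) (s n))
    exp-log ε 0<ε = from (1≤s (ε * ½) (half-pos 0<ε)) (null-recip K ε 0<ε)
      where
      from : ∃[ N ] (∀ n → N ℕ.≤ n → 1ℚ ≤ s n + ε * ½) → ∃[ N ] (∀ n → N ℕ.≤ n → K * recip n < ε) →
             ∃[ N ] (∀ n → N ℕ.≤ n → dist (S (q n) n) (s n) < ε)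
      from (N₁ , h₁) (N₂ , h₂) = (N₁ ℕ.⊔ N₂) ℕ.⊔ (N₀ ℕ.⊔ suc M) , bound
        where
        0≤½ε : 0ℚ ≤ ε * ½
        0≤½ε = <⇒≤ (half-pos 0<ε)
        ½ε<ε : ε * ½ < ε
        ½ε<ε = subst₂ _<_ (+-identityˡ (ε * ½)) (half+half ε) (+-monoˡ-< (ε * ½) (half-pos 0<ε))
        s≤ : ∀ n {r} → 0ℚ ≤ r → s (suc n) ≤ S (q (suc n)) (suc n) + r
        s≤ n 0≤r = subst (_≤ S (q (suc n)) (suc n) + _) (+-identityʳ (s (suc n))) (+-mono-≤ (x≤exp-log (s (suc n)) n) 0≤r)
        bound : ∀ n → (N₁ ℕ.⊔ N₂) ℕ.⊔ (N₀ ℕ.⊔ suc M) ℕ.≤ n → dist (S (q n) n) (s n) < ε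
        bound zero    p = contradiction (ℕₚ.m⊔n≤o⇒n≤o N₀ (suc M) (ℕₚ.m⊔n≤o⇒n≤o (N₁ ℕ.⊔ N₂) (N₀ ℕ.⊔ suc M) p)) λ ()
        bound (suc n) p = cases (exp-log≤ (s (suc n)) n 0≤b (q≤b (suc n) N₀≤) (ℕₚ.≤-pred M≤))
          where
          N₀≤ : N₀ ℕ.≤ suc n
          N₀≤ = ℕₚ.m⊔n≤o⇒m≤o N₀ (suc M) (ℕₚ.m⊔n≤o⇒n≤o (N₁ ℕ.⊔ N₂) (N₀ ℕ.⊔ suc M) p)
          M≤ : suc M ℕ.≤ suc n
          M≤ = ℕₚ.m⊔n≤o⇒n≤o N₀ (suc M) (ℕₚ.m⊔n≤o⇒n≤o (N₁ ℕ.⊔ N₂) (N₀ ℕ.⊔ suc M) p)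
          N₁≤ : N₁ ℕ.≤ suc n
          N₁≤ = ℕₚ.m⊔n≤o⇒m≤o N₁ N₂ (ℕₚ.m⊔n≤o⇒m≤o (N₁ ℕ.⊔ N₂) (N₀ ℕ.⊔ suc M) p)
          N₂≤ : N₂ ℕ.≤ suc n
          N₂≤ = ℕₚ.m⊔n≤o⇒n≤o N₁ N₂ (ℕₚ.m⊔n≤o⇒m≤o (N₁ ℕ.⊔ N₂) (N₀ ℕ.⊔ suc M) p)
          cases : S (q (suc n)) (suc n) ≤ 1ℚ ⊎ S (q (suc n)) (suc n) ≤ s (suc n) + K * recip (suc n) →
                  dist (S (q (suc n)) (suc n)) (s (suc n)) < ε
          cases (inj₁ S≤1) = ≤-<-trans (dist≤ (≤-trans S≤1 (h₁ (suc n) N₁≤)) (s≤ n 0≤½ε)) ½ε<ε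
          cases (inj₂ S≤)  = ≤-<-trans (dist≤ S≤ (s≤ n (*-nonNeg (<⇒≤ 0<K) (0≤recip (suc n))))) (h₂ (suc n) N₂≤)

    abstract
      log-cauchy : Cauchy q
      log-cauchy = small-≤ {λ m n → dist (q m) (q n)} {λ m n → ω₁ m n + ω₂ m n} (N₀ ℕ.⊔ suc M) bound (small-+ {ω₁} {ω₂} small-ω₁ small-ω₂)
        where
        open ≤-Reasoning
        ω₁ ω₂ ω₃ : ℕ → ℕ → ℚ
        ω₁ m n = dist (S (q m) m) (s m) + dist (s m) (s n)
        ω₂ m n = dist (S (q n) n) (s n) + ω₃ m n
        ω₃ m n = T b m + T b n
        small-ω₁ : Small ω₁
        small-ω₁ = small-+ {λ m _ → dist (S (q m) m) (s m)} {λ m n → dist (s m) (s n)}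
          (small₁ {λ m → dist (S (q m) m) (s m)} exp-log) cs
        small-ω₃ : Small ω₃
        small-ω₃ = small-+ {λ m _ → T b m} {λ _ n → T b n} (small₁ {T b} T-null) (small₂ {T b} T-null)
        small-ω₂ : Small ω₂
        small-ω₂ = small-+ {λ _ n → dist (S (q n) n) (s n)} {ω₃} (small₂ {λ n → dist (S (q n) n) (s n)} exp-log) small-ω₃
        bound : ∀ m n → N₀ ℕ.⊔ suc M ℕ.≤ m → N₀ ℕ.⊔ suc M ℕ.≤ n → dist (q m) (q n) ≤
          (dist (S (q m) m) (s m) + dist (s m) (s n)) + (dist (S (q n) n) (s n) + (T b m + T b n))
        bound zero    n p _ = contradiction (ℕₚ.m⊔n≤o⇒n≤o N₀ (suc M) p) λ ()
        bound (suc m) n p p′ = begin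
          dist (q (suc m)) (q n)
            ≤⟨ S-expands (log-nonNeg (s (suc m)) (suc m)) (log-nonNeg (s n) n) m ⟩
          dist u w
            ≤⟨ dist-tri u (s n) w ⟩
          dist u (s n) + dist (s n) w
            ≤⟨ +-mono-≤ (dist-tri u (s (suc m)) (s n)) (dist-tri (s n) v w) ⟩
          (dist u (s (suc m)) + dist (s (suc m)) (s n)) + (dist (s n) v + dist v w)
            ≤⟨ +-monoʳ-≤ (dist u (s (suc m)) + dist (s (suc m)) (s n)) (+-mono-≤ (≤-reflexive (dist-sym (s n) v)) uniform) ⟩
          (dist u (s (suc m)) + dist (s (suc m)) (s n)) + (dist v (s n) + (T b (suc m) + T b n)) ∎
          where
          u v w : ℚ
          u = S (q (suc m)) (suc m)
          v = S (q n) n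
          w = S (q n) (suc m)
          uniform : dist v w ≤ T b (suc m) + T b n
          uniform = subst (dist v w ≤_) (+-comm (T b n) (T b (suc m)))
            (S-uniform (∣q∣≤b n (ℕₚ.m⊔n≤o⇒m≤o N₀ (suc M) p′)) n (suc m)
              (ℕₚ.<⇒≤ (ℕₚ.m⊔n≤o⇒n≤o N₀ (suc M) p′)) (ℕₚ.<⇒≤ (ℕₚ.m⊔n≤o⇒n≤o N₀ (suc M) p)))

  module LogMono (s t : ℕ → ℚ) (cs : Cauchy s) (ct : Cauchy t) (1≤s : EventuallyAbove1 s) (1≤t : EventuallyAbove1 t)
                 {δ} (0<δ : 0ℚ < δ) (N : ℕ) (s+δ≤t : ∀ n → N ℕ.≤ n → s n + δ ≤ t n) where
    private
      module Ls = Log s cs 1≤s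
      module Lt = Log t ct 1≤t

    b : ℚ
    b = Ls.b ⊔ Lt.b

    0≤b : 0ℚ ≤ b
    0≤b = ≤-trans Ls.0≤b (p≤p⊔q Ls.b Lt.b)

    open Bound b 0≤b

    1/K : ℚ
    1/K = (1/ K) {{>-nonZero 0<K}}

    0<1/K : 0ℚ < 1/K
    0<1/K = positive⁻¹ 1/K {{1/pos⇒pos K {{positive 0<K}}}}

    η ε : ℚ
    η = δ * ½
    ε = 1/K * η

    0<ε : 0ℚ < ε
    0<ε = *-pos 0<1/K (half-pos 0<δ)

    N′ : ℕ
    N′ = (N ℕ.⊔ proj₁ (Ls.exp-log η (half-pos 0<δ))) ℕ.⊔ ((Ls.N₀ ℕ.⊔ Lt.N₀) ℕ.⊔ suc M)

    log-< : ∀ n → N′ ℕ.≤ n → logApprox (s n) n + ε ≤ logApprox (t n) n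
    log-< n p = begin
      x + ε                ≤⟨ +-monoʳ-≤ x ε≤ ⟩
      x + (y - x)          ≡⟨ solve 2 (λ x y → x :+ (y :- x) := y) refl x y ⟩
      y                    ∎
      where
      open ≤-Reasoning
      x = logApprox (s n) n
      y = logApprox (t n) n
      p₁ = ℕₚ.m⊔n≤o⇒m≤o (N ℕ.⊔ proj₁ (Ls.exp-log η (half-pos 0<δ))) ((Ls.N₀ ℕ.⊔ Lt.N₀) ℕ.⊔ suc M) p
      p₂ = ℕₚ.m⊔n≤o⇒n≤o (N ℕ.⊔ proj₁ (Ls.exp-log η (half-pos 0<δ))) ((Ls.N₀ ℕ.⊔ Lt.N₀) ℕ.⊔ suc M) p
      p₃ = ℕₚ.m⊔n≤o⇒m≤o (Ls.N₀ ℕ.⊔ Lt.N₀) (suc M) p₂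
      M< : suc M ℕ.≤ n
      M< = ℕₚ.m⊔n≤o⇒n≤o (Ls.N₀ ℕ.⊔ Lt.N₀) (suc M) p₂
      ∣x∣≤b : ∣ x ∣ ≤ b
      ∣x∣≤b = ≤-trans (Ls.∣q∣≤b n (ℕₚ.m⊔n≤o⇒m≤o Ls.N₀ Lt.N₀ p₃)) (p≤p⊔q Ls.b Lt.b)
      ∣y∣≤b : ∣ y ∣ ≤ b
      ∣y∣≤b = ≤-trans (Lt.∣q∣≤b n (ℕₚ.m⊔n≤o⇒n≤o Ls.N₀ Lt.N₀ p₃)) (p≤q⊔p Ls.b Lt.b)
      t≤S : t n ≤ S y n
      t≤S = above n (ℕₚ.≤-trans (s≤s z≤n) M<)
        where
        above : ∀ n → 1 ℕ.≤ n → t n ≤ S (logApprox (t n) n) n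
        above (suc n) _ = x≤exp-log (t (suc n)) n
      S+η≤S : S x n + η ≤ S y n
      S+η≤S = begin
        S x n + η                          ≤⟨ +-monoˡ-≤ η (≤-dist (S x n) (s n)) ⟩
        s n + dist (S x n) (s n) + η
          ≤⟨ +-monoˡ-≤ η (+-monoʳ-≤ (s n) (<⇒≤ (proj₂ (Ls.exp-log η (half-pos 0<δ)) n (ℕₚ.m⊔n≤o⇒n≤o N _ p₁)))) ⟩
        s n + η + η                        ≡⟨ trans (+-assoc (s n) η η) (cong (s n +_) (half+half δ)) ⟩
        s n + δ                            ≤⟨ s+δ≤t n (ℕₚ.m⊔n≤o⇒m≤o N _ p₁) ⟩
        t n                                ≤⟨ t≤S ⟩
        S y n                              ∎
      x≤y : x ≤ y
      x≤y = <⇒≤ (≰⇒> λ y≤x → <⇒≢ (<-≤-trans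
        (subst (_< S x n + η) (+-identityʳ (S x n)) (+-monoʳ-< (S x n) (half-pos 0<δ)))
        (≤-trans S+η≤S (S-mono (log-nonNeg (t n) n) y≤x n))) refl)
      dist≡ : dist y x ≡ y - x
      dist≡ = 0≤p⇒∣p∣≡p (subst (_≤ y - x) (+-inverseʳ x) (+-monoˡ-≤ (- x) x≤y))
      η≤ : η ≤ K * (y - x)
      η≤ = begin
        η                        ≡⟨ solve 2 (λ a η → η := (a :+ η) :- a) refl (S x n) η ⟩
        (S x n + η) - S x n      ≤⟨ sub≤ (≤-trans S+η≤S (≤-dist (S y n) (S x n))) ⟩
        dist (S y n) (S x n)     ≤⟨ S-lip ∣y∣≤b ∣x∣≤b n M< ⟩
        K * dist y x             ≡⟨ cong (K *_) dist≡ ⟩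
        K * (y - x)              ∎
      ε≤ : ε ≤ y - x
      ε≤ = begin
        1/K * η                  ≤⟨ *-monoˡ (<⇒≤ 0<1/K) η≤ ⟩
        1/K * (K * (y - x))      ≡⟨ sym (*-assoc 1/K K (y - x)) ⟩
        1/K * K * (y - x)        ≡⟨ cong (_* (y - x)) (*-inverseˡ K {{>-nonZero 0<K}}) ⟩
        1ℚ * (y - x)             ≡⟨ *-identityˡ (y - x) ⟩
        y - x                    ∎

-- Cauchy reals; equality is the setoid relation _≃_ below.
record ℝ : Set where
  no-eta-equality
  constructor mkℝ
  field
    seq    : ℕ → ℚ
    cauchy : ∀ ε → 0ℚ ℚ.< ε → ∃[ N ] (∀ m n → N ℕ.≤ m → N ℕ.≤ n → ℚ.∣ seq m ℚ.- seq n ∣ ℚ.< ε)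

open ℝ public

infix  8 -_
infixl 7 _*_
infix  7 _÷_[_]
infixl 6 _+_ _-_ _⊔_
infix  4 _≃_ _≤_ _<_

data _≃_ (x y : ℝ) : Set where
  mk≃ : (∀ ε → 0ℚ ℚ.< ε → ∃[ N ] (∀ n → N ℕ.≤ n → ℚ.∣ seq x n ℚ.- seq y n ∣ ℚ.< ε)) → x ≃ y

data _≤_ (x y : ℝ) : Set where
  mk≤ : (∀ ε → 0ℚ ℚ.< ε → ∃[ N ] (∀ n → N ℕ.≤ n → seq x n ℚ.≤ seq y n ℚ.+ ε)) → x ≤ y

data _<_ (x y : ℝ) : Set where
  mk< : ∀ ε → 0ℚ ℚ.< ε → ∀ N → (∀ n → N ℕ.≤ n → seq x n ℚ.+ ε ℚ.≤ seq y n) → x < y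

ℚtoℝ : ℚ → ℝ
ℚtoℝ q = mkℝ (λ _ → q) (Limits.const-cauchy q)

ℕtoℝ : ℕ → ℝ
ℕtoℝ n = ℚtoℝ (ℕtoℚ n)

ℤtoℝ : ℤ → ℝ
ℤtoℝ i = ℚtoℝ (i ℚ./ 1)

0ℝ 1ℝ : ℝ
0ℝ = ℚtoℝ 0ℚ
1ℝ = ℚtoℝ 1ℚ

_+_ : ℝ → ℝ → ℝ
x + y = mkℝ (λ n → seq x n ℚ.+ seq y n) (Limits.+-cauchy (seq x) (seq y) (cauchy x) (cauchy y))

-_ : ℝ → ℝ
- x = mkℝ (λ n → ℚ.- seq x n) (Limits.neg-cauchy (seq x) (cauchy x))

_-_ : ℝ → ℝ → ℝ
x - y = x + (- y)

_*_ : ℝ → ℝ → ℝ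
x * y = mkℝ (λ n → seq x n ℚ.* seq y n) (Limits.*-cauchy (seq x) (seq y) (cauchy x) (cauchy y))

_⊔_ : ℝ → ℝ → ℝ
x ⊔ y = mkℝ (λ n → seq x n ℚ.⊔ seq y n) (Limits.⊔-cauchy (seq x) (seq y) (cauchy x) (cauchy y))

∣_∣ : ℝ → ℝ
∣ x ∣ = mkℝ (λ n → ℚ.∣ seq x n ∣) (Limits.∣∣-cauchy (seq x) (cauchy x))

-- The witness of 0 < |y| bounds |yₙ| away from 0 only for n ≥ N, hence the shift.
inverse : (y : ℝ) → 0ℝ < ∣ y ∣ → ℝ
inverse y (mk< ε 0<ε N ε≤∣y∣) = mkℝ inv inv-cauchy
  where
  open Limits.Inverse (λ n → seq y (N ℕ.+ n)) (Limits.shift-cauchy {seq y} N (cauchy y)) 0<ε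
    (λ n → subst (ℚ._≤ ℚ.∣ seq y (N ℕ.+ n) ∣) (ℚₚ.+-identityˡ ε) (ε≤∣y∣ (N ℕ.+ n) (ℕₚ.m≤m+n N n)))

_÷_[_] : (x y : ℝ) → 0ℝ < ∣ y ∣ → ℝ
x ÷ y [ y#0 ] = x * inverse y y#0

-- exp x = Σ xᵏ/k!, as the limit of the n-th partial sum at the n-th approximation of x.
exp : ℝ → ℝ
exp x = mkℝ (λ n → expSum (seq x n) n) (ExpLemmas.exp-cauchy (seq x) (cauchy x))

1≤-elim : ∀ x → 1ℝ ≤ x → LogLemmas.EventuallyAbove1 (seq x)
1≤-elim x (mk≤ 1≤x) = 1≤x

-- The natural logarithm of a real ≥ 1; exp-log≥1 is its defining property.
log≥1 : (x : ℝ) → 1ℝ ≤ x → ℝ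
log≥1 x 1≤x = mkℝ (λ n → logApprox (seq x n) n) (LogLemmas.Log.log-cauchy (seq x) (cauchy x) (1≤-elim x 1≤x))

exp-log≥1 : ∀ x (1≤x : 1ℝ ≤ x) → exp (log≥1 x 1≤x) ≃ x
exp-log≥1 x 1≤x = mk≃ (LogLemmas.Log.exp-log (seq x) (cauchy x) (1≤-elim x 1≤x))

abstract
  1≤ℕtoℚ : ∀ n → 0 ℕ.< n → 1ℚ ℚ.≤ ℕtoℚ n
  1≤ℕtoℚ (suc n) _ = RationalLemmas.1≤ι-suc n

  1≤ℕtoℝ : ∀ n → 0 ℕ.< n → 1ℝ ≤ ℕtoℝ n
  1≤ℕtoℝ n 0<n = mk≤ λ ε 0<ε → 0 , λ _ _ →
    ℚₚ.≤-trans (1≤ℕtoℚ n 0<n) (subst (ℚ._≤ ℕtoℚ n ℚ.+ ε) (ℚₚ.+-identityʳ (ℕtoℚ n)) (ℚₚ.+-monoʳ-≤ (ℕtoℚ n) (ℚₚ.<⇒≤ 0<ε)))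

  0<ℕtoℝ : ∀ n → 0 ℕ.< n → 0ℝ < ℕtoℝ n
  0<ℕtoℝ n 0<n = mk< 1ℚ Limits.0<1 0 λ _ _ → subst (ℚ._≤ ℕtoℚ n) (sym (ℚₚ.+-identityˡ 1ℚ)) (1≤ℕtoℚ n 0<n)

scale : ∀ x → 0ℝ < x → ℕ
scale x (mk< δ 0<δ _ _) = suc ℤ.∣ ℚ.↥ ((ℚ.1/ δ) {{ℚ.>-nonZero 0<δ}}) ∣

abstract
  0<scale : ∀ x (0<x : 0ℝ < x) → 0 ℕ.< scale x 0<x
  0<scale x (mk< _ _ _ _) = s≤s z≤n

  1≤scale*x : ∀ x (0<x : 0ℝ < x) → 1ℝ ≤ ℕtoℝ (scale x 0<x) * x
  1≤scale*x x 0<x@(mk< δ 0<δ N δ≤x) = mk≤ λ ε 0<ε → N , λ n N≤n → begin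
    1ℚ                             ≡⟨ sym (ℚₚ.*-inverseˡ δ {{ℚ.>-nonZero 0<δ}}) ⟩
    1/δ ℚ.* δ                      ≤⟨ *-mono 0≤1/δ (ℚₚ.≤-trans (ℚₚ.<⇒≤ 0<δ) (δ≤xₙ n N≤n)) 1/δ≤k (δ≤xₙ n N≤n) ⟩
    ℕtoℚ k ℚ.* seq x n             ≡⟨ sym (ℚₚ.+-identityʳ (ℕtoℚ k ℚ.* seq x n)) ⟩
    ℕtoℚ k ℚ.* seq x n ℚ.+ 0ℚ      ≤⟨ ℚₚ.+-monoʳ-≤ (ℕtoℚ k ℚ.* seq x n) (ℚₚ.<⇒≤ 0<ε) ⟩
    ℕtoℚ k ℚ.* seq x n ℚ.+ ε       ∎
    where
    open ℚₚ.≤-Reasoning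
    open RationalLemmas
    k : ℕ
    k = scale x 0<x
    instance
      δ-nonZero : ℚ.NonZero δ
      δ-nonZero = ℚ.>-nonZero 0<δ
    1/δ : ℚ
    1/δ = ℚ.1/ δ
    0≤1/δ : 0ℚ ℚ.≤ 1/δ
    0≤1/δ = ℚₚ.<⇒≤ (ℚₚ.positive⁻¹ 1/δ {{ℚₚ.1/pos⇒pos δ {{ℚ.positive 0<δ}}}})
    1/δ≤k : 1/δ ℚ.≤ ℕtoℚ k
    1/δ≤k = ℚₚ.≤-trans (p≤ι 1/δ) (ι-mono (ℕₚ.n≤1+n ℤ.∣ ℚ.↥ 1/δ ∣))
    δ≤xₙ : ∀ n → N ℕ.≤ n → δ ℚ.≤ seq x n
    δ≤xₙ n N≤n = subst (ℚ._≤ seq x n) (ℚₚ.+-identityˡ δ) (δ≤x n N≤n)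

-- log x = log (k x) − log k with k ∈ ℕ and k x ≥ 1; the value does not depend on k.
log : (x : ℝ) → 0ℝ < x → ℝ
log x 0<x =
  log≥1 (ℕtoℝ (scale x 0<x) * x) (1≤scale*x x 0<x) - log≥1 (ℕtoℝ (scale x 0<x)) (1≤ℕtoℝ (scale x 0<x) (0<scale x 0<x))

abstract
  -⁺-< : ∀ x y → x < y → (x - y) < 0ℝ
  -⁺-< x y (mk< ε 0<ε N x+ε≤y) = mk< ε 0<ε N λ n p → below (seq x n) (seq y n) (x+ε≤y n p)
    where
    open ℚₚ.≤-Reasoning
    open +-*-Solver using (solve; _:=_; _:+_; :-_)
    below : ∀ a b → a ℚ.+ ε ℚ.≤ b → (a ℚ.+ (ℚ.- b)) ℚ.+ ε ℚ.≤ 0ℚ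
    below a b h = begin
      (a ℚ.+ (ℚ.- b)) ℚ.+ ε    ≡⟨ solve 3 (λ a b e → (a :+ (:- b)) :+ e := (a :+ e) :+ (:- b)) refl a b ε ⟩
      (a ℚ.+ ε) ℚ.+ (ℚ.- b)    ≤⟨ ℚₚ.+-monoˡ-≤ (ℚ.- b) h ⟩
      b ℚ.+ (ℚ.- b)            ≡⟨ ℚₚ.+-inverseʳ b ⟩
      0ℚ                       ∎

  log≥1-mono-< : ∀ x y 1≤x 1≤y → x < y → log≥1 x 1≤x < log≥1 y 1≤y
  log≥1-mono-< x y 1≤x 1≤y (mk< δ 0<δ N x+δ≤y) = mk< ε 0<ε N′ log-<
    where open LogLemmas.LogMono (seq x) (seq y) (cauchy x) (cauchy y) (1≤-elim x 1≤x) (1≤-elim y 1≤y) 0<δ N x+δ≤y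

  *-monoˡ-<1 : ∀ k → 0 ℕ.< k → ∀ x → x < 1ℝ → (ℕtoℝ k * x) < ℕtoℝ k
  *-monoˡ-<1 k 0<k x (mk< δ 0<δ N x+δ≤1) =
    mk<-seq (λ n → seq (ℕtoℝ k) n ℚ.* seq x n) (seq (ℕtoℝ k)) (ℕtoℚ k ℚ.* δ) (*-pos 0<k′ 0<δ) N
      λ n p → scaled (ℕtoℚ k) (seq x n) (ℚₚ.<⇒≤ 0<k′) (x+δ≤1 n p)
    where
    open RationalLemmas
    0<k′ : 0ℚ ℚ.< ℕtoℚ k
    0<k′ = ℚₚ.<-≤-trans Limits.0<1 (1≤ℕtoℚ k 0<k)
    mk<-seq : ∀ f g {cf cg} ε → 0ℚ ℚ.< ε → ∀ N → (∀ n → N ℕ.≤ n → f n ℚ.+ ε ℚ.≤ g n) → mkℝ f cf < mkℝ g cg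
    mk<-seq f g ε 0<ε N h = mk< ε 0<ε N h
    scaled : ∀ a y → 0ℚ ℚ.≤ a → y ℚ.+ δ ℚ.≤ 1ℚ → a ℚ.* y ℚ.+ a ℚ.* δ ℚ.≤ a
    scaled a y 0≤a h = subst₂ ℚ._≤_ (ℚₚ.*-distribˡ-+ a y δ) (ℚₚ.*-identityʳ a) (*-monoˡ 0≤a h)

  log<0 : ∀ x (0<x : 0ℝ < x) → x < 1ℝ → log x 0<x < 0ℝ
  log<0 x 0<x x<1 = -⁺-< (log≥1 (ℕtoℝ k * x) 1≤kx) (log≥1 (ℕtoℝ k) 1≤k)
    (log≥1-mono-< (ℕtoℝ k * x) (ℕtoℝ k) 1≤kx 1≤k (*-monoˡ-<1 k (0<scale x 0<x) x x<1))
    where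
    k : ℕ
    k = scale x 0<x
    1≤kx : 1ℝ ≤ ℕtoℝ k * x
    1≤kx = 1≤scale*x x 0<x
    1≤k : 1ℝ ≤ ℕtoℝ k
    1≤k = 1≤ℕtoℝ k (0<scale x 0<x)

  <0⇒#0 : ∀ x → x < 0ℝ → 0ℝ < ∣ x ∣
  <0⇒#0 x (mk< ε 0<ε N x+ε≤0) = mk< ε 0<ε N λ n p → begin
    0ℚ ℚ.+ ε                                 ≡⟨ solve 2 (λ x ε → con 0ℚ :+ ε := (x :+ ε) :+ (:- x)) refl (seq x n) ε ⟩
    (seq x n ℚ.+ ε) ℚ.+ (ℚ.- seq x n)        ≤⟨ ℚₚ.+-monoˡ-≤ (ℚ.- seq x n) (x+ε≤0 n p) ⟩
    0ℚ ℚ.+ (ℚ.- seq x n)                     ≡⟨ ℚₚ.+-identityˡ (ℚ.- seq x n) ⟩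
    ℚ.- seq x n                              ≤⟨ RationalLemmas.p≤∣p∣ (ℚ.- seq x n) ⟩
    ℚ.∣ ℚ.- seq x n ∣                        ≡⟨ ℚₚ.∣-p∣≡∣p∣ (seq x n) ⟩
    ℚ.∣ seq x n ∣                            ∎
    where
    open ℚₚ.≤-Reasoning
    open +-*-Solver using (solve; _:=_; _:+_; :-_; con)

infix 8 _^_[_]
_^_[_] : (x y : ℝ) → 0ℝ < x → ℝ
x ^ y [ 0<x ] = exp (y * log x 0<x)

-- The maximum of finitely many reals ≥ 0 (and 0 for the empty family).
maximum : ∀ {n} → Vector ℝ n → ℝ
maximum = foldr _⊔_ 0ℝ

abstract
  0<maximum : ∀ {n} → 0 ℕ.< n → (x : Vector ℝ n) → (∀ i → 0ℝ < x i) → 0ℝ < maximum x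
  0<maximum {suc n} _ x 0<x = below⊔ (x zero) (maximum (λ i → x (suc i))) (0<x zero)
    where
    below⊔ : ∀ y z → 0ℝ < y → 0ℝ < (y ⊔ z)
    below⊔ y z (mk< ε 0<ε N h) = mk< ε 0<ε N λ k p → ℚₚ.≤-trans (h k p) (ℚₚ.p≤p⊔q (seq y k) (seq z k))

  maximum<1 : ∀ {n} (x : Vector ℝ n) → (∀ i → x i < 1ℝ) → maximum x < 1ℝ
  maximum<1 {zero}  x x<1 = mk< 1ℚ Limits.0<1 0 λ _ _ → ℚₚ.≤-refl
  maximum<1 {suc n} x x<1 = combine (x<1 zero) (maximum<1 (λ i → x (suc i)) (λ i → x<1 (suc i)))
    where
    y z : ℝ
    y = x zero
    z = maximum (λ i → x (suc i))
    combine : y < 1ℝ → z < 1ℝ → (y ⊔ z) < 1ℝ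
    combine (mk< ε 0<ε N h) (mk< ε′ 0<ε′ N′ h′) =
      mk< (ε ℚ.⊓ ε′) 0<⊓ (N ℕ.⊔ N′) λ k p → begin
        (seq y k ℚ.⊔ seq z k) ℚ.+ (ε ℚ.⊓ ε′)
          ≡⟨ ℚₚ.mono-≤-distrib-⊔ {λ q → q ℚ.+ (ε ℚ.⊓ ε′)} (ℚₚ.+-monoˡ-≤ (ε ℚ.⊓ ε′)) (seq y k) (seq z k) ⟩
        (seq y k ℚ.+ (ε ℚ.⊓ ε′)) ℚ.⊔ (seq z k ℚ.+ (ε ℚ.⊓ ε′))
          ≤⟨ ℚₚ.⊔-lub (ℚₚ.≤-trans (ℚₚ.+-monoʳ-≤ (seq y k) (ℚₚ.p⊓q≤p ε ε′)) (h k (ℕₚ.m⊔n≤o⇒m≤o N N′ p)))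
                      (ℚₚ.≤-trans (ℚₚ.+-monoʳ-≤ (seq z k) (ℚₚ.p⊓q≤q ε ε′)) (h′ k (ℕₚ.m⊔n≤o⇒n≤o N N′ p))) ⟩
        1ℚ ∎
      where
      open ℚₚ.≤-Reasoning
      0<⊓ : 0ℚ ℚ.< ε ℚ.⊓ ε′
      0<⊓ = pick (ℚₚ.⊓-sel ε ε′)
        where
        pick : (ε ℚ.⊓ ε′ ≡ ε) ⊎ (ε ℚ.⊓ ε′ ≡ ε′) → 0ℚ ℚ.< ε ℚ.⊓ ε′
        pick (inj₁ e) = subst (0ℚ ℚ.<_) (sym e) 0<ε
        pick (inj₂ e) = subst (0ℚ ℚ.<_) (sym e) 0<ε′

ℝ^ : ℕ → Set
ℝ^ d = Vector ℝ d

infix 4 _≋_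
_≋_ : ∀ {d} → ℝ^ d → ℝ^ d → Set
x ≋ y = ∀ i → x i ≃ y i

‖_‖ : ∀ {d} → ℝ^ d → ℝ
‖ x ‖ = maximum (λ i → ∣ x i ∣)

infixl 6 _-ᵥ_
_-ᵥ_ : ∀ {d} → ℝ^ d → ℝ^ d → ℝ^ d
_-ᵥ_ = zipWith _-_

IsContraction : ∀ {d} → ℝ → (ℝ^ d → ℝ^ d) → Set
IsContraction τ f = 0ℝ < τ × τ < 1ℝ × (∀ x y → ‖ f x -ᵥ f y ‖ ≤ τ * ‖ x -ᵥ y ‖)

record IFS (d J : ℕ) : Set where
  field
    0<J         : 0 ℕ.< J
    map         : Fin J → ℝ^ d → ℝ^ d
    rate        : Fin J → ℝ
    contraction : ∀ j → IsContraction (rate j) (map j)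

  maxRate : ℝ
  maxRate = maximum rate

  0<maxRate : 0ℝ < maxRate
  0<maxRate = 0<maximum 0<J rate (λ j → proj₁ (contraction j))

  log-maxRate<0 : log maxRate 0<maxRate < 0ℝ
  log-maxRate<0 = log<0 maxRate 0<maxRate (maximum<1 rate (λ j → proj₁ (proj₂ (contraction j))))

  D : ℝ
  D = (- log (ℕtoℝ J) (0<ℕtoℝ J 0<J)) ÷ log maxRate 0<maxRate [ <0⇒#0 (log maxRate 0<maxRate) log-maxRate<0 ]

private
  variable
    d J : ℕ
    ℓ : Level

IsCauchy : (ℕ → ℝ^ d) → Set
IsCauchy u = ∀ ε → 0ℝ < ε → ∃[ N ] (∀ m n → N ℕ.≤ m → N ℕ.≤ n → ‖ u m -ᵥ u n ‖ < ε)

_ConvergesTo_ : (ℕ → ℝ^ d) → ℝ^ d → Set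
u ConvergesTo x = ∀ ε → 0ℝ < ε → ∃[ N ] (∀ n → N ℕ.≤ n → ‖ u n -ᵥ x ‖ < ε)

-- Compactness in its constructive form: complete and totally bounded. (The
-- open-cover form is not constructively available, even for [0,1].)
record IsCompact (C : Pred (ℝ^ d) ℓ) : Set ℓ where
  field
    complete       : ∀ u → (∀ k → u k ∈ C) → IsCauchy u → ∃[ x ] x ∈ C × u ConvergesTo x
    totallyBounded : ∀ ε → 0ℝ < ε → ∃[ ys ] All (_∈ C) ys × (∀ x → x ∈ C → Any (λ y → ‖ x -ᵥ y ‖ < ε) ys)

-- ⋃ⱼ fⱼ(C). The double negation makes this the classical union: for [0,1] = [0,½] ∪ [½,1],
-- a constructive ∃ would ask to decide in which of the two pieces a real number lies.
⋃-image : IFS d J → Pred (ℝ^ d) ℓ → Pred (ℝ^ d) ℓ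
⋃-image F C x = ¬ ¬ (∃[ j ] ∃[ y ] y ∈ C × x ≋ IFS.map F j y)

record IsAttractor (F : IFS d J) (C : Pred (ℝ^ d) ℓ) : Set ℓ where
  field
    nonEmpty  : ∃[ x ] x ∈ C
    compact   : IsCompact C
    invariant : ⋃-image F C ≐ C

-- An integer polynomial is its list of coefficients, constant term first;
-- trailing zeros are allowed and ignored by _≈ₚ_, degree, content and height.
Poly : Set
Poly = List ℤ

coeff : Poly → ℕ → ℤ
coeff []      _       = 0ℤ
coeff (a ∷ p) zero    = a
coeff (a ∷ p) (suc i) = coeff p i

infix 4 _≈ₚ_
_≈ₚ_ : Poly → Poly → Set
p ≈ₚ q = ∀ i → coeff p i ≡ coeff q i

infixl 6 _+ₚ_
_+ₚ_ : Poly → Poly → Poly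
[]      +ₚ q       = q
(a ∷ p) +ₚ []      = a ∷ p
(a ∷ p) +ₚ (b ∷ q) = (a ℤ.+ b) ∷ (p +ₚ q)

infixl 7 _*ₚ_
_*ₚ_ : Poly → Poly → Poly
[]      *ₚ q = []
(a ∷ p) *ₚ q = List.map (λ b → a ℤ.* b) q +ₚ (0ℤ ∷ (p *ₚ q))

ℤ[X] : RawSemiring 0ℓ 0ℓ
ℤ[X] = record { Carrier = Poly ; _≈_ = _≈ₚ_ ; _+_ = _+ₚ_ ; _*_ = _*ₚ_ ; 0# = [] ; 1# = 1ℤ ∷ [] }

open RawSemiringDefinitions ℤ[X] using (Irreducible)

degree : Poly → ℕ
degree []      = 0
degree (a ∷ p) = if does (all? (ℤₚ._≟ 0ℤ) p) then 0 else suc (degree p)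

content : Poly → ℤ
content = List.foldr ℤ.gcd 0ℤ

height : Poly → ℕ
height = List.foldr (λ a h → ℤ.∣ a ∣ ℕ.⊔ h) 0

eval : Poly → ℝ → ℝ
eval p x = List.foldr (λ a r → ℤtoℝ a + x * r) 0ℝ p

record IsMinimalPolynomial (p : Poly) (α : ℝ) : Set where
  field
    irreducible : Irreducible p
    coprime     : content p ≡ 1ℤ
    root        : eval p α ≃ 0ℝ

IsAlgebraic[degree≤_,height≤_] : ℕ → ℕ → ℝ → Set
IsAlgebraic[degree≤ n ,height≤ N ] α =
  ∃[ p ] IsMinimalPolynomial p α × degree p ℕ.≤ n × height p ℕ.≤ N

𝒮 : Pred (ℝ^ d) ℓ → ℕ → ℕ → Pred (ℝ^ d) ℓ
𝒮 C N n x = x ∈ C × (∀ i → IsAlgebraic[degree≤ n ,height≤ N ] (x i))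

-- |S| ≤ b, as: every finite family of pairwise distinct elements of S has at most b
-- members. In particular S is finite.
CardinalityAtMost : Pred (ℝ^ d) ℓ → ℝ → Set ℓ
CardinalityAtMost {d} S b = ∀ m (s : Fin m → ℝ^ d) → (∀ i → s i ∈ S) → Injective _≡_ _≋_ s → ℕtoℝ m ≤ b

{-# OPTIONS --safe #-}

-- Two distinct algebraic numbers α, β in a bounded set, of degree ≤ n and height ≤ N, satisfy
-- |α − β| ≫ N⁻²ⁿ, while the Jᵏ pieces of C of level k have diameter ≪ τᵏ. Hence if k is about
-- 2n log N / (−log τ) plus a constant, each piece contains at most one point of 𝒮 C N n, and
-- there are Jᵏ ≪ N²ⁿᴰ pieces.
--
-- The lower bound goes back to a Liouville inequality 1 ≪ N²ⁿ⁻¹ |q(α)| for q(α) ≠ 0, where p is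
-- the minimal polynomial of α. Instead of a resultant, Siegel's lemma provides small integer
-- polynomials u, v, not both zero, with u p + v q constant; the constant is nonzero because p has
-- minimal degree among the integer polynomials vanishing at α. If the minimal polynomial q of β
-- does not vanish at α, then |q(α)| = |q(α) − q(β)| ≪ N |α − β|. Otherwise the inequality is
-- applied to q′, and Taylor's formula gives |q′(α)| ≪ N |α − β|.
module Submission where

open import Data.Nat.Base as ℕ using (ℕ; zero; suc; z≤n; s≤s)
import Data.Nat.Divisibility as ℕ∣
open import Data.Nat.Induction using (<-rec)
open import Data.Nat.ListAction using () renaming (product to ∏)
open import Data.Nat.Primality using (Prime; euclidsLemma; prime⇒nonZero)
open import Data.Nat.Primality.Factorisation using (PrimeFactorisation; factorise)
import Data.Nat.Properties as ℕₚ
open import Data.Nat.Solver using () renaming (module +-*-Solver to ℕ-Solver)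
open import Data.Integer.Base as ℤ using (ℤ; 0ℤ; 1ℤ)
import Data.Integer.Properties as ℤₚ
open import Data.Integer.Solver using () renaming (module +-*-Solver to ℤ-Solver)
open import Data.Rational.Base as ℚ using (ℚ; 0ℚ; 1ℚ; ½)
import Data.Rational.Properties as ℚₚ
open import Data.Rational.Solver using () renaming (module +-*-Solver to ℚ-Solver)
import Data.Rational.Unnormalised.Base as ℚᵘ
import Data.Rational.Unnormalised.Properties as ℚᵘₚ
open import Algebra.Properties.AbelianGroup ℤₚ.+-0-abelianGroup using (∙-cancelʳ)
open import Data.Fin.Base as Fin using (Fin; zero; suc; toℕ; fromℕ<; finToFun; funToFin; combine; _↑ˡ_; _↑ʳ_; splitAt)
import Data.Fin.Properties as Finₚ
open import Data.List.Base as List using (List; []; _∷_; length; foldr; tabulate)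
import Data.List.Properties as Listₚ
open import Data.List.Relation.Unary.All using (All; []; _∷_; all?)
open import Data.List.Relation.Unary.Any using (Any; here; there)
open import Data.Product.Base using (∃-syntax; _×_; _,_; proj₁; proj₂)
open import Data.Sum.Base using (_⊎_; inj₁; inj₂; [_,_]′)
open import Data.Vec.Functional using (Vector)
open import Function.Definitions using (Injective)
open import Relation.Binary.PropositionalEquality hiding (J)
open import Relation.Nullary using (yes; no; ¬_)
open import Relation.Nullary.Negation using (contradiction)
open import Relation.Unary using (Pred; _∈_)

-- Equality of reals is undecidable, so neither `q(α) = 0` nor the piece containing a point can be
-- decided. These case distinctions are made under double negation, which the conclusions `x ≋ x′`
-- and `m ≤ Jᵏ` tolerate because they are stable. The polynomial estimates are made at rational
-- approximations of `α`, where `p` is small rather than zero, and carry an error that tends to 0.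
-- Irreducibility is given in ℤ[X] only; that `p` has minimal degree follows by pseudo-division and
-- Gauss's lemma. The exponent `2n` arises as `(2n − 1) + 1`: Siegel's lemma is applied to `n + d`
-- unknowns and `n + d − 1 ≤ 2n − 1` equations with coefficients `≪ N`, and the estimate of
-- `q(α) − q(β)`, or of the Taylor remainder, adds one factor `N`. The constant in the depth of the
-- pieces absorbs the separation constant and the diameter of the attractor through `a exp(−a) < 1`.

-- The functional equation of the exponential series

module ExponentialSums where
  open import Data.Rational.Base
  open import Data.Rational.Properties
  open ℚ-Solver using (solve; _:=_; _:+_; _:*_; :-_; _:-_; con)
  open import Defs using (module RationalLemmas; module Limits; module ExpLemmas)
  open RationalLemmas
  open ExpLemmas using (T; S; T-nonNeg; T-abs)

  Σ≤ : (ℕ → ℚ) → ℕ → ℚ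
  Σ≤ f zero    = f zero
  Σ≤ f (suc n) = Σ≤ f n + f (suc n)

  -- The Cauchy product, over the pairs `i + j = k`.
  conv : (ℕ → ℚ) → (ℕ → ℚ) → ℕ → ℚ
  conv f g zero    = f zero * g zero
  conv f g (suc k) = f zero * g (suc k) + conv (λ i → f (suc i)) g k

  conv-cong : ∀ {f f′ g g′} → (∀ i → f i ≡ f′ i) → (∀ i → g i ≡ g′ i) → ∀ k → conv f g k ≡ conv f′ g′ k
  conv-cong p q zero    = cong₂ _*_ (p 0) (q 0)
  conv-cong p q (suc k) = cong₂ _+_ (cong₂ _*_ (p 0) (q (suc k))) (conv-cong (λ i → p (suc i)) q k)

  conv-+ˡ : ∀ f f′ g k → conv (λ i → f i + f′ i) g k ≡ conv f g k + conv f′ g k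
  conv-+ˡ f f′ g zero    = *-distribʳ-+ (g 0) (f 0) (f′ 0)
  conv-+ˡ f f′ g (suc k) = trans (cong ((f 0 + f′ 0) * g (suc k) +_) (conv-+ˡ _ _ g k))
    (solve 5 (λ x y z u v → (x :+ y) :* z :+ (u :+ v) := (x :* z :+ u) :+ (y :* z :+ v)) refl
      (f 0) (f′ 0) (g (suc k)) (conv (λ i → f (suc i)) g k) (conv (λ i → f′ (suc i)) g k))

  conv-*ˡ : ∀ c f g k → conv (λ i → c * f i) g k ≡ c * conv f g k
  conv-*ˡ c f g zero    = *-assoc c (f 0) (g 0)
  conv-*ˡ c f g (suc k) = trans (cong (c * f 0 * g (suc k) +_) (conv-*ˡ c _ g k))
    (solve 4 (λ c x y z → c :* x :* y :+ c :* z := c :* (x :* y :+ z)) refl c (f 0) (g (suc k)) (conv (λ i → f (suc i)) g k))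

  conv-*ʳ : ∀ c f g k → conv f (λ i → c * g i) k ≡ c * conv f g k
  conv-*ʳ c f g zero    = solve 3 (λ c x y → x :* (c :* y) := c :* (x :* y)) refl c (f 0) (g 0)
  conv-*ʳ c f g (suc k) = trans (cong (f 0 * (c * g (suc k)) +_) (conv-*ʳ c _ g k))
    (solve 4 (λ c x y z → x :* (c :* y) :+ c :* z := c :* (x :* y :+ z)) refl c (f 0) (g (suc k)) (conv (λ i → f (suc i)) g k))

  -- The operator t d/dt on the power series with coefficients `f`; `conv-euler` is its Leibniz
  -- rule.
  euler : (ℕ → ℚ) → ℕ → ℚ
  euler f i = ι i * f i

  conv-euler : ∀ f g k → ι k * conv f g k ≡ conv (euler f) g k + conv f (euler g) k
  conv-euler f g zero    = solve 2 (λ x y → con 0ℚ :* (x :* y) := con 0ℚ :* x :* y :+ x :* (con 0ℚ :* y)) refl (f 0) (g 0)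
  conv-euler f g (suc k) = begin
    ι (suc k) * (f 0 * g (suc k) + C)
      ≡⟨ cong (λ z → z * (f 0 * g (suc k) + C)) (ι-suc k) ⟩
    (1ℚ + ι k) * (f 0 * g (suc k) + C)
      ≡⟨ solve 4 (λ n x y c → (con 1ℚ :+ n) :* (x :* y :+ c) := ((con 1ℚ :+ n) :* (x :* y) :+ c) :+ n :* c) refl (ι k) (f 0) (g (suc k)) C ⟩
    ((1ℚ + ι k) * (f 0 * g (suc k)) + C) + ι k * C
      ≡⟨ cong₂ (λ m z → (m * (f 0 * g (suc k)) + C) + z) (sym (ι-suc k)) (conv-euler f⁺ g k) ⟩
    (ι (suc k) * (f 0 * g (suc k)) + C) + (conv (euler f⁺) g k + conv f⁺ (euler g) k)
      ≡⟨ solve 6 (λ m x y c u v → (m :* (x :* y) :+ c) :+ (u :+ v) := (con 0ℚ :* x :* y :+ (c :+ u)) :+ (x :* (m :* y) :+ v)) refl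
          (ι (suc k)) (f 0) (g (suc k)) C (conv (euler f⁺) g k) (conv f⁺ (euler g) k) ⟩
    (0ℚ * f 0 * g (suc k) + (C + conv (euler f⁺) g k)) + (f 0 * (ι (suc k) * g (suc k)) + conv f⁺ (euler g) k)
      ≡⟨ cong (λ z → (0ℚ * f 0 * g (suc k) + z) + (f 0 * (ι (suc k) * g (suc k)) + conv f⁺ (euler g) k))
          (sym (trans (conv-cong euler-suc (λ _ → refl) k) (conv-+ˡ f⁺ (euler f⁺) g k))) ⟩
    conv (euler f) g (suc k) + conv f (euler g) (suc k) ∎
    where
    open ≡-Reasoning
    f⁺ : ℕ → ℚ
    f⁺ i = f (suc i)
    C = conv f⁺ g k
    euler-suc : ∀ i → euler f (suc i) ≡ f⁺ i + euler f⁺ i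
    euler-suc i = trans (cong (_* f⁺ i) (ι-suc i)) (solve 2 (λ n x → (con 1ℚ :+ n) :* x := x :+ n :* x) refl (ι i) (f⁺ i))

  conv-sucʳ : ∀ f g → g 0 ≡ 0ℚ → ∀ k → conv f g (suc k) ≡ conv f (λ i → g (suc i)) k
  conv-sucʳ f g g0 zero    = trans (cong (λ z → f 0 * g 1 + f 1 * z) g0)
    (solve 2 (λ x y → x :+ y :* con 0ℚ := x) refl (f 0 * g 1) (f 1))
  conv-sucʳ f g g0 (suc k) = cong (f 0 * g (suc (suc k)) +_) (conv-sucʳ (λ i → f (suc i)) g g0 k)

  euler-T : ∀ a i → euler (T a) (suc i) ≡ a * T a i
  euler-T a i = begin
    ι (suc i) * (T a i * a * recip i)  ≡⟨ solve 4 (λ n t a r → n :* (t :* a :* r) := (a :* t) :* (r :* n)) refl (ι (suc i)) (T a i) a (recip i) ⟩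
    (a * T a i) * (recip i * ι (suc i)) ≡⟨ trans (cong ((a * T a i) *_) (recip-inv i)) (*-identityʳ _) ⟩
    a * T a i ∎
    where open ≡-Reasoning

  -- The product of the two exponential series solves y′ = (a + b) y, so its coefficients obey the
  -- recurrence that defines `T (a + b)`. This stands in for the binomial theorem.
  conv-T-suc : ∀ a b k → ι (suc k) * conv (T a) (T b) (suc k) ≡ (a + b) * conv (T a) (T b) k
  conv-T-suc a b k = begin
    ι (suc k) * conv (T a) (T b) (suc k)
      ≡⟨ conv-euler (T a) (T b) (suc k) ⟩
    conv (euler (T a)) (T b) (suc k) + conv (T a) (euler (T b)) (suc k)
      ≡⟨ cong₂ _+_ left right ⟩
    a * C + b * C
      ≡⟨ sym (*-distribʳ-+ C a b) ⟩
    (a + b) * C ∎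
    where
    open ≡-Reasoning
    C = conv (T a) (T b) k
    left : conv (euler (T a)) (T b) (suc k) ≡ a * C
    left = trans (solve 3 (λ x y z → con 0ℚ :* x :* y :+ z := z) refl (T a 0) (T b (suc k)) (conv (λ i → euler (T a) (suc i)) (T b) k))
      (trans (conv-cong (euler-T a) (λ _ → refl) k) (conv-*ˡ a (T a) (T b) k))
    right : conv (T a) (euler (T b)) (suc k) ≡ b * C
    right = trans (conv-sucʳ (T a) (euler (T b)) refl k)
      (trans (conv-cong {T a} (λ _ → refl) (euler-T b) k) (conv-*ʳ b (T a) (T b) k))

  T-+ : ∀ a b k → T (a + b) k ≡ conv (T a) (T b) k
  T-+ a b zero    = refl
  T-+ a b (suc k) = begin
    T (a + b) k * (a + b) * recip k
      ≡⟨ cong (λ t → t * (a + b) * recip k) (T-+ a b k) ⟩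
    conv (T a) (T b) k * (a + b) * recip k
      ≡⟨ cong (_* recip k) (trans (*-comm (conv (T a) (T b) k) (a + b)) (sym (conv-T-suc a b k))) ⟩
    ι (suc k) * conv (T a) (T b) (suc k) * recip k
      ≡⟨ solve 3 (λ n c r → n :* c :* r := c :* (r :* n)) refl (ι (suc k)) (conv (T a) (T b) (suc k)) (recip k) ⟩
    conv (T a) (T b) (suc k) * (recip k * ι (suc k))
      ≡⟨ trans (cong (conv (T a) (T b) (suc k) *_) (recip-inv k)) (*-identityʳ _) ⟩
    conv (T a) (T b) (suc k) ∎
    where open ≡-Reasoning

  -- `conv f (Σ≤ g) n` sums the triangle `i + j ≤ n` by rows; passing to `suc n` adds one diagonal.
  conv-Σ : ∀ f g n → conv f (Σ≤ g) (suc n) ≡ conv f (Σ≤ g) n + conv f g (suc n)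
  conv-Σ f g zero    = solve 4 (λ x y u v → x :* (u :+ v) :+ y :* u := x :* u :+ (x :* v :+ y :* u)) refl (f 0) (f 1) (g 0) (g 1)
  conv-Σ f g (suc n) = trans (cong (f 0 * (Σ≤ g (suc n) + g (suc (suc n))) +_) (conv-Σ (λ i → f (suc i)) g n))
    (solve 5 (λ x y z u v → x :* (y :+ z) :+ (u :+ v) := (x :* y :+ u) :+ (x :* z :+ v)) refl
      (f 0) (Σ≤ g (suc n)) (g (suc (suc n))) (conv (λ i → f (suc i)) (Σ≤ g) n) (conv (λ i → f (suc i)) g (suc n)))

  S≡Σ≤ : ∀ a n → S a n ≡ Σ≤ (T a) n
  S≡Σ≤ a zero    = refl
  S≡Σ≤ a (suc n) = cong (_+ T a (suc n)) (S≡Σ≤ a n)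

  S-+ : ∀ a b n → S (a + b) n ≡ conv (T a) (Σ≤ (T b)) n
  S-+ a b zero    = refl
  S-+ a b (suc n) = trans (cong₂ _+_ (S-+ a b n) (T-+ a b (suc n))) (sym (conv-Σ (T a) (T b) n))

  Σ≤-front : ∀ f n → Σ≤ f (suc n) ≡ f 0 + Σ≤ (λ i → f (suc i)) n
  Σ≤-front f zero    = refl
  Σ≤-front f (suc n) = trans (cong (_+ f (suc (suc n))) (Σ≤-front f n)) (+-assoc (f 0) _ _)

  Σ≤-nonNeg : ∀ {f} → (∀ i → 0ℚ ≤ f i) → ∀ n → 0ℚ ≤ Σ≤ f n
  Σ≤-nonNeg h zero    = h 0
  Σ≤-nonNeg h (suc n) = +-mono-≤ (Σ≤-nonNeg h n) (h (suc n))

  Σ≤-abs : ∀ {f F} → (∀ i → ∣ f i ∣ ≤ F i) → ∀ n → ∣ Σ≤ f n ∣ ≤ Σ≤ F n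
  Σ≤-abs h zero = h 0
  Σ≤-abs {f} h (suc n) = ≤-trans (∣p+q∣≤∣p∣+∣q∣ (Σ≤ f n) (f (suc n))) (+-mono-≤ (Σ≤-abs h n) (h (suc n)))

  conv-nonNeg : ∀ {f g} → (∀ i → 0ℚ ≤ f i) → (∀ i → 0ℚ ≤ g i) → ∀ k → 0ℚ ≤ conv f g k
  conv-nonNeg p q zero    = *-nonNeg (p 0) (q 0)
  conv-nonNeg p q (suc k) = +-mono-≤ (*-nonNeg (p 0) (q (suc k))) (conv-nonNeg (λ i → p (suc i)) q k)

  -- The part of the product of two partial sums that lies beyond the diagonal i + j = n.
  excess : (ℕ → ℚ) → (ℕ → ℚ) → ℕ → ℚ
  excess f g n = Σ≤ f n * Σ≤ g n - conv f (Σ≤ g) n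

  -- The definition subtracts, but this recursion only adds, so that majorants pass through it in
  -- `excess-abs`.
  excess-suc : ∀ f g n → excess f g (suc n) ≡ excess (λ i → f (suc i)) g n + Σ≤ (λ i → f (suc i)) n * g (suc n)
  excess-suc f g n = trans (cong (λ z → z * Σ≤ g (suc n) - conv f (Σ≤ g) (suc n)) (Σ≤-front f n))
    (solve 5 (λ x s u v c → (x :+ s) :* (u :+ v) :- (x :* (u :+ v) :+ c) := (s :* u :- c) :+ s :* v) refl
      (f 0) (Σ≤ (λ i → f (suc i)) n) (Σ≤ g n) (g (suc n)) (conv (λ i → f (suc i)) (Σ≤ g) n))

  excess-abs : ∀ {f g F G} → (∀ i → ∣ f i ∣ ≤ F i) → (∀ i → ∣ g i ∣ ≤ G i) → ∀ n → ∣ excess f g n ∣ ≤ excess F G n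
  excess-abs {f} {g} {F} {G} p q zero = ≤-reflexive (trans (cong ∣_∣ (+-inverseʳ (f 0 * g 0))) (sym (+-inverseʳ (F 0 * G 0))))
  excess-abs {f} {g} {F} {G} p q (suc n) = begin
    ∣ excess f g (suc n) ∣                                      ≡⟨ cong ∣_∣ (excess-suc f g n) ⟩
    ∣ excess f⁺ g n + Σ≤ f⁺ n * g (suc n) ∣                     ≤⟨ ∣p+q∣≤∣p∣+∣q∣ (excess f⁺ g n) _ ⟩
    ∣ excess f⁺ g n ∣ + ∣ Σ≤ f⁺ n * g (suc n) ∣                 ≡⟨ cong (∣ excess f⁺ g n ∣ +_) (∣p*q∣≡∣p∣*∣q∣ (Σ≤ f⁺ n) (g (suc n))) ⟩
    ∣ excess f⁺ g n ∣ + ∣ Σ≤ f⁺ n ∣ * ∣ g (suc n) ∣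
      ≤⟨ +-mono-≤ (excess-abs p⁺ q n) (*-mono (0≤∣p∣ (Σ≤ f⁺ n)) (≤-trans (0≤∣p∣ (g (suc n))) (q (suc n))) (Σ≤-abs p⁺ n) (q (suc n))) ⟩
    excess F⁺ G n + Σ≤ F⁺ n * G (suc n)                         ≡⟨ sym (excess-suc F G n) ⟩
    excess F G (suc n)                                          ∎
    where
    open ≤-Reasoning
    f⁺ F⁺ : ℕ → ℚ
    f⁺ i = f (suc i)
    F⁺ i = F (suc i)
    p⁺ : ∀ i → ∣ f⁺ i ∣ ≤ F⁺ i
    p⁺ i = p (suc i)

  Σ≤-mono : ∀ {g} → (∀ i → 0ℚ ≤ g i) → ∀ m j → Σ≤ g j ≤ Σ≤ g (m ℕ.+ j)
  Σ≤-mono h zero j = ≤-refl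
  Σ≤-mono {g} h (suc m) j = ≤-trans (Σ≤-mono h m j)
    (subst (_≤ Σ≤ g (suc m ℕ.+ j)) (+-identityʳ _) (+-monoʳ-≤ (Σ≤ g (m ℕ.+ j)) (h (suc m ℕ.+ j))))

  -- The rectangle `[0,m] × [0,j]` lies in the triangle of side `m + j`, and all terms are
  -- non-negative.
  Σ≤-*-≤-conv : ∀ {f g} → (∀ i → 0ℚ ≤ f i) → (∀ i → 0ℚ ≤ g i) → ∀ m j → Σ≤ f m * Σ≤ g j ≤ conv f (Σ≤ g) (m ℕ.+ j)
  Σ≤-*-≤-conv p q zero zero = ≤-refl
  Σ≤-*-≤-conv {f} {g} p q zero (suc j) = subst (_≤ conv f (Σ≤ g) (suc j)) (+-identityʳ _)
    (+-monoʳ-≤ (f 0 * Σ≤ g (suc j)) (conv-nonNeg (λ i → p (suc i)) (Σ≤-nonNeg q) j))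
  Σ≤-*-≤-conv {f} {g} p q (suc m) j = begin
    Σ≤ f (suc m) * Σ≤ g j                          ≡⟨ trans (cong (_* Σ≤ g j) (Σ≤-front f m)) (*-distribʳ-+ (Σ≤ g j) (f 0) _) ⟩
    f 0 * Σ≤ g j + Σ≤ (λ i → f (suc i)) m * Σ≤ g j
      ≤⟨ +-mono-≤ (*-monoˡ (p 0) (Σ≤-mono q (suc m) j)) (Σ≤-*-≤-conv (λ i → p (suc i)) q m j) ⟩
    conv f (Σ≤ g) (suc m ℕ.+ j)                    ∎
    where open ≤-Reasoning

  -- The excess is majorised by that of `A` and `B`, whose indices lie between the triangles of
  -- sides `n` and `n + n`: a stretch of the tail of the series of `A + B`.
  S-*-≤ : ∀ {a b A B} → ∣ a ∣ ≤ A → ∣ b ∣ ≤ B → ∀ n →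
    ∣ S a n * S b n - S (a + b) n ∣ ≤ S (A + B) (n ℕ.+ n) - S (A + B) n
  S-*-≤ {a} {b} {A} {B} ha hb n = begin
    ∣ S a n * S b n - S (a + b) n ∣
      ≡⟨ cong ∣_∣ (cong₂ _-_ (cong₂ _*_ (S≡Σ≤ a n) (S≡Σ≤ b n)) (S-+ a b n)) ⟩
    ∣ excess (T a) (T b) n ∣           ≤⟨ excess-abs (T-abs ha) (T-abs hb) n ⟩
    excess (T A) (T B) n
      ≤⟨ +-monoˡ-≤ (- conv (T A) (Σ≤ (T B)) n) (Σ≤-*-≤-conv (T-nonNeg 0≤A) (T-nonNeg 0≤B) n n) ⟩
    conv (T A) (Σ≤ (T B)) (n ℕ.+ n) - conv (T A) (Σ≤ (T B)) n
      ≡⟨ cong₂ _-_ (sym (S-+ A B (n ℕ.+ n))) (sym (S-+ A B n)) ⟩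
    S (A + B) (n ℕ.+ n) - S (A + B) n ∎
    where
    open ≤-Reasoning
    0≤A : 0ℚ ≤ A
    0≤A = ≤-trans (0≤∣p∣ a) ha
    0≤B : 0ℚ ≤ B
    0≤B = ≤-trans (0≤∣p∣ b) hb

  module _ (s t : ℕ → ℚ) {A B} (N : ℕ) (hs : ∀ n → N ℕ.≤ n → ∣ s n ∣ ≤ A) (ht : ∀ n → N ℕ.≤ n → ∣ t n ∣ ≤ B) where
    open Limits
    private
      0≤A+B : 0ℚ ≤ A + B
      0≤A+B = +-mono-≤ (≤-trans (0≤∣p∣ (s N)) (hs N ℕₚ.≤-refl)) (≤-trans (0≤∣p∣ (t N)) (ht N ℕₚ.≤-refl))
    open ExpLemmas.Bound (A + B) 0≤A+B

    S-*-null : Null (λ n → dist (S (s n) n * S (t n) n) (S (s n + t n) n))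
    S-*-null ε 0<ε = let (M′ , h) = T-null ε 0<ε in
      N ℕ.⊔ (M ℕ.⊔ M′) , λ n p → ≤-<-trans
        (≤-trans (S-*-≤ (hs n (ℕₚ.m⊔n≤o⇒m≤o N _ p)) (ht n (ℕₚ.m⊔n≤o⇒m≤o N _ p)) n)
          (tail≤ n n (ℕₚ.m⊔n≤o⇒m≤o M M′ (ℕₚ.m⊔n≤o⇒n≤o N _ p))))
        (h n (ℕₚ.m⊔n≤o⇒n≤o M M′ (ℕₚ.m⊔n≤o⇒n≤o N _ p)))

-- Coefficients and degrees of integer polynomials

module IntegerPolynomials where
  open import Data.Integer.Base hiding (suc; _≤_; _<_; _^_)
  open import Data.Integer.Properties hiding (≤-refl; ≤-trans; <⇒≤)
  open import Data.Integer.Divisibility.Signed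
  open import Data.Nat.Base using (_^_)
  open ℤ-Solver using (solve; _:=_; _:+_; _:*_; :-_; _:-_; con)
  open import Defs using (Poly; coeff; _≈ₚ_; _+ₚ_; _*ₚ_; degree; height)

  scale : ℤ → Poly → Poly
  scale c = List.map (c *_)

  coeff-+ₚ : ∀ p q i → coeff (p +ₚ q) i ≡ coeff p i + coeff q i
  coeff-+ₚ []      q       i       = sym (+-identityˡ (coeff q i))
  coeff-+ₚ (a ∷ p) []      i       = sym (+-identityʳ (coeff (a ∷ p) i))
  coeff-+ₚ (a ∷ p) (b ∷ q) zero    = refl
  coeff-+ₚ (a ∷ p) (b ∷ q) (suc i) = coeff-+ₚ p q i

  coeff-scale : ∀ c p i → coeff (scale c p) i ≡ c * coeff p i
  coeff-scale c []      i       = sym (*-zeroʳ c)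
  coeff-scale c (a ∷ p) zero    = refl
  coeff-scale c (a ∷ p) (suc i) = coeff-scale c p i

  coeff-*ₚ-zero : ∀ a p q → coeff ((a ∷ p) *ₚ q) 0 ≡ a * coeff q 0
  coeff-*ₚ-zero a p q = trans (coeff-+ₚ (scale a q) (0ℤ ∷ (p *ₚ q)) 0)
    (trans (+-identityʳ _) (coeff-scale a q 0))

  coeff-*ₚ-suc : ∀ a p q k → coeff ((a ∷ p) *ₚ q) (suc k) ≡ a * coeff q (suc k) + coeff (p *ₚ q) k
  coeff-*ₚ-suc a p q k = trans (coeff-+ₚ (scale a q) (0ℤ ∷ (p *ₚ q)) (suc k))
    (cong (_+ coeff (p *ₚ q) k) (coeff-scale a q (suc k)))

  *ₚ-congʳ : ∀ p {q r} → q ≈ₚ r → p *ₚ q ≈ₚ p *ₚ r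
  *ₚ-congʳ []      h k = refl
  *ₚ-congʳ (a ∷ p) {q} {r} h zero = trans (coeff-*ₚ-zero a p q) (trans (cong (a *_) (h 0)) (sym (coeff-*ₚ-zero a p r)))
  *ₚ-congʳ (a ∷ p) {q} {r} h (suc k) = trans (coeff-*ₚ-suc a p q k)
    (trans (cong₂ _+_ (cong (a *_) (h (suc k))) (*ₚ-congʳ p h k)) (sym (coeff-*ₚ-suc a p r k)))

  *ₚ-distribʳ : ∀ p q r k → coeff ((p +ₚ q) *ₚ r) k ≡ coeff (p *ₚ r) k + coeff (q *ₚ r) k
  *ₚ-distribʳ []      q       r k = sym (+-identityˡ _)
  *ₚ-distribʳ (a ∷ p) []      r k = sym (+-identityʳ _)
  *ₚ-distribʳ (a ∷ p) (b ∷ q) r zero = trans (coeff-*ₚ-zero (a + b) (p +ₚ q) r)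
    (trans (*-distribʳ-+ (coeff r 0) a b) (sym (cong₂ _+_ (coeff-*ₚ-zero a p r) (coeff-*ₚ-zero b q r))))
  *ₚ-distribʳ (a ∷ p) (b ∷ q) r (suc k) = trans (coeff-*ₚ-suc (a + b) (p +ₚ q) r k)
    (trans (cong (λ z → (a + b) * coeff r (suc k) + z) (*ₚ-distribʳ p q r k))
    (trans (solve 5 (λ a b x u v → (a :+ b) :* x :+ (u :+ v) := (a :* x :+ u) :+ (b :* x :+ v)) refl
              a b (coeff r (suc k)) (coeff (p *ₚ r) k) (coeff (q *ₚ r) k))
      (sym (cong₂ _+_ (coeff-*ₚ-suc a p r k) (coeff-*ₚ-suc b q r k)))))

  scale-*ₚˡ : ∀ c p q k → coeff (scale c p *ₚ q) k ≡ c * coeff (p *ₚ q) k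
  scale-*ₚˡ c []      q k = sym (*-zeroʳ c)
  scale-*ₚˡ c (a ∷ p) q zero = trans (coeff-*ₚ-zero (c * a) (scale c p) q)
    (trans (*-assoc c a (coeff q 0)) (cong (c *_) (sym (coeff-*ₚ-zero a p q))))
  scale-*ₚˡ c (a ∷ p) q (suc k) = trans (coeff-*ₚ-suc (c * a) (scale c p) q k)
    (trans (cong (λ z → c * a * coeff q (suc k) + z) (scale-*ₚˡ c p q k))
    (trans (solve 4 (λ c a x u → c :* a :* x :+ c :* u := c :* (a :* x :+ u)) refl c a (coeff q (suc k)) (coeff (p *ₚ q) k))
      (cong (c *_) (sym (coeff-*ₚ-suc a p q k)))))

  scale-*ₚʳ : ∀ c p q k → coeff (p *ₚ scale c q) k ≡ c * coeff (p *ₚ q) k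
  scale-*ₚʳ c []      q k = sym (*-zeroʳ c)
  scale-*ₚʳ c (a ∷ p) q zero = trans (coeff-*ₚ-zero a p (scale c q))
    (trans (cong (a *_) (coeff-scale c q 0))
    (trans (solve 3 (λ c a x → a :* (c :* x) := c :* (a :* x)) refl c a (coeff q 0)) (cong (c *_) (sym (coeff-*ₚ-zero a p q)))))
  scale-*ₚʳ c (a ∷ p) q (suc k) = trans (coeff-*ₚ-suc a p (scale c q) k)
    (trans (cong₂ (λ x u → a * x + u) (coeff-scale c q (suc k)) (scale-*ₚʳ c p q k))
    (trans (solve 4 (λ c a x u → a :* (c :* x) :+ c :* u := c :* (a :* x :+ u)) refl c a (coeff q (suc k)) (coeff (p *ₚ q) k))
      (cong (c *_) (sym (coeff-*ₚ-suc a p q k)))))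

  -- Formulated by coefficients, so that trailing zeros do not matter and `DegLT p 0` covers the
  -- zero polynomial.
  DegLT : Poly → ℕ → Set
  DegLT p d = ∀ i → d ℕ.≤ i → coeff p i ≡ 0ℤ

  DegLT-length : ∀ p → DegLT p (length p)
  DegLT-length []      i       h       = refl
  DegLT-length (a ∷ p) (suc i) (s≤s h) = DegLT-length p i h

  DegLT-mono : ∀ {p d e} → d ℕ.≤ e → DegLT p d → DegLT p e
  DegLT-mono d≤e h i e≤i = h i (ℕₚ.≤-trans d≤e e≤i)

  coeff-*ₚ-null : ∀ p q → DegLT p 0 → ∀ k → coeff (p *ₚ q) k ≡ 0ℤ
  coeff-*ₚ-null []      q h k = refl
  coeff-*ₚ-null (a ∷ p) q h zero = trans (coeff-*ₚ-zero a p q) (cong (_* coeff q 0) (h 0 z≤n))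
  coeff-*ₚ-null (a ∷ p) q h (suc k) = trans (coeff-*ₚ-suc a p q k)
    (cong₂ _+_ (cong (_* coeff q (suc k)) (h 0 z≤n)) (coeff-*ₚ-null p q (λ i _ → h (suc i) z≤n) k))

  *-zeroed : ∀ a {x} → x ≡ 0ℤ → a * x ≡ 0ℤ
  *-zeroed a e = trans (cong (a *_) e) (*-zeroʳ a)

  coeff-*ₚ-top : ∀ p q d e → DegLT p (suc d) → DegLT q (suc e) → coeff (p *ₚ q) (d ℕ.+ e) ≡ coeff p d * coeff q e
  coeff-*ₚ-top []      q d e hp hq = refl
  coeff-*ₚ-top (a ∷ p) q zero zero hp hq = coeff-*ₚ-zero a p q
  coeff-*ₚ-top (a ∷ p) q zero (suc e) hp hq = trans (coeff-*ₚ-suc a p q e)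
    (trans (cong (λ z → a * coeff q (suc e) + z) (coeff-*ₚ-null p q (λ i _ → hp (suc i) (s≤s z≤n)) e)) (+-identityʳ _))
  coeff-*ₚ-top (a ∷ p) q (suc d) e hp hq = trans (coeff-*ₚ-suc a p q (d ℕ.+ e))
    (trans (cong₂ _+_ (*-zeroed a (hq (suc (d ℕ.+ e)) (s≤s (ℕₚ.m≤n+m e d))))
                      (coeff-*ₚ-top p q d e (λ i h → hp (suc i) (s≤s h)) hq))
      (+-identityˡ _))

  DegLT-*ₚ : ∀ p q {e} → DegLT q (suc e) → DegLT (p *ₚ q) (length p ℕ.+ e)
  DegLT-*ₚ []      q hq i h = refl
  DegLT-*ₚ (a ∷ p) q {e} hq (suc i) (s≤s h) = trans (coeff-*ₚ-suc a p q i)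
    (cong₂ _+_ (*-zeroed a (hq (suc i) (s≤s (ℕₚ.≤-trans (ℕₚ.m≤n+m e (length p)) h)))) (DegLT-*ₚ p q hq i h))

  shift : ℕ → Poly → Poly
  shift zero    p = p
  shift (suc s) p = 0ℤ ∷ shift s p

  coeff-shift : ∀ s p j → coeff (shift s p) (s ℕ.+ j) ≡ coeff p j
  coeff-shift zero    p j = refl
  coeff-shift (suc s) p j = coeff-shift s p j

  coeff-shift-*ₚ : ∀ s m p k → coeff (shift s (m ∷ []) *ₚ p) k ≡ m * coeff (shift s p) k
  coeff-shift-*ₚ zero m p zero = coeff-*ₚ-zero m [] p
  coeff-shift-*ₚ zero m p (suc k) = trans (coeff-*ₚ-suc m [] p k) (+-identityʳ _)
  coeff-shift-*ₚ (suc s) m p zero = trans (coeff-*ₚ-zero 0ℤ (shift s (m ∷ [])) p) (sym (*-zeroʳ m))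
  coeff-shift-*ₚ (suc s) m p (suc k) = trans (coeff-*ₚ-suc 0ℤ (shift s (m ∷ [])) p k)
    (trans (+-identityˡ _) (coeff-shift-*ₚ s m p k))

  -- Pseudo-division and Gauss's lemma

  record PseudoDivision (v : ℕ) (p q : Poly) : Set where
    field
      multiplier          : ℤ
      multiplier≢0        : multiplier ≢ 0ℤ
      quotientₚ remainder : Poly
      remainder-degree    : DegLT remainder v
      equation            : ∀ k → multiplier * coeff p k ≡ coeff (quotientₚ *ₚ q) k + coeff remainder k

  i*j≢0′ : ∀ {i j} → i ≢ 0ℤ → j ≢ 0ℤ → i * j ≢ 0ℤ
  i*j≢0′ {i} i≢0 j≢0 e = [ i≢0 , j≢0 ]′ (i*j≡0⇒i≡0∨j≡0 i e)

  -- Each reduction step multiplies the dividend by the leading coefficient of `q` instead of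
  -- dividing by it, so the `multiplier` is a power of that coefficient.
  pseudoDivide : ∀ q v → DegLT q (suc v) → coeff q v ≢ 0ℤ → ∀ d p → DegLT p d → PseudoDivision v p q
  pseudoDivide q v hq lead≢0 d p hp with d ℕₚ.≤? v
  ... | yes d≤v = record
    { multiplier = 1ℤ ; multiplier≢0 = λ () ; quotientₚ = [] ; remainder = p
    ; remainder-degree = DegLT-mono {p} d≤v hp
    ; equation = λ k → trans (*-identityˡ _) (sym (+-identityˡ _)) }
  pseudoDivide q v hq lead≢0 zero    p hp | no d≰v = contradiction z≤n d≰v
  pseudoDivide q v hq lead≢0 (suc d) p hp | no d≰v = record
    { multiplier = multiplier * c ; multiplier≢0 = i*j≢0′ multiplier≢0 lead≢0
    ; quotientₚ = quotientₚ +ₚ shift s (multiplier * b ∷ []) ; remainder = remainder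
    ; remainder-degree = remainder-degree
    ; equation = equation′ }
    where
    b c : ℤ
    b = coeff p d
    c = coeff q v
    s : ℕ
    s = d ℕ.∸ v
    v≤d : v ℕ.≤ d
    v≤d = ℕₚ.≤-pred (ℕₚ.≰⇒> d≰v)
    -- `c p − b X^s q`, in which the terms of degree `d` cancel.
    p₁ : Poly
    p₁ = scale c p +ₚ scale (- b) (shift s q)
    coeff-p₁ : ∀ k → coeff p₁ k ≡ c * coeff p k + - b * coeff (shift s q) k
    coeff-p₁ k = trans (coeff-+ₚ (scale c p) (scale (- b) (shift s q)) k)
      (cong₂ _+_ (coeff-scale c p k) (coeff-scale (- b) (shift s q) k))
    at : ∀ j → coeff p₁ (s ℕ.+ j) ≡ c * coeff p (s ℕ.+ j) + - b * coeff q j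
    at j = trans (coeff-p₁ (s ℕ.+ j)) (cong (λ z → c * coeff p (s ℕ.+ j) + - b * z) (coeff-shift s q j))
    s+v≡d : s ℕ.+ v ≡ d
    s+v≡d = ℕₚ.m∸n+n≡m v≤d
    hp₁′ : ∀ j → v ℕ.≤ j → coeff p₁ (s ℕ.+ j) ≡ 0ℤ
    hp₁′ j v≤j with ℕₚ.m≤n⇒m<n∨m≡n v≤j
    ... | inj₁ v<j = trans (at j) (cong₂ _+_
      (*-zeroed c (hp (s ℕ.+ j) (subst (ℕ._≤ s ℕ.+ j) (trans (ℕₚ.+-suc s v) (cong suc s+v≡d)) (ℕₚ.+-monoʳ-≤ s v<j))))
      (*-zeroed (- b) (hq j v<j)))
    ... | inj₂ refl = trans (at v) (trans (cong (λ i → c * coeff p i + - b * c) s+v≡d)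
      (solve 2 (λ b c → c :* b :+ (:- b) :* c := con 0ℤ) refl b c))
    hp₁ : DegLT p₁ d
    hp₁ i d≤i = subst (λ k → coeff p₁ k ≡ 0ℤ) (ℕₚ.m+[n∸m]≡n (ℕₚ.≤-trans (ℕₚ.m∸n≤m d v) d≤i))
      (hp₁′ (i ℕ.∸ s) (subst (ℕ._≤ i ℕ.∸ s) (trans (cong (ℕ._∸ s) (sym s+v≡d)) (ℕₚ.m+n∸m≡n s v)) (ℕₚ.∸-monoˡ-≤ s d≤i)))
    open PseudoDivision (pseudoDivide q v hq lead≢0 d p₁ hp₁)
    equation′ : ∀ k → multiplier * c * coeff p k ≡
      coeff ((quotientₚ +ₚ shift s (multiplier * b ∷ [])) *ₚ q) k + coeff remainder k
    equation′ k = begin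
      multiplier * c * coeff p k
        ≡⟨ solve 5 (λ m c x b y → m :* c :* x := m :* (c :* x :+ (:- b) :* y) :+ m :* b :* y) refl multiplier c (coeff p k) b y ⟩
      multiplier * (c * coeff p k + - b * y) + multiplier * b * y
        ≡⟨ cong (_+ multiplier * b * y) (trans (cong (multiplier *_) (sym (coeff-p₁ k))) (equation k)) ⟩
      coeff (quotientₚ *ₚ q) k + coeff remainder k + multiplier * b * y
        ≡⟨ solve 3 (λ u r w → u :+ r :+ w := u :+ w :+ r) refl (coeff (quotientₚ *ₚ q) k) (coeff remainder k) (multiplier * b * y) ⟩
      coeff (quotientₚ *ₚ q) k + multiplier * b * y + coeff remainder k
        ≡⟨ cong (_+ coeff remainder k) (sym (trans (*ₚ-distribʳ quotientₚ _ q k)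
            (cong (λ z → coeff (quotientₚ *ₚ q) k + z) (coeff-shift-*ₚ s (multiplier * b) q k)))) ⟩
      coeff ((quotientₚ +ₚ shift s (multiplier * b ∷ [])) *ₚ q) k + coeff remainder k ∎
      where
      open ≡-Reasoning
      y = coeff (shift s q) k

  ∣-coeff-*ₚ : ∀ {ℓ} p q k → (∀ j → j ℕ.≤ k → ℓ ∣ coeff q j) → ℓ ∣ coeff (p *ₚ q) k
  ∣-coeff-*ₚ []      q k h = divides 0ℤ refl
  ∣-coeff-*ₚ {ℓ} (a ∷ p) q zero h = subst (ℓ ∣_) (sym (coeff-*ₚ-zero a p q)) (∣n⇒∣m*n a (h 0 z≤n))
  ∣-coeff-*ₚ {ℓ} (a ∷ p) q (suc k) h = subst (ℓ ∣_) (sym (coeff-*ₚ-suc a p q k))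
    (∣m∣n⇒∣m+n (∣n⇒∣m*n a (h (suc k) ℕₚ.≤-refl)) (∣-coeff-*ₚ p q k (λ j j≤k → h j (ℕₚ.m≤n⇒m≤1+n j≤k))))

  prime-split : ∀ {ℓ} → Prime ℓ → ∀ i j → (+ ℓ ∣ i * j) → (+ ℓ ∣ i) ⊎ (+ ℓ ∣ j)
  prime-split {ℓ} pr i j h with euclidsLemma ∣ i ∣ ∣ j ∣ pr (subst (ℓ ℕ∣.∣_) (abs-* i j) (∣⇒∣ᵤ h))
  ... | inj₁ d = inj₁ (∣ᵤ⇒∣ d)
  ... | inj₂ d = inj₂ (∣ᵤ⇒∣ d)

  gauss : ∀ {ℓ} → Prime ℓ → ∀ p q → (∀ k → + ℓ ∣ coeff (p *ₚ q) k) → All (+ ℓ ∣_) p ⊎ (∀ k → + ℓ ∣ coeff q k)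
  gauss pr [] q h = inj₁ []
  gauss {ℓ} pr (a ∷ p) q h with + ℓ ∣? a
  ... | yes ℓ∣a with gauss pr p q (λ k → ∣m+n∣m⇒∣n (subst (+ ℓ ∣_) (coeff-*ₚ-suc a p q k) (h (suc k))) (∣m⇒∣m*n (coeff q (suc k)) ℓ∣a))
  ...   | inj₁ ℓ∣p = inj₁ (ℓ∣a ∷ ℓ∣p)
  ...   | inj₂ ℓ∣q = inj₂ ℓ∣q
  gauss {ℓ} pr (a ∷ p) q h | no ℓ∤a = inj₂ (<-rec (λ k → + ℓ ∣ coeff q k) step)
    where
    cancel : ∀ k → + ℓ ∣ a * coeff q k → + ℓ ∣ coeff q k
    cancel k d = [ (λ d′ → contradiction d′ ℓ∤a) , (λ d′ → d′) ]′ (prime-split pr a (coeff q k) d)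
    step : ∀ k → (∀ {j} → j ℕ.< k → + ℓ ∣ coeff q j) → + ℓ ∣ coeff q k
    step zero    _   = cancel 0 (subst (+ ℓ ∣_) (coeff-*ₚ-zero a p q) (h 0))
    step (suc k) rec = cancel (suc k) (∣m+n∣n⇒∣m {m = a * coeff q (suc k)} (subst (+ ℓ ∣_) (coeff-*ₚ-suc a p q k) (h (suc k)))
      (∣-coeff-*ₚ p q k (λ j j≤k → rec (s≤s j≤k))))

  All-∣⇒scale : ∀ {ℓ p} → All (ℓ ∣_) p → ∃[ p′ ] p ≡ scale ℓ p′
  All-∣⇒scale [] = [] , refl
  All-∣⇒scale {ℓ} (divides a′ e ∷ ds) = let (p′ , e′) = All-∣⇒scale ds in
    a′ ∷ p′ , cong₂ _∷_ (trans e (*-comm a′ ℓ)) e′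

  All-coeff : ∀ {ℓ} {P : ℤ → Set ℓ} p → (∀ k → P (coeff p k)) → All P p
  All-coeff []      h = []
  All-coeff (a ∷ p) h = h 0 ∷ All-coeff p (λ k → h (suc k))

  -- A divisor `q` of `p` over the rationals, turned into a divisor over the integers. The `factor`
  -- need not be primitive: only primes of the multiplier are removed.
  record PrimitiveFactorisation (p q : Poly) : Set where
    field
      cofactor factor : Poly
      multiple        : ℤ
      multiple≢0      : multiple ≢ 0ℤ
      scaled          : ∀ k → coeff q k ≡ multiple * coeff factor k
      factorised      : p ≈ₚ cofactor *ₚ factor

  -- By `gauss` each prime of the multiplier divides `a` or `q` and is cancelled there; a prime
  -- taken out of `q` is recorded in `multiple`.
  clearPrimes : ∀ ℓs → All Prime ℓs → ∀ p a q → (∀ k → + ∏ ℓs * coeff p k ≡ coeff (a *ₚ q) k) → PrimitiveFactorisation p q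
  clearPrimes [] [] p a q h = record
    { cofactor = a ; factor = q ; multiple = 1ℤ ; multiple≢0 = λ () ; scaled = λ k → sym (*-identityˡ _)
    ; factorised = λ k → trans (sym (*-identityˡ _)) (h k) }
  clearPrimes (ℓ ∷ ℓs) (pr ∷ prs) p a q h = divide (gauss pr a q ℓ∣aq)
    where
    peel : ∀ k → + ℓ * (+ ∏ ℓs * coeff p k) ≡ coeff (a *ₚ q) k
    peel k = trans (sym (*-assoc (+ ℓ) (+ ∏ ℓs) (coeff p k))) (trans (cong (_* coeff p k) (sym (pos-* ℓ (∏ ℓs)))) (h k))
    ℓ∣aq : ∀ k → + ℓ ∣ coeff (a *ₚ q) k
    ℓ∣aq k = subst (+ ℓ ∣_) (peel k) (∣m⇒∣m*n (+ ∏ ℓs * coeff p k) ∣-refl)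
    cancel : ∀ {i j} → + ℓ * i ≡ + ℓ * j → i ≡ j
    cancel = *-cancelˡ-≡ (+ ℓ) _ _ {{prime⇒nonZero pr}}
    divide : All (+ ℓ ∣_) a ⊎ (∀ k → + ℓ ∣ coeff q k) → PrimitiveFactorisation p q
    divide (inj₁ ℓ∣a) = let (a′ , e) = All-∣⇒scale ℓ∣a in
      clearPrimes ℓs prs p a′ q λ k → cancel (trans (peel k) (trans (cong (λ a → coeff (a *ₚ q) k) e) (scale-*ₚˡ (+ ℓ) a′ q k)))
    divide (inj₂ ℓ∣q) = record
      { cofactor = F.cofactor ; factor = F.factor ; multiple = + ℓ * F.multiple
      ; multiple≢0 = i*j≢0′ (λ e → ℕ.≢-nonZero⁻¹ ℓ {{prime⇒nonZero pr}} (+-injective e)) F.multiple≢0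
      ; scaled = λ k → trans (cong (λ q → coeff q k) q≡) (trans (coeff-scale (+ ℓ) q′ k)
          (trans (cong (+ ℓ *_) (F.scaled k)) (sym (*-assoc (+ ℓ) F.multiple _))))
      ; factorised = F.factorised }
      where
      q′ = proj₁ (All-∣⇒scale (All-coeff q ℓ∣q))
      q≡ = proj₂ (All-∣⇒scale (All-coeff q ℓ∣q))
      module F = PrimitiveFactorisation (clearPrimes ℓs prs p a q′ λ k →
        cancel (trans (peel k) (trans (cong (λ q → coeff (a *ₚ q) k) q≡) (scale-*ₚʳ (+ ℓ) a q′ k))))

  ∣i∣≡unit*i : ∀ i → ∃[ u ] + ∣ i ∣ ≡ u * i
  ∣i∣≡unit*i (+ n)    = 1ℤ , sym (*-identityˡ (+ n))
  ∣i∣≡unit*i -[1+ n ] = -1ℤ , sym (-1*i≡-i -[1+ n ])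

  primitiveFactorisation : ∀ e → e ≢ 0ℤ → ∀ p a q → (∀ k → e * coeff p k ≡ coeff (a *ₚ q) k) → PrimitiveFactorisation p q
  primitiveFactorisation e e≢0 p a q h =
    clearPrimes (PrimeFactorisation.factors fs) (PrimeFactorisation.factorsPrime fs) p (scale u a) q λ k → begin
      + ∏ (PrimeFactorisation.factors fs) * coeff p k  ≡⟨ cong (λ n → + n * coeff p k) (sym (PrimeFactorisation.isFactorisation fs)) ⟩
      + ∣ e ∣ * coeff p k                                         ≡⟨ cong (_* coeff p k) (proj₂ (∣i∣≡unit*i e)) ⟩
      u * e * coeff p k                                           ≡⟨ trans (*-assoc u e _) (cong (u *_) (h k)) ⟩
      u * coeff (a *ₚ q) k                                        ≡⟨ sym (scale-*ₚˡ u a q k) ⟩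
      coeff (scale u a *ₚ q) k                                    ∎
    where
    open ≡-Reasoning
    -- Prime factorisation applies to the absolute value of `e`, so its sign is moved into `a`.
    u = proj₁ (∣i∣≡unit*i e)
    fs : PrimeFactorisation ∣ e ∣
    fs = factorise ∣ e ∣ {{≢-nonZero e≢0}}

  Zero : Poly → Set
  Zero p = ∀ k → coeff p k ≡ 0ℤ

  All⇒Zero : ∀ {p} → All (_≡ 0ℤ) p → Zero p
  All⇒Zero []       k       = refl
  All⇒Zero (e ∷ es) zero    = e
  All⇒Zero (e ∷ es) (suc k) = All⇒Zero es k

  degree-DegLT : ∀ p → DegLT p (suc (degree p))
  degree-DegLT [] i h = refl
  degree-DegLT (a ∷ p) i h with all? (_≟ 0ℤ) p
  degree-DegLT (a ∷ p) (suc i) h       | yes zs = All⇒Zero zs i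
  degree-DegLT (a ∷ p) (suc i) (s≤s h) | no _   = degree-DegLT p i h

  lead≡0⇒Zero : ∀ p → coeff p (degree p) ≡ 0ℤ → Zero p
  lead≡0⇒Zero [] h k = refl
  lead≡0⇒Zero (a ∷ p) h k with all? (_≟ 0ℤ) p
  lead≡0⇒Zero (a ∷ p) h zero    | yes zs = h
  lead≡0⇒Zero (a ∷ p) h (suc k) | yes zs = All⇒Zero zs k
  ... | no ¬zs = contradiction (All-coeff p (lead≡0⇒Zero p h)) ¬zs

  ∣coeff∣≤height : ∀ p i → ∣ coeff p i ∣ ℕ.≤ height p
  ∣coeff∣≤height []      i       = z≤n
  ∣coeff∣≤height (a ∷ p) zero    = ℕₚ.m≤m⊔n ∣ a ∣ (height p)
  ∣coeff∣≤height (a ∷ p) (suc i) = ℕₚ.≤-trans (∣coeff∣≤height p i) (ℕₚ.m≤n⊔m ∣ a ∣ (height p))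

  derivative : Poly → Poly
  derivative []      = []
  derivative (a ∷ p) = p +ₚ (0ℤ ∷ derivative p)

  coeff-derivative : ∀ p i → coeff (derivative p) i ≡ + suc i * coeff p (suc i)
  coeff-derivative []      i    = sym (*-zeroʳ (+ suc i))
  coeff-derivative (a ∷ p) zero = trans (coeff-+ₚ p _ 0) (trans (+-identityʳ _) (sym (*-identityˡ _)))
  coeff-derivative (a ∷ p) (suc i) = trans (coeff-+ₚ p _ (suc i)) (trans (cong (λ z → coeff p (suc i) + z) (coeff-derivative p i))
    (sym (suc-* (+ suc i) (coeff p (suc i)))))

  -- Siegel's lemma and constant combinations of two polynomials

  funToFin-cong : ∀ {m n} {f g : Fin m → Fin n} → (∀ i → f i ≡ g i) → funToFin f ≡ funToFin g
  funToFin-cong {zero}  h = refl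
  funToFin-cong {suc m} h = cong₂ combine (h zero) (funToFin-cong (λ i → h (suc i)))

  finToFun-injective : ∀ {m n} (i j : Fin (n ^ m)) → (∀ k → finToFun {n} {m} i k ≡ finToFun j k) → i ≡ j
  finToFun-injective {m} {n} i j h = trans (sym (Finₚ.funToFin-finToFin {m} {n} i)) (trans (funToFin-cong h) (Finₚ.funToFin-finToFin {m} {n} j))

  0≤i+∣i∣-bound : ∀ {i M} → ∣ i ∣ ℕ.≤ M → + ∣ i + + M ∣ ≡ i + + M
  0≤i+∣i∣-bound {+ n}      {M} h = refl
  0≤i+∣i∣-bound { -[1+ n ]} {M} h = trans (cong (λ z → + ∣ z ∣) (⊖-≥ h)) (sym (⊖-≥ h))

  ∣+m-+n∣≤ : ∀ {m n X} → m ℕ.≤ X → n ℕ.≤ X → ∣ + m - + n ∣ ℕ.≤ X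
  ∣+m-+n∣≤ {m} {n} hm hn = subst (λ z → ∣ z ∣ ℕ.≤ _) (sym (m-n≡m⊖n m n)) (ℕₚ.≤-trans (∣m⊝n∣≤m⊔n m n) (ℕₚ.⊔-lub hm hn))

  module Siegel (m r X M : ℕ) (φ : (Fin m → ℤ) → ℕ → ℤ)
    (φ-- : ∀ w w′ k → φ (λ i → w i - w′ i) k ≡ φ w k - φ w′ k)
    (φ-bound : ∀ w → (∀ i → ∣ w i ∣ ℕ.≤ X) → ∀ k → ∣ φ w k ∣ ℕ.≤ M)
    (many : suc (M ℕ.+ M) ^ r ℕ.< suc X ^ m) where

    private
      point : Fin (suc X ^ m) → Fin m → ℤ
      point a i = + toℕ (finToFun {suc X} {m} a i)

      point≤ : ∀ a i → ∣ point a i ∣ ℕ.≤ X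
      point≤ a i = ℕₚ.≤-pred (Finₚ.toℕ<n (finToFun {suc X} {m} a i))

      value : Fin (suc X ^ m) → Fin r → ℕ
      -- The shift by `M` maps `[−M,M]` injectively to `[0,2M]`; the absolute value only turns the
      -- result into a natural number.
      value a k = ∣ φ (point a) (toℕ k) + + M ∣

      value< : ∀ a k → value a k ℕ.< suc (M ℕ.+ M)
      value< a k = s≤s (ℕₚ.≤-trans (∣i+j∣≤∣i∣+∣j∣ (φ (point a) (toℕ k)) (+ M)) (ℕₚ.+-monoˡ-≤ M (φ-bound (point a) (point≤ a) (toℕ k))))

      values : Fin (suc X ^ m) → Fin r → Fin (suc (M ℕ.+ M))
      values a k = fromℕ< (value< a k)

      values-≡ : ∀ a b → funToFin (values a) ≡ funToFin (values b) → ∀ k → φ (point a) (toℕ k) ≡ φ (point b) (toℕ k)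
      values-≡ a b e k = ∙-cancelʳ (+ M) _ _ (trans (sym (0≤i+∣i∣-bound {φ (point a) (toℕ k)} (φ-bound (point a) (point≤ a) (toℕ k))))
        (trans (cong +_ value≡) (0≤i+∣i∣-bound {φ (point b) (toℕ k)} (φ-bound (point b) (point≤ b) (toℕ k)))))
        where
        value≡ : value a k ≡ value b k
        value≡ = trans (sym (Finₚ.toℕ-fromℕ< (value< a k))) (trans (cong toℕ
          (trans (sym (Finₚ.finToFun-funToFin (values a) k)) (trans (cong (λ c → finToFun {suc (M ℕ.+ M)} {r} c k) e) (Finₚ.finToFun-funToFin (values b) k))))
          (Finₚ.toℕ-fromℕ< (value< b k)))

    -- Pigeonhole on the box `[0,X]^m`: two points with equal values differ by a solution. As the
    -- coordinates of the points are non-negative, those of the difference are at most `X`, not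
    -- `2X`.
    siegel : ∃[ w ] ¬ (∀ i → w i ≡ 0ℤ) × (∀ i → ∣ w i ∣ ℕ.≤ X) × (∀ k → k ℕ.< r → φ w k ≡ 0ℤ)
    siegel = let (a , b , a<b , e) = Finₚ.pigeonhole many (λ a → funToFin (values a)) in
      (λ i → point a i - point b i) ,
      (λ z → Finₚ.<⇒≢ a<b (finToFun-injective {m} {suc X} a b (λ i → Finₚ.toℕ-injective (+-injective (i-j≡0⇒i≡j (point a i) (point b i) (z i)))))) ,
      (λ i → ∣+m-+n∣≤ (point≤ a i) (point≤ b i)) ,
      (λ k k<r → trans (φ-- (point a) (point b) k) (trans (cong (λ z → φ (point a) k - z)
        (sym (subst (λ k → φ (point a) k ≡ φ (point b) k) (Finₚ.toℕ-fromℕ< k<r) (values-≡ a b e (fromℕ< k<r)))))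
        (+-inverseʳ (φ (point a) k))))

  tabulate-*ₚ-- : ∀ {n} (u u′ : Fin n → ℤ) p k →
    coeff (tabulate (λ i → u i - u′ i) *ₚ p) k ≡ coeff (tabulate u *ₚ p) k - coeff (tabulate u′ *ₚ p) k
  tabulate-*ₚ-- {zero}  u u′ p k = refl
  tabulate-*ₚ-- {suc n} u u′ p zero = trans (coeff-*ₚ-zero (u zero - u′ zero) (tabulate (λ i → u (suc i) - u′ (suc i))) p)
    (trans (solve 3 (λ a b x → (a :- b) :* x := a :* x :- b :* x) refl (u zero) (u′ zero) (coeff p 0))
      (sym (cong₂ _-_ (coeff-*ₚ-zero (u zero) (tabulate (λ i → u (suc i))) p) (coeff-*ₚ-zero (u′ zero) (tabulate (λ i → u′ (suc i))) p))))
  tabulate-*ₚ-- {suc n} u u′ p (suc k) = trans (coeff-*ₚ-suc (u zero - u′ zero) (tabulate (λ i → u (suc i) - u′ (suc i))) p k)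
    (trans (cong (λ z → (u zero - u′ zero) * coeff p (suc k) + z) (tabulate-*ₚ-- (λ i → u (suc i)) (λ i → u′ (suc i)) p k))
    (trans (solve 5 (λ a b x y z → (a :- b) :* x :+ (y :- z) := (a :* x :+ y) :- (b :* x :+ z)) refl (u zero) (u′ zero) (coeff p (suc k))
              (coeff (tabulate (λ i → u (suc i)) *ₚ p) k) (coeff (tabulate (λ i → u′ (suc i)) *ₚ p) k))
      (sym (cong₂ _-_ (coeff-*ₚ-suc (u zero) (tabulate (λ i → u (suc i))) p k) (coeff-*ₚ-suc (u′ zero) (tabulate (λ i → u′ (suc i))) p k)))))

  ∣coeff-*ₚ∣≤ : ∀ u p {X H} → (∀ i → ∣ coeff u i ∣ ℕ.≤ X) → (∀ i → ∣ coeff p i ∣ ℕ.≤ H) →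
    ∀ k → ∣ coeff (u *ₚ p) k ∣ ℕ.≤ length u ℕ.* (X ℕ.* H)
  ∣coeff-*ₚ∣≤ []      p hu hp k = z≤n
  ∣coeff-*ₚ∣≤ (a ∷ u) p {X} {H} hu hp zero = subst (ℕ._≤ _) (sym (trans (cong ∣_∣ (coeff-*ₚ-zero a u p)) (abs-* a (coeff p 0))))
    (ℕₚ.≤-trans (ℕₚ.*-mono-≤ (hu 0) (hp 0)) (ℕₚ.m≤m+n (X ℕ.* H) _))
  ∣coeff-*ₚ∣≤ (a ∷ u) p {X} {H} hu hp (suc k) = subst (ℕ._≤ _) (sym (cong ∣_∣ (coeff-*ₚ-suc a u p k)))
    (ℕₚ.≤-trans (∣i+j∣≤∣i∣+∣j∣ (a * coeff p (suc k)) (coeff (u *ₚ p) k))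
      (ℕₚ.+-mono-≤ (subst (ℕ._≤ X ℕ.* H) (sym (abs-* a (coeff p (suc k)))) (ℕₚ.*-mono-≤ (hu 0) (hp (suc k))))
        (∣coeff-*ₚ∣≤ u p (λ i → hu (suc i)) hp k)))

  ∣coeff-tabulate∣≤ : ∀ {n X} (u : Fin n → ℤ) → (∀ i → ∣ u i ∣ ℕ.≤ X) → ∀ k → ∣ coeff (tabulate u) k ∣ ℕ.≤ X
  ∣coeff-tabulate∣≤ {zero}  u h k       = z≤n
  ∣coeff-tabulate∣≤ {suc n} u h zero    = h zero
  ∣coeff-tabulate∣≤ {suc n} u h (suc k) = ∣coeff-tabulate∣≤ (λ i → u (suc i)) (λ i → h (suc i)) k

  Zero-tabulate : ∀ {n} (u : Fin n → ℤ) → Zero (tabulate u) → ∀ i → u i ≡ 0ℤ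
  Zero-tabulate u h zero    = h 0
  Zero-tabulate u h (suc i) = Zero-tabulate (λ i → u (suc i)) (λ k → h (suc k)) i

  record ConstantCombination (n d X : ℕ) (p q : Poly) : Set where
    field
      u v            : Poly
      constant       : ℤ
      u-length       : length u ≡ n
      v-length       : length v ≡ d
      u-bound        : ∀ i → ∣ coeff u i ∣ ℕ.≤ X
      v-bound        : ∀ i → ∣ coeff v i ∣ ℕ.≤ X
      nontrivial     : ¬ (Zero u × Zero v)
      combination    : (u *ₚ p) +ₚ (v *ₚ q) ≈ₚ constant ∷ []

  -- Replaces the expansion of the resultant: all the coefficients of u p + v q but the constant one are made to vanish.
  module _ (n′ d H X : ℕ) (p q : Poly) where
    private
      n = suc n′
      M = n ℕ.* (X ℕ.* H) ℕ.+ d ℕ.* (X ℕ.* H)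

      left right : (Fin (n ℕ.+ d) → ℤ) → Poly
      left  w = tabulate (λ i → w (i ↑ˡ d))
      right w = tabulate (λ i → w (n ↑ʳ i))

      length-left : ∀ w → length (left w) ≡ n
      length-left w = Listₚ.length-tabulate (λ i → w (i ↑ˡ d))

      length-right : ∀ w → length (right w) ≡ d
      length-right w = Listₚ.length-tabulate (λ i → w (n ↑ʳ i))

      left-bound : ∀ w → (∀ i → ∣ w i ∣ ℕ.≤ X) → ∀ k → ∣ coeff (left w) k ∣ ℕ.≤ X
      left-bound w h = ∣coeff-tabulate∣≤ (λ i → w (i ↑ˡ d)) (λ i → h (i ↑ˡ d))

      right-bound : ∀ w → (∀ i → ∣ w i ∣ ℕ.≤ X) → ∀ k → ∣ coeff (right w) k ∣ ℕ.≤ X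
      right-bound w h = ∣coeff-tabulate∣≤ (λ i → w (n ↑ʳ i)) (λ i → h (n ↑ʳ i))

      φ : (Fin (n ℕ.+ d) → ℤ) → ℕ → ℤ
      -- The index is shifted by one, which leaves the constant coefficient free. The lengths `n`
      -- and `d` are those of the Sylvester matrix; there is one equation fewer than unknowns.
      φ w k = coeff (left w *ₚ p) (suc k) + coeff (right w *ₚ q) (suc k)

      φ-- : ∀ w w′ k → φ (λ i → w i - w′ i) k ≡ φ w k - φ w′ k
      φ-- w w′ k = trans
        (cong₂ _+_ (tabulate-*ₚ-- (λ i → w (i ↑ˡ d)) (λ i → w′ (i ↑ˡ d)) p (suc k)) (tabulate-*ₚ-- (λ i → w (n ↑ʳ i)) (λ i → w′ (n ↑ʳ i)) q (suc k)))
        (solve 4 (λ a b x y → (a :- b) :+ (x :- y) := (a :+ x) :- (b :+ y)) refl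
          (coeff (left w *ₚ p) (suc k)) (coeff (left w′ *ₚ p) (suc k)) (coeff (right w *ₚ q) (suc k)) (coeff (right w′ *ₚ q) (suc k)))

      zero-join : ∀ w → Zero (left w) → Zero (right w) → ∀ s → w (Fin.join n d s) ≡ 0ℤ
      zero-join w zu zv (inj₁ i) = Zero-tabulate (λ i → w (i ↑ˡ d)) zu i
      zero-join w zu zv (inj₂ i) = Zero-tabulate (λ i → w (n ↑ʳ i)) zv i

    module _ (p-deg : DegLT p (suc d)) (q-deg : DegLT q (suc n))
             (hp : ∀ i → ∣ coeff p i ∣ ℕ.≤ H) (hq : ∀ i → ∣ coeff q i ∣ ℕ.≤ H) where
      private
        φ-bound : ∀ w → (∀ i → ∣ w i ∣ ℕ.≤ X) → ∀ k → ∣ φ w k ∣ ℕ.≤ M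
        φ-bound w h k = ℕₚ.≤-trans (∣i+j∣≤∣i∣+∣j∣ (coeff (left w *ₚ p) (suc k)) (coeff (right w *ₚ q) (suc k)))
          (ℕₚ.+-mono-≤
            (subst (λ l → ∣ coeff (left w *ₚ p) (suc k) ∣ ℕ.≤ l ℕ.* (X ℕ.* H)) (length-left w)
              (∣coeff-*ₚ∣≤ (left w) p (left-bound w h) hp (suc k)))
            (subst (λ l → ∣ coeff (right w *ₚ q) (suc k) ∣ ℕ.≤ l ℕ.* (X ℕ.* H)) (length-right w)
              (∣coeff-*ₚ∣≤ (right w) q (right-bound w h) hq (suc k))))

        combine-solution : ∀ w → ¬ (∀ i → w i ≡ 0ℤ) → (∀ i → ∣ w i ∣ ℕ.≤ X) → (∀ k → k ℕ.< n′ ℕ.+ d → φ w k ≡ 0ℤ) →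
          ConstantCombination n d X p q
        combine-solution w w≢0 w≤ φw≡0 = record
          { u = left w ; v = right w ; constant = coeff (left w *ₚ p +ₚ right w *ₚ q) 0
          ; u-length = length-left w ; v-length = length-right w
          ; u-bound = left-bound w w≤ ; v-bound = right-bound w w≤
          ; nontrivial = λ (zu , zv) → w≢0 (λ i → subst (λ i → w i ≡ 0ℤ) (Finₚ.join-splitAt n d i) (zero-join w zu zv (splitAt n i)))
          ; combination = λ { zero → refl ; (suc k) → trans (coeff-+ₚ (left w *ₚ p) (right w *ₚ q) (suc k)) (vanish k) } }
          where
          vanish : ∀ k → φ w k ≡ 0ℤ
          vanish k with k ℕₚ.<? n′ ℕ.+ d
          ... | yes k< = φw≡0 k k<
          -- Both products have degree below `n + d`, so these coefficients vanish without being
          -- imposed.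
          ... | no k≮ = cong₂ _+_
            (DegLT-*ₚ (left w) p p-deg (suc k) (subst (λ l → l ℕ.+ d ℕ.≤ suc k) (sym (length-left w)) (s≤s (ℕₚ.≮⇒≥ k≮))))
            (DegLT-*ₚ (right w) q q-deg (suc k) (subst (λ l → l ℕ.+ n ℕ.≤ suc k) (sym (length-right w))
              (subst (ℕ._≤ suc k) (ℕₚ.+-comm n d) (s≤s (ℕₚ.≮⇒≥ k≮)))))

      constantCombination : suc (M ℕ.+ M) ^ (n′ ℕ.+ d) ℕ.< suc X ^ (n ℕ.+ d) → ConstantCombination n d X p q
      constantCombination many = let (w , w≢0 , w≤ , φw≡0) = siegel in combine-solution w w≢0 w≤ φw≡0
        where open Siegel (n ℕ.+ d) (n′ ℕ.+ d) X M φ φ-- φ-bound many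

-- The size of the box in Siegel's lemma

module SiegelCounting where
  open import Data.Nat.Base
  open import Data.Nat.Properties
  open ℕ-Solver using (solve; _:=_; _:+_; _:*_; con)
  open ≤-Reasoning

  ^-distribʳ-* : ∀ k a b → (a * b) ^ k ≡ a ^ k * b ^ k
  ^-distribʳ-* zero    a b = refl
  ^-distribʳ-* (suc k) a b = trans (cong (a * b *_) (^-distribʳ-* k a b)) ([m*n]*[o*p]≡[m*o]*[n*p] a b (a ^ k) (b ^ k))

  -- The one surplus unknown yields one surplus factor `suc X`, which has to beat `c ^ r`; hence the
  -- choice of `X` as a power of `c`. Allowing `s ≥ r` lets one `X` serve all degrees `d`.
  boxes<points : ∀ c X r s B → 1 ≤ c → B ≤ c * suc X → r ≤ s → X ≡ c ^ s → B ^ r < suc X ^ suc r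
  boxes<points c X r s B 1≤c B≤ r≤s X≡ = begin-strict
    B ^ r                 ≤⟨ ^-monoˡ-≤ r B≤ ⟩
    (c * suc X) ^ r       ≡⟨ ^-distribʳ-* r c (suc X) ⟩
    c ^ r * suc X ^ r     ≤⟨ *-monoˡ-≤ (suc X ^ r) (^-monoʳ-≤ c {{>-nonZero 1≤c}} r≤s) ⟩
    c ^ s * suc X ^ r     ≡⟨ cong (_* suc X ^ r) (sym X≡) ⟩
    X * suc X ^ r         <⟨ *-monoˡ-< (suc X ^ r) {{m^n≢0 (suc X) r}} (n<1+n X) ⟩
    suc X ^ suc r         ∎

  -- By `d ≤ n` the values are at most `2nXH` in absolute value, so their range has at most
  -- `4nHX + 1` elements; the 1 is absorbed in `suc X`.
  boxes≤ : ∀ n d H X → d ≤ n → 1 ≤ n → 1 ≤ H →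
    suc ((n * (X * H) + d * (X * H)) + (n * (X * H) + d * (X * H))) ≤ 4 * (n * H) * suc X
  boxes≤ n d H X d≤n 1≤n 1≤H = begin
    suc ((Y + d * (X * H)) + (Y + d * (X * H)))  ≤⟨ s≤s (+-mono-≤ M≤ M≤) ⟩
    suc ((Y + Y) + (Y + Y))         ≡⟨ cong suc (solve 3 (λ n X H → (n :* (X :* H) :+ n :* (X :* H)) :+ (n :* (X :* H) :+ n :* (X :* H)) := con 4 :* (n :* H) :* X) refl n X H) ⟩
    suc (4 * (n * H) * X)           ≤⟨ +-monoˡ-≤ (4 * (n * H) * X) {1} (*-mono-≤ {1} {4} (s≤s z≤n) (*-mono-≤ 1≤n 1≤H)) ⟩
    4 * (n * H) + 4 * (n * H) * X   ≡⟨ sym (*-suc (4 * (n * H)) X) ⟩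
    4 * (n * H) * suc X             ∎
    where
    Y = n * (X * H)
    M≤ : Y + d * (X * H) ≤ Y + Y
    M≤ = +-monoʳ-≤ Y (*-monoˡ-≤ (X * H) d≤n)

-- Evaluation of integer polynomials at rational numbers

module AlgebraicNumbers where
  open import Data.Rational.Base hiding (_≃_)
  open import Data.Rational.Properties
  open ℚ-Solver using (solve; _:=_; _:+_; _:*_; :-_; _:-_; con)
  open import Defs using (module RationalLemmas; module Limits; Poly; coeff; degree; height; _≈ₚ_; _+ₚ_; _*ₚ_; eval; ℤ[X];
    IsAlgebraic[degree≤_,height≤_]; IsMinimalPolynomial; ℝ; seq; cauchy; _≃_; mk≃; 0ℝ)
  open import Algebra.Definitions.RawMagma using (_,_)
  open import Algebra.Definitions.RawSemiring ℤ[X] using (Irreducible) renaming (_∣_ to _∣ₚ_)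
  open RationalLemmas
  open Limits
  open IntegerPolynomials
  open SiegelCounting

  ιℤ : ℤ → ℚ
  ιℤ i = i / 1

  ιℤ-toℚᵘ : ∀ i → toℚᵘ (ιℤ i) ℚᵘ.≃ ℚᵘ.mkℚᵘ i 0
  ιℤ-toℚᵘ i = toℚᵘ-fromℚᵘ (ℚᵘ.mkℚᵘ i 0)

  ιℤ-+ : ∀ i j → ιℤ (i ℤ.+ j) ≡ ιℤ i + ιℤ j
  ιℤ-+ i j = toℚᵘ-injective (begin
    toℚᵘ (ιℤ (i ℤ.+ j))                   ≈⟨ ιℤ-toℚᵘ (i ℤ.+ j) ⟩
    ℚᵘ.mkℚᵘ (i ℤ.+ j) 0                   ≈⟨ ℚᵘ.*≡* (cong (ℤ._* 1ℤ) (sym (cong₂ ℤ._+_ (ℤₚ.*-identityʳ i) (ℤₚ.*-identityʳ j)))) ⟩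
    ℚᵘ.mkℚᵘ i 0 ℚᵘ.+ ℚᵘ.mkℚᵘ j 0          ≈⟨ ℚᵘₚ.+-cong (ℚᵘₚ.≃-sym (ιℤ-toℚᵘ i)) (ℚᵘₚ.≃-sym (ιℤ-toℚᵘ j)) ⟩
    toℚᵘ (ιℤ i) ℚᵘ.+ toℚᵘ (ιℤ j)          ≈⟨ ℚᵘₚ.≃-sym (toℚᵘ-homo-+ (ιℤ i) (ιℤ j)) ⟩
    toℚᵘ (ιℤ i + ιℤ j)                    ∎)
    where open import Relation.Binary.Reasoning.Setoid ℚᵘₚ.≃-setoid

  ιℤ-* : ∀ i j → ιℤ (i ℤ.* j) ≡ ιℤ i * ιℤ j
  ιℤ-* i j = toℚᵘ-injective (begin
    toℚᵘ (ιℤ (i ℤ.* j))                   ≈⟨ ιℤ-toℚᵘ (i ℤ.* j) ⟩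
    ℚᵘ.mkℚᵘ i 0 ℚᵘ.* ℚᵘ.mkℚᵘ j 0          ≈⟨ ℚᵘₚ.*-cong (ℚᵘₚ.≃-sym (ιℤ-toℚᵘ i)) (ℚᵘₚ.≃-sym (ιℤ-toℚᵘ j)) ⟩
    toℚᵘ (ιℤ i) ℚᵘ.* toℚᵘ (ιℤ j)          ≈⟨ ℚᵘₚ.≃-sym (toℚᵘ-homo-* (ιℤ i) (ιℤ j)) ⟩
    toℚᵘ (ιℤ i * ιℤ j)                    ∎)
    where open import Relation.Binary.Reasoning.Setoid ℚᵘₚ.≃-setoid

  ∣ιℤ∣ : ∀ i → ∣ ιℤ i ∣ ≡ ι ℤ.∣ i ∣
  ∣ιℤ∣ i = toℚᵘ-injective (begin
    toℚᵘ ∣ ιℤ i ∣           ≈⟨ toℚᵘ-homo-∣-∣ (ιℤ i) ⟩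
    ℚᵘ.∣ toℚᵘ (ιℤ i) ∣      ≈⟨ ℚᵘₚ.∣-∣-cong (ιℤ-toℚᵘ i) ⟩
    ℚᵘ.∣ ℚᵘ.mkℚᵘ i 0 ∣      ≈⟨ ℚᵘₚ.≃-sym (ιℤ-toℚᵘ (ℤ.+ ℤ.∣ i ∣)) ⟩
    toℚᵘ (ι ℤ.∣ i ∣)        ∎)
    where open import Relation.Binary.Reasoning.Setoid ℚᵘₚ.≃-setoid

  ι-* : ∀ m n → ι (m ℕ.* n) ≡ ι m * ι n
  ι-* m n = trans (cong ιℤ (ℤₚ.pos-* m n)) (ιℤ-* (ℤ.+ m) (ℤ.+ n))

  1≤∣ιℤ∣ : ∀ i → i ≢ 0ℤ → 1ℚ ≤ ∣ ιℤ i ∣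
  1≤∣ιℤ∣ i i≢0 = subst (1ℚ ≤_) (sym (∣ιℤ∣ i)) (1≤ι ℤ.∣ i ∣ (λ e → i≢0 (ℤₚ.∣i∣≡0⇒i≡0 e)))
    where
    1≤ι : ∀ n → n ≢ 0 → 1ℚ ≤ ι n
    1≤ι zero    n≢0 = contradiction refl n≢0
    1≤ι (suc n) _   = 1≤ι-suc n

  evalℚ : Poly → ℚ → ℚ
  evalℚ p a = foldr (λ c r → ιℤ c + a * r) 0ℚ p

  seq-eval : ∀ p x k → seq (eval p x) k ≡ evalℚ p (seq x k)
  seq-eval []      x k = refl
  seq-eval (c ∷ p) x k = cong (λ z → ιℤ c + seq x k * z) (seq-eval p x k)

  evalℚ-+ₚ : ∀ p q a → evalℚ (p +ₚ q) a ≡ evalℚ p a + evalℚ q a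
  evalℚ-+ₚ []      q       a = sym (+-identityˡ _)
  evalℚ-+ₚ (c ∷ p) []      a = sym (+-identityʳ _)
  evalℚ-+ₚ (c ∷ p) (d ∷ q) a = trans (cong₂ (λ x y → x + a * y) (ιℤ-+ c d) (evalℚ-+ₚ p q a))
    (solve 5 (λ c d a u v → (c :+ d) :+ a :* (u :+ v) := (c :+ a :* u) :+ (d :+ a :* v)) refl (ιℤ c) (ιℤ d) a (evalℚ p a) (evalℚ q a))

  evalℚ-scale : ∀ c p a → evalℚ (scale c p) a ≡ ιℤ c * evalℚ p a
  evalℚ-scale c []      a = sym (*-zeroʳ (ιℤ c))
  evalℚ-scale c (d ∷ p) a = trans (cong₂ (λ x y → x + a * y) (ιℤ-* c d) (evalℚ-scale c p a))
    (solve 4 (λ c d a u → c :* d :+ a :* (c :* u) := c :* (d :+ a :* u)) refl (ιℤ c) (ιℤ d) a (evalℚ p a))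

  evalℚ-0∷ : ∀ p a → evalℚ (0ℤ ∷ p) a ≡ a * evalℚ p a
  evalℚ-0∷ p a = +-identityˡ (a * evalℚ p a)

  evalℚ-*ₚ : ∀ p q a → evalℚ (p *ₚ q) a ≡ evalℚ p a * evalℚ q a
  evalℚ-*ₚ []      q a = sym (*-zeroˡ (evalℚ q a))
  evalℚ-*ₚ (c ∷ p) q a = begin
    evalℚ (scale c q +ₚ (0ℤ ∷ (p *ₚ q))) a
      ≡⟨ trans (evalℚ-+ₚ (scale c q) (0ℤ ∷ (p *ₚ q)) a) (cong₂ _+_ (evalℚ-scale c q a) (evalℚ-0∷ (p *ₚ q) a)) ⟩
    ιℤ c * Q + a * evalℚ (p *ₚ q) a
      ≡⟨ cong (λ z → ιℤ c * Q + a * z) (evalℚ-*ₚ p q a) ⟩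
    ιℤ c * Q + a * (evalℚ p a * Q)
      ≡⟨ solve 4 (λ c q a p → c :* q :+ a :* (p :* q) := (c :+ a :* p) :* q) refl (ιℤ c) Q a (evalℚ p a) ⟩
    (ιℤ c + a * evalℚ p a) * Q ∎
    where
    open ≡-Reasoning
    Q = evalℚ q a

  evalℚ-Zero : ∀ p a → Zero p → evalℚ p a ≡ 0ℚ
  evalℚ-Zero []      a h = refl
  evalℚ-Zero (c ∷ p) a h = trans (cong₂ (λ c z → ιℤ c + a * z) (h 0) (evalℚ-Zero p a (λ k → h (suc k))))
    (trans (+-identityˡ _) (*-zeroʳ a))

  evalℚ-cong : ∀ p q a → p ≈ₚ q → evalℚ p a ≡ evalℚ q a
  evalℚ-cong []      q       a h = sym (evalℚ-Zero q a (λ k → sym (h k)))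
  evalℚ-cong (c ∷ p) []      a h = evalℚ-Zero (c ∷ p) a h
  evalℚ-cong (c ∷ p) (d ∷ q) a h = cong₂ (λ c z → ιℤ c + a * z) (h 0) (evalℚ-cong p q a (λ k → h (suc k)))

  evalℚ-derivative : ∀ c p a → evalℚ (derivative (c ∷ p)) a ≡ evalℚ p a + a * evalℚ (derivative p) a
  evalℚ-derivative c p a = trans (evalℚ-+ₚ p (0ℤ ∷ derivative p) a) (cong (evalℚ p a +_) (evalℚ-0∷ (derivative p) a))

  Bounded : ℚ → Poly → Set
  Bounded h p = ∀ i → ∣ ιℤ (coeff p i) ∣ ≤ h

  module _ (b : ℚ) where
    -- The sum `1 + b + … + b^(l−1)`, its derivative in `b`, and half its second derivative. For
    -- coefficients at most 1 on `[−b,b]` they bound the value, the Lipschitz constant and the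
    -- quadratic Taylor coefficient.
    sizeBound slopeBound curvatureBound : ℕ → ℚ
    sizeBound zero    = 0ℚ
    sizeBound (suc l) = 1ℚ + b * sizeBound l
    slopeBound zero    = 0ℚ
    slopeBound (suc l) = sizeBound l + b * slopeBound l
    curvatureBound zero    = 0ℚ
    curvatureBound (suc l) = slopeBound l + b * curvatureBound l

  module Bounds {b h : ℚ} (0≤b : 0ℚ ≤ b) (0≤h : 0ℚ ≤ h) where
    private
      β = sizeBound b
      σ = slopeBound b
      κ = curvatureBound b

    0≤β : ∀ l → 0ℚ ≤ β l
    0≤β zero    = ≤-refl
    0≤β (suc l) = +-mono-≤ 0≤1 (*-nonNeg 0≤b (0≤β l))

    0≤σ : ∀ l → 0ℚ ≤ σ l
    0≤σ zero    = ≤-refl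
    0≤σ (suc l) = +-mono-≤ (0≤β l) (*-nonNeg 0≤b (0≤σ l))

    0≤κ : ∀ l → 0ℚ ≤ κ l
    0≤κ zero    = ≤-refl
    0≤κ (suc l) = +-mono-≤ (0≤σ l) (*-nonNeg 0≤b (0≤κ l))

    horner-≤ : ∀ {x a y Y Z} → ∣ a ∣ ≤ b → ∣ x ∣ ≤ Y → ∣ y ∣ ≤ Z → ∣ x + a * y ∣ ≤ Y + b * Z
    horner-≤ {x} {a} {y} ha hx hy = ≤-trans (∣p+q∣≤∣p∣+∣q∣ x (a * y)) (+-mono-≤ hx
      (subst (_≤ b * _) (sym (∣p*q∣≡∣p∣*∣q∣ a y)) (*-mono (0≤∣p∣ a) (≤-trans (0≤∣p∣ y) hy) ha hy)))

    ∣evalℚ∣≤ : ∀ p {a} → ∣ a ∣ ≤ b → Bounded h p → ∣ evalℚ p a ∣ ≤ h * β (length p)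
    ∣evalℚ∣≤ []      ha hp = ≤-reflexive (sym (*-zeroʳ h))
    ∣evalℚ∣≤ (c ∷ p) ha hp = ≤-trans (horner-≤ ha (hp 0) (∣evalℚ∣≤ p ha (λ i → hp (suc i))))
      (≤-reflexive (solve 3 (λ h b s → h :+ b :* (h :* s) := h :* (con 1ℚ :+ b :* s)) refl h b (β (length p))))

    evalℚ-lipschitz : ∀ p {a a′} → ∣ a ∣ ≤ b → ∣ a′ ∣ ≤ b → Bounded h p →
      dist (evalℚ p a) (evalℚ p a′) ≤ h * σ (length p) * dist a a′
    evalℚ-lipschitz []      {a} {a′} ha ha′ hp =
      ≤-reflexive (sym (trans (cong (_* dist a a′) (*-zeroʳ h)) (*-zeroˡ (dist a a′))))
    evalℚ-lipschitz (c ∷ p) {a} {a′} ha ha′ hp = begin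
      ∣ (ιℤ c + a * P) - (ιℤ c + a′ * P′) ∣
        ≡⟨ cong ∣_∣ (solve 5 (λ c a a′ P P′ → (c :+ a :* P) :- (c :+ a′ :* P′) := P :* (a :- a′) :+ a′ :* (P :- P′)) refl (ιℤ c) a a′ P P′) ⟩
      ∣ P * (a - a′) + a′ * (P - P′) ∣
        ≤⟨ horner-≤ ha′ (≤-trans (≤-reflexive (∣p*q∣≡∣p∣*∣q∣ P (a - a′))) (*-monoʳ (0≤∣p∣ (a - a′)) (∣evalℚ∣≤ p ha hp⁺)))
             (evalℚ-lipschitz p ha ha′ hp⁺) ⟩
      h * β l * D + b * (h * σ l * D)
        ≡⟨ solve 5 (λ h x d b y → h :* x :* d :+ b :* (h :* y :* d) := h :* (x :+ b :* y) :* d) refl h (β l) D b (σ l) ⟩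
      h * σ (suc l) * D ∎
      where
      open ≤-Reasoning
      P = evalℚ p a
      P′ = evalℚ p a′
      D = dist a a′
      l = length p
      hp⁺ : Bounded h p
      hp⁺ i = hp (suc i)

    ∣derivative∣≤ : ∀ p {a} → ∣ a ∣ ≤ b → Bounded h p → ∣ evalℚ (derivative p) a ∣ ≤ h * σ (length p)
    ∣derivative∣≤ []      ha hp = ≤-reflexive (sym (*-zeroʳ h))
    ∣derivative∣≤ (c ∷ p) {a} ha hp = ≤-trans (≤-reflexive (cong ∣_∣ (evalℚ-derivative c p a)))
      (≤-trans (horner-≤ ha (∣evalℚ∣≤ p ha (λ i → hp (suc i))) (∣derivative∣≤ p ha (λ i → hp (suc i))))
      (≤-reflexive (solve 4 (λ h x b y → h :* x :+ b :* (h :* y) := h :* (x :+ b :* y)) refl h (β (length p)) b (σ (length p)))))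

    evalℚ-taylor : ∀ p {a a′} → ∣ a ∣ ≤ b → ∣ a′ ∣ ≤ b → Bounded h p →
      ∣ (evalℚ p a′ - evalℚ p a) - (a′ - a) * evalℚ (derivative p) a ∣ ≤ h * κ (length p) * (dist a′ a * dist a′ a)
    evalℚ-taylor []      {a} {a′} ha ha′ hp = ≤-reflexive (trans
      (cong ∣_∣ (solve 1 (λ d → con 0ℚ :- d :* con 0ℚ := con 0ℚ) refl (a′ - a)))
      (sym (trans (cong (_* (dist a′ a * dist a′ a)) (*-zeroʳ h)) (*-zeroˡ (dist a′ a * dist a′ a)))))
    evalℚ-taylor (c ∷ p) {a} {a′} ha ha′ hp = begin
      ∣ ((ιℤ c + a′ * P′) - (ιℤ c + a * P)) - (a′ - a) * evalℚ (derivative (c ∷ p)) a ∣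
        ≡⟨ cong (λ z → ∣ ((ιℤ c + a′ * P′) - (ιℤ c + a * P)) - (a′ - a) * z ∣) (evalℚ-derivative c p a) ⟩
      ∣ ((ιℤ c + a′ * P′) - (ιℤ c + a * P)) - (a′ - a) * (P + a * d) ∣
        ≡⟨ cong ∣_∣ (solve 6 (λ c a a′ P P′ d → ((c :+ a′ :* P′) :- (c :+ a :* P)) :- (a′ :- a) :* (P :+ a :* d) :=
             d :* ((a′ :- a) :* (a′ :- a)) :+ a′ :* ((P′ :- P) :- (a′ :- a) :* d)) refl (ιℤ c) a a′ P P′ d) ⟩
      ∣ d * ((a′ - a) * (a′ - a)) + a′ * ((P′ - P) - (a′ - a) * d) ∣
        ≤⟨ horner-≤ ha′ (≤-trans (≤-reflexive (trans (∣p*q∣≡∣p∣*∣q∣ d ((a′ - a) * (a′ - a))) (cong (∣ d ∣ *_) (∣p*q∣≡∣p∣*∣q∣ (a′ - a) (a′ - a)))))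
             (*-monoʳ (*-nonNeg (0≤∣p∣ (a′ - a)) (0≤∣p∣ (a′ - a))) (∣derivative∣≤ p ha hp⁺))) (evalℚ-taylor p ha ha′ hp⁺) ⟩
      h * σ l * D + b * (h * κ l * D)
        ≡⟨ solve 5 (λ h x d b y → h :* x :* d :+ b :* (h :* y :* d) := h :* (x :+ b :* y) :* d) refl h (σ l) D b (κ l) ⟩
      h * κ (suc l) * D ∎
      where
      open ≤-Reasoning
      P = evalℚ p a
      P′ = evalℚ p a′
      d = evalℚ (derivative p) a
      D = dist a′ a * dist a′ a
      l = length p
      hp⁺ : Bounded h p
      hp⁺ i = hp (suc i)

  -- Null sequences and sequences bounded away from zero

  Tends0 : (ℕ → ℚ) → Set
  Tends0 z = Null (λ k → ∣ z k ∣)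

  Tends0-cong : ∀ {x y} → (∀ k → x k ≡ y k) → Tends0 x → Tends0 y
  Tends0-cong e h ε 0<ε = let (N , b) = h ε 0<ε in N , λ k p → subst (λ z → ∣ z ∣ < ε) (e k) (b k p)

  Tends0-+ : ∀ {x y} → Tends0 x → Tends0 y → Tends0 (λ k → x k + y k)
  Tends0-+ {x} {y} hx hy ε 0<ε with hx (ε * ½) (half-pos 0<ε) | hy (ε * ½) (half-pos 0<ε)
  ... | N , b | N′ , b′ = N ℕ.⊔ N′ , λ k p → ≤-<-trans (∣p+q∣≤∣p∣+∣q∣ (x k) (y k)) (subst (_ <_) (half+half ε)
    (+-mono-< (b k (ℕₚ.m⊔n≤o⇒m≤o N N′ p)) (b′ k (ℕₚ.m⊔n≤o⇒n≤o N N′ p))))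

  Tends0-* : ∀ {x y} → EventuallyBounded y → Tends0 x → Tends0 (λ k → y k * x k)
  Tends0-* {x} {y} (B , 0<B , N , hy) hx ε 0<ε with diagonal (small-* 0<B (small₁ hx)) ε 0<ε
  ... | N′ , b = N ℕ.⊔ N′ , λ k p → ≤-<-trans
    (≤-trans (≤-reflexive (∣p*q∣≡∣p∣*∣q∣ (y k) (x k))) (*-monoʳ (0≤∣p∣ (x k)) (hy k (ℕₚ.m⊔n≤o⇒m≤o N N′ p))))
    (b k (ℕₚ.m⊔n≤o⇒n≤o N N′ p))

  Tends0-const : ∀ {c} → Tends0 (λ _ → c) → ¬ (0ℚ < ∣ c ∣)
  Tends0-const {c} h 0<c = let (N , b) = h ∣ c ∣ 0<c in <-irrefl refl (b N ℕₚ.≤-refl)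

  constᵇ : ∀ c → EventuallyBounded (λ _ → c)
  constᵇ c = ∣ c ∣ + 1ℚ , +-mono-≤-< (0≤∣p∣ c) 0<1 , 0 , λ _ _ → subst (_≤ ∣ c ∣ + 1ℚ) (+-identityʳ _) (+-monoʳ-≤ ∣ c ∣ 0≤1)

  1≤⇒0< : ∀ {p} → 1ℚ ≤ p → 0ℚ < p
  1≤⇒0< = <-≤-trans 0<1

  Tends0-ιℤ* : ∀ {x} m → m ≢ 0ℤ → Tends0 (λ k → ιℤ m * x k) → Tends0 x
  Tends0-ιℤ* {x} m m≢0 h ε 0<ε = let (N , b) = h ε 0<ε in N , λ k p → ≤-<-trans
    (≤-trans (subst (_≤ ∣ ιℤ m ∣ * ∣ x k ∣) (*-identityˡ ∣ x k ∣) (*-monoʳ (0≤∣p∣ (x k)) (1≤∣ιℤ∣ m m≢0)))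
      (≤-reflexive (sym (∣p*q∣≡∣p∣*∣q∣ (ιℤ m) (x k))))) (b k p)

  Apart0 : (ℕ → ℚ) → Set
  Apart0 z = ∃[ ε ] 0ℚ < ε × ∃[ N ] (∀ k → N ℕ.≤ k → ε ≤ ∣ z k ∣)

  ∣p∣≤∣q∣+dist : ∀ p q → ∣ p ∣ ≤ ∣ q ∣ + dist p q
  ∣p∣≤∣q∣+dist p q = subst (λ z → ∣ z ∣ ≤ ∣ q ∣ + dist p q) (solve 2 (λ p q → q :+ (p :- q) := p) refl p q) (∣p+q∣≤∣p∣+∣q∣ q (p - q))

  -- Once the terms vary by less than `ε/4`, comparing the single rational `∣ z N ∣` with `ε/2`
  -- decides: either all later terms are below `ε`, or all are at least `ε/4`, which is excluded.
  ¬Apart0⇒Tends0 : ∀ {z} → Cauchy z → ¬ Apart0 z → Tends0 z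
  ¬Apart0⇒Tends0 {z} cz ¬apart ε 0<ε with cz (ε * ½ * ½) (half-pos (half-pos 0<ε))
  ... | N , c with ∣ z N ∣ <? ε * ½
  ... | yes small = N , λ k p → ≤-<-trans (∣p∣≤∣q∣+dist (z k) (z N)) (subst (_ <_) (half+half ε)
    (+-mono-< small (<-trans (c k N p ℕₚ.≤-refl) (subst (ε * ½ * ½ <_) (half+half (ε * ½))
      (subst (_< ε * ½ * ½ + ε * ½ * ½) (+-identityʳ (ε * ½ * ½)) (+-monoʳ-< (ε * ½ * ½) (half-pos (half-pos 0<ε))))))))
  ... | no large = contradiction
    (ε * ½ * ½ , half-pos (half-pos 0<ε) , N , λ k p → ≤-trans
      (≤-reflexive (trans (solve 1 (λ q → q := (q :+ q) :- q) refl (ε * ½ * ½)) (cong (_- ε * ½ * ½) (half+half (ε * ½)))))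
      (sub≤ (≤-trans (≮⇒≥ large) (≤-trans (∣p∣≤∣q∣+dist (z N) (z k))
        (≤-trans (+-monoʳ-≤ ∣ z k ∣ (<⇒≤ (c N k ℕₚ.≤-refl p))) (≤-reflexive (+-comm ∣ z k ∣ (ε * ½ * ½))))))))
    ¬apart

  -- The reals have no zero divisors: if both factors were eventually at least `ε` and `δ` in
  -- absolute value, the product would be at least `ε * δ`.
  Tends0-*⁻ : ∀ {x y} → Cauchy x → Cauchy y → Tends0 (λ k → x k * y k) → ¬ Tends0 y → ¬ ¬ Tends0 x
  Tends0-*⁻ {x} {y} cx cy xy→0 y↛0 x↛0 = y↛0 (¬Apart0⇒Tends0 cy λ (δ , 0<δ , N′ , hy) → x↛0 (¬Apart0⇒Tends0 cx λ (ε , 0<ε , N , hx) →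
    let (N″ , h) = xy→0 (ε * δ) (*-pos 0<ε 0<δ)
        k = N ℕ.⊔ (N′ ℕ.⊔ N″)
    in <-irrefl refl (<-≤-trans (h k (ℕₚ.m≤n⇒m≤o⊔n N (ℕₚ.m≤n⊔m N′ N″))) (≤-trans
         (*-mono (<⇒≤ 0<ε) (0≤∣p∣ (y k)) (hx k (ℕₚ.m≤m⊔n N _)) (hy k (ℕₚ.m≤n⇒m≤o⊔n N (ℕₚ.m≤m⊔n N′ N″))))
         (≤-reflexive (sym (∣p*q∣≡∣p∣*∣q∣ (x k) (y k))))))))

  height-Bounded : ∀ p {H} → (∀ i → ℤ.∣ coeff p i ∣ ℕ.≤ H) → Bounded (ι H) p
  height-Bounded p h i = subst (_≤ _) (sym (∣ιℤ∣ (coeff p i))) (ι-mono (h i))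

  _at_ : Poly → ℝ → ℕ → ℚ
  (p at α) k = evalℚ p (seq α k)

  at-cauchy : ∀ p α → Cauchy (p at α)
  at-cauchy p α = subst-cauchy (cauchy (eval p α))
    where
    subst-cauchy : Cauchy (seq (eval p α)) → Cauchy (p at α)
    subst-cauchy c ε 0<ε = let (N , h) = c ε 0<ε in
      N , λ m n q r → subst₂ (λ x y → ∣ x - y ∣ < ε) (seq-eval p α m) (seq-eval p α n) (h m n q r)

  at-bounded : ∀ p α → EventuallyBounded (p at α)
  at-bounded p α = bounded (p at α) (at-cauchy p α)

  -- Minimality of the degree of the minimal polynomial

  Splits : Poly → Set
  Splits p = ∀ {x y} → p ≈ₚ x *ₚ y → x ∣ₚ (1ℤ ∷ []) ⊎ y ∣ₚ (1ℤ ∷ [])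

  ¬Zero-factor : ∀ p q {k} → coeff (p *ₚ q) k ≢ 0ℤ → ¬ Zero p
  ¬Zero-factor p q {k} ≢0 z = ≢0 (coeff-*ₚ-null p q (λ i _ → z i) k)

  leading≢0 : ∀ p → ¬ Zero p → coeff p (degree p) ≢ 0ℤ
  leading≢0 p p≢0 e = p≢0 (lead≡0⇒Zero p e)

  coeff-*ₚ-const : ∀ p q → DegLT p 1 → ∀ k → coeff (p *ₚ q) k ≡ coeff p 0 ℤ.* coeff q k
  coeff-*ₚ-const []      q h k = refl
  coeff-*ₚ-const (a ∷ p) q h zero = coeff-*ₚ-zero a p q
  coeff-*ₚ-const (a ∷ p) q h (suc k) = trans (coeff-*ₚ-suc a p q k)
    (trans (cong (λ z → a ℤ.* coeff q (suc k) ℤ.+ z) (coeff-*ₚ-null p q (λ i _ → h (suc i) (s≤s z≤n)) k)) (ℤₚ.+-identityʳ _))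

  coeff-*ₚ-[] : ∀ p k → coeff (p *ₚ []) k ≡ 0ℤ
  coeff-*ₚ-[] []      k       = refl
  coeff-*ₚ-[] (a ∷ p) zero    = refl
  coeff-*ₚ-[] (a ∷ p) (suc k) = coeff-*ₚ-[] p k

  unit-degree : ∀ p → p ∣ₚ (1ℤ ∷ []) → degree p ≡ 0
  unit-degree p (z , z*p≈1) = exact (degree p) refl
    where
    ≢0 : coeff (z *ₚ p) 0 ≢ 0ℤ
    ≢0 e = contradiction (trans (sym (z*p≈1 0)) e) λ ()
    z≢0 : ¬ Zero z
    z≢0 = ¬Zero-factor z p ≢0
    p≢0 : ¬ Zero p
    p≢0 h = contradiction (trans (sym (z*p≈1 0)) (trans (*ₚ-congʳ z {p} {[]} h 0) (coeff-*ₚ-[] z 0))) λ ()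
    exact : ∀ d → degree p ≡ d → degree p ≡ 0
    exact zero    e = e
    exact (suc d) e = contradiction
      (trans (sym (coeff-*ₚ-top z p (degree z) (degree p) (degree-DegLT z) (degree-DegLT p)))
        (trans (z*p≈1 _) (trans (cong (λ d → coeff (1ℤ ∷ []) (degree z ℕ.+ d)) e) (cong (coeff (1ℤ ∷ [])) (ℕₚ.+-suc (degree z) d)))))
      (i*j≢0′ (leading≢0 z z≢0) (leading≢0 p p≢0))

  evalℚ-constant : ∀ c x → evalℚ (c ∷ []) x ≡ ιℤ c
  evalℚ-constant c x = trans (cong (ιℤ c +_) (*-zeroʳ x)) (+-identityʳ (ιℤ c))

  ¬unit-root : ∀ p α → Tends0 (p at α) → ¬ (p ∣ₚ (1ℤ ∷ []))
  ¬unit-root p α p→0 (z , z*p≈1) = Tends0-const {1ℚ}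
    (Tends0-cong (λ k → trans (sym (evalℚ-*ₚ z p (seq α k))) (trans (evalℚ-cong (z *ₚ p) (1ℤ ∷ []) (seq α k) z*p≈1) (evalℚ-constant 1ℤ (seq α k))))
      (Tends0-* (at-bounded z α) p→0))
    0<1

  ¬constant-root : ∀ p α → DegLT p 1 → coeff p 0 ≢ 0ℤ → ¬ Tends0 (p at α)
  ¬constant-root p α p-deg p₀≢0 p→0 = Tends0-const (Tends0-cong (λ k → trans (evalℚ-cong p (coeff p 0 ∷ []) (seq α k) constant)
      (evalℚ-constant (coeff p 0) (seq α k))) p→0)
    (1≤⇒0< (1≤∣ιℤ∣ (coeff p 0) p₀≢0))
    where
    constant : p ≈ₚ coeff p 0 ∷ []
    constant zero    = refl
    constant (suc i) = p-deg (suc i) (s≤s z≤n)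

  -- The list is brought to length `n + 1`, since the bounds on values depend on the length and have
  -- to be uniform in `α`. The true degree is kept in `deg`.
  record HasMinimalPolynomial (n N : ℕ) (α : ℝ) : Set where
    field
      poly       : Poly
      deg        : ℕ
      deg-bound  : DegLT poly (suc deg)
      leading    : coeff poly deg ≢ 0ℤ
      deg≤n      : deg ℕ.≤ n
      bound      : ∀ i → ℤ.∣ coeff poly i ∣ ℕ.≤ N
      len        : length poly ≡ suc n
      splits     : Splits poly
      vanishes   : Tends0 (poly at α)

  module Minimality {α p d} (p-deg : DegLT p (suc d)) (p-lead : coeff p d ≢ 0ℤ) (p-splits : Splits p) (p→0 : Tends0 (p at α)) where

    -- The remainder of `p` modulo a `q` of degree `v < d` vanishes at `α`, hence is zero by
    -- induction. Then `q` divides `p` up to constants, and Gauss's lemma gives a factorisation of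
    -- `p` over the integers. A unit cofactor would make coefficient `d` of `p` vanish, and the
    -- other factor has the root `α`, so it is no unit.
    no-smaller : ∀ v q → v ℕ.≤ d → DegLT q v → Tends0 (q at α) → Zero q
    no-smaller zero    q _   q-deg _   = λ k → q-deg k z≤n
    no-smaller (suc v) q v<d q-deg q→0 with coeff q v ℤₚ.≟ 0ℤ
    ... | yes q_v≡0 = no-smaller v q (ℕₚ.<⇒≤ v<d) lower q→0
      where
      lower : DegLT q v
      lower i v≤i with ℕₚ.m≤n⇒m<n∨m≡n v≤i
      ... | inj₁ v<i  = q-deg i v<i
      ... | inj₂ refl = q_v≡0
    ... | no q_v≢0 = contradiction (p-splits F.factorised) λ
        { (inj₁ unit) → ¬unit-left unit ; (inj₂ unit) → ¬unit-root F.factor α factor→0 unit }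
      where
      open PseudoDivision (pseudoDivide q v q-deg q_v≢0 (suc d) p p-deg) renaming (quotientₚ to a; multiplier to e; remainder to r)
      eval-equation : ∀ x → ιℤ e * evalℚ p x ≡ evalℚ a x * evalℚ q x + evalℚ r x
      eval-equation x = trans (sym (evalℚ-scale e p x)) (trans (evalℚ-cong (scale e p) ((a *ₚ q) +ₚ r) x
          (λ k → trans (coeff-scale e p k) (trans (equation k) (sym (coeff-+ₚ (a *ₚ q) r k)))))
        (trans (evalℚ-+ₚ (a *ₚ q) r x) (cong (_+ evalℚ r x) (evalℚ-*ₚ a q x))))
      r→0 : Tends0 (r at α)
      r→0 = Tends0-cong (λ k → trans (cong (_+ - 1ℚ * (evalℚ a (seq α k) * evalℚ q (seq α k))) (eval-equation (seq α k)))
          (solve 2 (λ x r → (x :+ r) :+ con (- 1ℚ) :* x := r) refl (evalℚ a (seq α k) * evalℚ q (seq α k)) (evalℚ r (seq α k))))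
        (Tends0-+ (Tends0-* (constᵇ (ιℤ e)) p→0) (Tends0-* (constᵇ (- 1ℚ)) (Tends0-* (at-bounded a α) q→0)))
      r≡0 : Zero r
      r≡0 = no-smaller v r (ℕₚ.<⇒≤ v<d) remainder-degree r→0
      module F = PrimitiveFactorisation (primitiveFactorisation e multiplier≢0 p a q
        (λ k → trans (equation k) (trans (cong (λ z → coeff (a *ₚ q) k ℤ.+ z) (r≡0 k)) (ℤₚ.+-identityʳ _))))
      factor→0 : Tends0 (F.factor at α)
      factor→0 = Tends0-ιℤ* F.multiple F.multiple≢0 (Tends0-cong (λ k → trans
        (evalℚ-cong q (scale F.multiple F.factor) (seq α k) (λ i → trans (F.scaled i) (sym (coeff-scale F.multiple F.factor i))))
        (evalℚ-scale F.multiple F.factor (seq α k))) q→0)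
      factor_d≡0 : coeff F.factor d ≡ 0ℤ
      factor_d≡0 = [ (λ m≡0 → contradiction m≡0 F.multiple≢0) , (λ z → z) ]′
        (ℤₚ.i*j≡0⇒i≡0∨j≡0 F.multiple (trans (sym (F.scaled d)) (q-deg d v<d)))
      ¬unit-left : ¬ (F.cofactor ∣ₚ (1ℤ ∷ []))
      ¬unit-left unit = p-lead (trans (F.factorised d) (trans
        (coeff-*ₚ-const F.cofactor F.factor (subst (λ c → DegLT F.cofactor (suc c)) (unit-degree F.cofactor unit) (degree-DegLT F.cofactor)) d)
        (*-zeroed (coeff F.cofactor 0) factor_d≡0)))

    d≢0 : d ≢ 0
    d≢0 e = ¬constant-root p α (subst (λ d → DegLT p (suc d)) e p-deg) (subst (λ i → coeff p i ≢ 0ℤ) e p-lead) p→0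

  Tends0-abs : ∀ {z} → Tends0 z → Tends0 (λ k → ∣ z k ∣)
  Tends0-abs {z} h ε 0<ε = let (N , b) = h ε 0<ε in N , λ k p → subst (_< ε) (sym (∣∣p∣∣≡∣p∣ (z k))) (b k p)

  sizeBound-mono : ∀ {b} → 0ℚ ≤ b → ∀ {l l′} → l ℕ.≤ l′ → sizeBound b l ≤ sizeBound b l′
  sizeBound-mono 0≤b {l′ = zero}   z≤n = ≤-refl
  sizeBound-mono 0≤b {l′ = suc l′} z≤n = Bounds.0≤β 0≤b 0≤b (suc l′)
  sizeBound-mono 0≤b (s≤s l≤l′) = +-monoʳ-≤ 1ℚ (*-monoˡ 0≤b (sizeBound-mono 0≤b l≤l′))

  -- The exponent `2n − 1` is the number of equations for `d = n`, so the bound serves every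
  -- `d ≤ n`.
  siegelBound : ℕ → ℕ → ℕ
  siegelBound n′ H = (4 ℕ.* (suc n′ ℕ.* H)) ℕ.^ (n′ ℕ.+ suc n′)

  abstract
    smallCombination : ∀ n′ d H p q → d ℕ.≤ suc n′ → 1 ℕ.≤ H → DegLT p (suc d) → DegLT q (suc (suc n′)) →
      (∀ i → ℤ.∣ coeff p i ∣ ℕ.≤ H) → (∀ i → ℤ.∣ coeff q i ∣ ℕ.≤ H) → ConstantCombination (suc n′) d (siegelBound n′ H) p q
    smallCombination n′ d H p q d≤n 1≤H p-deg q-deg hp hq = go (siegelBound n′ H) refl
      where
      go : ∀ X → X ≡ siegelBound n′ H → ConstantCombination (suc n′) d X p q
      go X X≡ = constantCombination n′ d H X p q p-deg q-deg hp hq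
        (boxes<points (4 ℕ.* (suc n′ ℕ.* H)) X (n′ ℕ.+ d) (n′ ℕ.+ suc n′) _ (ℕₚ.*-mono-≤ {1} {4} (s≤s z≤n) (ℕₚ.*-mono-≤ {1} {suc n′} (s≤s z≤n) 1≤H))
          (boxes≤ (suc n′) d H X d≤n (s≤s z≤n) 1≤H) (ℕₚ.+-monoʳ-≤ n′ d≤n) X≡)

  -- The Liouville inequality and the separation of algebraic numbers

  module Separation (n′ N : ℕ) (1≤N : 1 ℕ.≤ N) {b : ℚ} (0≤b : 0ℚ ≤ b) where
    n H : ℕ
    n = suc n′
    -- The factor `n` makes the bound cover derivatives as well.
    H = n ℕ.* N

    private
      1≤H : 1 ℕ.≤ H
      1≤H = ℕₚ.*-mono-≤ {1} {n} (s≤s z≤n) 1≤N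

      N≤H : N ℕ.≤ H
      N≤H = ℕₚ.m≤m+n N (n′ ℕ.* N)

    gain : ℚ
    gain = ι (siegelBound n′ H) * sizeBound b n

    0≤gain : 0ℚ ≤ gain
    0≤gain = *-nonNeg (ι-nonNeg (siegelBound n′ H)) (Bounds.0≤β 0≤b 0≤b n)

    module _ {α} (M : HasMinimalPolynomial n N α) (q : Poly) where
      open HasMinimalPolynomial M renaming (poly to p; deg to d)
      open Minimality {α} {p} {d} deg-bound leading splits vanishes

      -- The Liouville inequality, read off from `u p + v q` at a rational `x`. The term with `p`
      -- disappears only in the limit `x → α`.
      lower-bound : DegLT q (suc n) → (∀ i → ℤ.∣ coeff q i ∣ ℕ.≤ H) → ¬ Tends0 (q at α) →
        ∀ x → ∣ x ∣ ≤ b → 1ℚ ≤ gain * (∣ evalℚ p x ∣ + ∣ evalℚ q x ∣)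
      lower-bound q-deg q-bound q↛0 x ∣x∣≤b = begin
        1ℚ                                       ≤⟨ 1≤∣ιℤ∣ constant constant≢0 ⟩
        ∣ ιℤ constant ∣                          ≡⟨ cong ∣_∣ (sym (value x)) ⟩
        ∣ evalℚ u x * evalℚ p x + evalℚ v x * evalℚ q x ∣
          ≤⟨ ∣p+q∣≤∣p∣+∣q∣ (evalℚ u x * evalℚ p x) (evalℚ v x * evalℚ q x) ⟩
        ∣ evalℚ u x * evalℚ p x ∣ + ∣ evalℚ v x * evalℚ q x ∣
          ≡⟨ cong₂ _+_ (∣p*q∣≡∣p∣*∣q∣ (evalℚ u x) (evalℚ p x)) (∣p*q∣≡∣p∣*∣q∣ (evalℚ v x) (evalℚ q x)) ⟩
        ∣ evalℚ u x ∣ * ∣ evalℚ p x ∣ + ∣ evalℚ v x ∣ * ∣ evalℚ q x ∣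
          ≤⟨ +-mono-≤ (*-monoʳ (0≤∣p∣ (evalℚ p x)) (factor≤ u u-bound (ℕₚ.≤-reflexive u-length)))
                      (*-monoʳ (0≤∣p∣ (evalℚ q x)) (factor≤ v v-bound (subst (ℕ._≤ n) (sym v-length) deg≤n))) ⟩
        gain * ∣ evalℚ p x ∣ + gain * ∣ evalℚ q x ∣ ≡⟨ sym (*-distribˡ-+ gain (∣ evalℚ p x ∣) (∣ evalℚ q x ∣)) ⟩
        gain * (∣ evalℚ p x ∣ + ∣ evalℚ q x ∣)   ∎
        where
        open ≤-Reasoning
        open ConstantCombination (smallCombination n′ d H p q deg≤n 1≤H deg-bound q-deg (λ i → ℕₚ.≤-trans (bound i) N≤H) q-bound)
        value : ∀ x → evalℚ u x * evalℚ p x + evalℚ v x * evalℚ q x ≡ ιℤ constant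
        value x = trans (sym (trans (evalℚ-+ₚ (u *ₚ p) (v *ₚ q) x) (cong₂ _+_ (evalℚ-*ₚ u p x) (evalℚ-*ₚ v q x))))
          (trans (evalℚ-cong ((u *ₚ p) +ₚ (v *ₚ q)) (constant ∷ []) x combination) (evalℚ-constant constant x))
        factor≤ : ∀ w → (∀ i → ℤ.∣ coeff w i ∣ ℕ.≤ siegelBound n′ H) → length w ℕ.≤ n → ∣ evalℚ w x ∣ ≤ gain
        factor≤ w hw lw = ≤-trans (Bounds.∣evalℚ∣≤ 0≤b (ι-nonNeg (siegelBound n′ H)) w ∣x∣≤b (height-Bounded w hw))
          (*-monoˡ (ι-nonNeg (siegelBound n′ H)) (sizeBound-mono 0≤b lw))
        constant≢0 : constant ≢ 0ℤ
        -- If the constant were 0, then `v(α) q(α) = 0`, so `v(α) = 0`. As `v` has length `d`, it is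
        -- zero by minimality; then `u p = 0` and `u` is zero too.
        constant≢0 c≡0 = Tends0-*⁻ (at-cauchy v α) (at-cauchy q α) vq→0 q↛0 λ v→0 →
          let v≡0 : Zero v
              v≡0 = no-smaller d v ℕₚ.≤-refl (subst (DegLT v) v-length (DegLT-length v)) v→0
          in ¬¬u≡0 v≡0 (λ u≡0 → nontrivial (u≡0 , v≡0))
          where
          vq→0 : Tends0 (λ k → evalℚ v (seq α k) * evalℚ q (seq α k))
          vq→0 = Tends0-cong (λ k → rearrange (evalℚ u (seq α k) * evalℚ p (seq α k)) (evalℚ v (seq α k) * evalℚ q (seq α k)) (trans (value (seq α k)) (cong ιℤ c≡0)))
            (Tends0-* (constᵇ (- 1ℚ)) (Tends0-* (at-bounded u α) vanishes))
            where
            rearrange : ∀ x y → x + y ≡ 0ℚ → - 1ℚ * x ≡ y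
            rearrange x y e = trans (solve 2 (λ x y → con (- 1ℚ) :* x := y :- (x :+ y)) refl x y)
              (trans (cong (λ z → y - z) e) (+-identityʳ y))
          ¬¬u≡0 : Zero v → ¬ ¬ Zero u
          ¬¬u≡0 v≡0 u≢0 = i*j≢0′ (leading≢0 u u≢0) leading (trans (sym (coeff-*ₚ-top u p (degree u) d (degree-DegLT u) deg-bound))
            (trans (sym (ℤₚ.+-identityʳ _)) (trans (cong (λ z → coeff (u *ₚ p) k ℤ.+ z) (sym (coeff-*ₚ-null v q (λ i _ → v≡0 i) k)))
            (trans (sym (coeff-+ₚ (u *ₚ p) (v *ₚ q) k)) (trans (combination k) (constant-coeff k))))))
            where
            k = degree u ℕ.+ d
            constant-coeff : ∀ k → coeff (constant ∷ []) k ≡ 0ℤ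
            constant-coeff zero    = c≡0
            constant-coeff (suc k) = refl

    -- `slope` serves the case `q(α) ≠ 0` and `curvature` the case of conjugates. Their sum gives
    -- one `rate` valid in both, as the cases cannot be decided.
    slope curvature rate : ℚ
    slope     = ι N * slopeBound b (suc n)
    curvature = ι N * curvatureBound b (suc n)
    rate      = gain * (slope + curvature)

    private
      0≤slope : 0ℚ ≤ slope
      0≤slope = *-nonNeg (ι-nonNeg N) (Bounds.0≤σ 0≤b 0≤b (suc n))

      0≤curvature : 0ℚ ≤ curvature
      0≤curvature = *-nonNeg (ι-nonNeg N) (Bounds.0≤κ 0≤b 0≤b (suc n))

      -- Common end of both cases: `s` is the bracket of `lower-bound`, `w` its part tending to 0,
      -- `D` the distance of the approximations, and `y` is `slope` or `curvature`.
      conclude : ∀ {y D s} → y ≤ slope + curvature → 0ℚ ≤ D → ∀ {ε w} → 1ℚ ≤ gain * s → s ≤ w + y * D → ∣ gain * w ∣ < ε →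
        1ℚ ≤ rate * D + ε
      conclude {y} {D} {s} y≤ 0≤D {ε} {w} 1≤ s≤ w<ε = begin
        1ℚ                        ≤⟨ 1≤ ⟩
        gain * s                  ≤⟨ *-monoˡ 0≤gain s≤ ⟩
        gain * (w + y * D)        ≡⟨ solve 4 (λ g w y D → g :* (w :+ y :* D) := g :* y :* D :+ g :* w) refl gain w y D ⟩
        gain * y * D + gain * w   ≤⟨ +-mono-≤ (*-monoʳ 0≤D (*-monoˡ 0≤gain y≤)) (≤-trans (p≤∣p∣ (gain * w)) (<⇒≤ w<ε)) ⟩
        rate * D + ε              ∎
        where open ≤-Reasoning

    0≤rate : 0ℚ ≤ rate
    0≤rate = *-nonNeg 0≤gain (+-mono-≤ 0≤slope 0≤curvature)

    EventuallyIn : ℝ → Set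
    EventuallyIn α = ∃[ K ] (∀ k → K ℕ.≤ k → ∣ seq α k ∣ ≤ b)

    -- The inequality `1 ≤ rate * ∣ α − β ∣` of reals, unfolded.
    AtDistance : ℝ → ℝ → Set
    AtDistance α β = ∀ ε → 0ℚ < ε → ∃[ K ] (∀ k → K ℕ.≤ k → 1ℚ ≤ rate * ∣ seq α k - seq β k ∣ + ε)

    module _ {α β} (Mα : HasMinimalPolynomial n N α) (Mβ : HasMinimalPolynomial n N β) (α≤b : EventuallyIn α) (β≤b : EventuallyIn β) where
      private
        module A = HasMinimalPolynomial Mα
        module B = HasMinimalPolynomial Mβ
        p = A.poly
        q = B.poly
        q-Bounded : Bounded (ι N) q
        q-Bounded = height-Bounded q B.bound
        a c : ℕ → ℚ
        a = seq α
        c = seq β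
        Kα = proj₁ α≤b
        Kβ = proj₁ β≤b

      separate-distinct : ¬ Tends0 (q at α) → AtDistance α β
      separate-distinct q↛0 ε 0<ε = let (K , h) = Tends0-* (constᵇ gain) (Tends0-+ (Tends0-abs A.vanishes) (Tends0-abs B.vanishes)) ε 0<ε in
        Kα ℕ.⊔ (Kβ ℕ.⊔ K) , λ k le →
          let aₖ≤b = proj₂ α≤b k (ℕₚ.m⊔n≤o⇒m≤o Kα _ le)
              cₖ≤b = proj₂ β≤b k (ℕₚ.m⊔n≤o⇒m≤o Kβ K (ℕₚ.m⊔n≤o⇒n≤o Kα _ le))
          in conclude (subst (_≤ slope + curvature) (+-identityʳ slope) (+-monoʳ-≤ slope 0≤curvature)) (0≤∣p∣ (a k - c k))
               (lower-bound Mα q (DegLT-mono {q} (s≤s B.deg≤n) B.deg-bound) (λ i → ℕₚ.≤-trans (B.bound i) N≤H) q↛0 (a k) aₖ≤b)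
               (bound-sum k aₖ≤b cₖ≤b)
               (h k (ℕₚ.m⊔n≤o⇒n≤o Kβ K (ℕₚ.m⊔n≤o⇒n≤o Kα _ le)))
        where
        bound-sum : ∀ k → ∣ a k ∣ ≤ b → ∣ c k ∣ ≤ b →
          ∣ evalℚ p (a k) ∣ + ∣ evalℚ q (a k) ∣ ≤ (∣ evalℚ p (a k) ∣ + ∣ evalℚ q (c k) ∣) + slope * dist (a k) (c k)
        bound-sum k aₖ≤b cₖ≤b = subst (∣ evalℚ p (a k) ∣ + ∣ evalℚ q (a k) ∣ ≤_) (sym (+-assoc (∣ evalℚ p (a k) ∣) (∣ evalℚ q (c k) ∣) (slope * dist (a k) (c k))))
          (+-monoʳ-≤ (∣ evalℚ p (a k) ∣) (≤-trans (∣p∣≤∣q∣+dist (evalℚ q (a k)) (evalℚ q (c k))) (+-monoʳ-≤ (∣ evalℚ q (c k) ∣)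
            (subst (λ l → dist (evalℚ q (a k)) (evalℚ q (c k)) ≤ ι N * slopeBound b l * dist (a k) (c k)) B.len
              (Bounds.evalℚ-lipschitz 0≤b (ι-nonNeg N) q aₖ≤b cₖ≤b q-Bounded)))))

      module _ (q→0 : Tends0 (q at α)) where
        private
          q′ = derivative q
          d = B.deg

          -- As `q` also vanishes at `α`, it can take the role of `p` in `lower-bound`, with its
          -- derivative as the second polynomial.
          Mα′ : HasMinimalPolynomial n N α
          Mα′ = record { poly = q ; deg = d ; deg-bound = B.deg-bound ; leading = B.leading ; deg≤n = B.deg≤n
                       ; bound = B.bound ; len = B.len ; splits = B.splits ; vanishes = q→0 }

          open Minimality {α} {q} {d} B.deg-bound B.leading B.splits q→0

          q′-coeff≡0 : DegLT q′ d
          q′-coeff≡0 i d≤i = trans (coeff-derivative q i) (*-zeroed (ℤ.+ suc i) (B.deg-bound (suc i) (s≤s d≤i)))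

          q′-bound : ∀ i → ℤ.∣ coeff q′ i ∣ ℕ.≤ H
          q′-bound i with suc i ℕₚ.≤? n
          ... | yes i<n = subst (ℕ._≤ H) (sym (trans (cong ℤ.∣_∣ (coeff-derivative q i)) (ℤₚ.abs-* (ℤ.+ suc i) (coeff q (suc i)))))
            (ℕₚ.*-mono-≤ i<n (B.bound (suc i)))
          ... | no i≮n = subst (ℕ._≤ H) (sym (cong ℤ.∣_∣ (q′-coeff≡0 i (ℕₚ.≤-trans B.deg≤n (ℕₚ.≤-pred (ℕₚ.≰⇒> i≮n)))))) z≤n

          q′≢0 : ∀ d → coeff q d ≢ 0ℤ → d ≢ 0 → ¬ Zero q′
          q′≢0 zero    _     d≢0 _    = d≢0 refl
          q′≢0 (suc d) lead≢0 _  q′≡0 = i*j≢0′ {ℤ.+ suc d} (λ ()) lead≢0 (trans (sym (coeff-derivative q d)) (q′≡0 d))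

          q′↛0 : ¬ Tends0 (q′ at α)
          q′↛0 q′→0 = q′≢0 d B.leading d≢0 (no-smaller d q′ ℕₚ.≤-refl q′-coeff≡0 q′→0)

          -- Division of the Taylor estimate by `D`: the quadratic term loses one factor `D`, and
          -- the error `w` is divided by the lower bound `η`, which is fixed, so that it still tends
          -- to 0.
          divide-≤ : ∀ {η D y w C} → 0ℚ < η → (η⁻¹ : ℚ) → η⁻¹ * η ≡ 1ℚ → 0ℚ ≤ η⁻¹ → η ≤ D → 0ℚ ≤ w → D * y ≤ w + C * (D * D) → y ≤ η⁻¹ * w + C * D
          divide-≤ {η} {D} {y} {w} {C} 0<η η⁻¹ inv 0≤η⁻¹ η≤D 0≤w h with ≤-total y (C * D)
          ... | inj₁ y≤ = ≤-trans y≤ (subst (_≤ η⁻¹ * w + C * D) (+-identityˡ (C * D)) (+-monoˡ-≤ (C * D) (*-nonNeg 0≤η⁻¹ 0≤w)))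
          ... | inj₂ ≤y = begin
            y                                  ≡⟨ solve 2 (λ y c → y := (y :- c) :+ c) refl y (C * D) ⟩
            (y - C * D) + C * D                ≡⟨ cong (_+ C * D) (sym (trans (cong (_* (y - C * D)) inv) (*-identityˡ (y - C * D)))) ⟩
            η⁻¹ * η * (y - C * D) + C * D      ≡⟨ cong (_+ C * D) (*-assoc η⁻¹ η (y - C * D)) ⟩
            η⁻¹ * (η * (y - C * D)) + C * D    ≤⟨ +-monoˡ-≤ (C * D) (*-monoˡ 0≤η⁻¹ (≤-trans (*-monoʳ 0≤y-CD η≤D) D*≤w)) ⟩
            η⁻¹ * w + C * D                    ∎
            where
            open ≤-Reasoning
            0≤y-CD : 0ℚ ≤ y - C * D
            0≤y-CD = subst (_≤ y - C * D) (+-inverseʳ (C * D)) (+-monoˡ-≤ (- (C * D)) ≤y)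
            D*≤w : D * (y - C * D) ≤ w
            D*≤w = subst (_≤ w) (solve 3 (λ D y C → D :* y :- C :* (D :* D) := D :* (y :- C :* D)) refl D y C)
              (sub≤ (≤-trans h (≤-reflexive (+-comm w (C * (D * D))))))

          taylor-≤ : ∀ k → ∣ a k ∣ ≤ b → ∣ c k ∣ ≤ b →
            dist (a k) (c k) * ∣ evalℚ q′ (a k) ∣ ≤ (∣ evalℚ q (a k) ∣ + ∣ evalℚ q (c k) ∣) + curvature * (dist (a k) (c k) * dist (a k) (c k))
          taylor-≤ k aₖ≤b cₖ≤b = begin
            D * ∣ y ∣                                          ≡⟨ cong (_* ∣ y ∣) (dist-sym (a k) (c k)) ⟩
            dist (c k) (a k) * ∣ y ∣                           ≡⟨ sym (∣p*q∣≡∣p∣*∣q∣ (c k - a k) y) ⟩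
            ∣ (c k - a k) * y ∣                                ≤⟨ ∣p∣≤∣q∣+dist ((c k - a k) * y) (Qc - Qa) ⟩
            ∣ Qc - Qa ∣ + dist ((c k - a k) * y) (Qc - Qa)     ≤⟨ +-mono-≤ difference (≤-trans (≤-reflexive (dist-sym ((c k - a k) * y) (Qc - Qa))) taylor) ⟩
            (∣ Qa ∣ + ∣ Qc ∣) + curvature * (D * D)            ∎
            where
            open ≤-Reasoning
            D = dist (a k) (c k)
            y = evalℚ q′ (a k)
            Qa = evalℚ q (a k)
            Qc = evalℚ q (c k)
            difference : ∣ Qc - Qa ∣ ≤ ∣ Qa ∣ + ∣ Qc ∣
            difference = ≤-trans (∣p+q∣≤∣p∣+∣q∣ Qc (- Qa)) (≤-reflexive (trans (cong (∣ Qc ∣ +_) (∣-p∣≡∣p∣ Qa)) (+-comm ∣ Qc ∣ ∣ Qa ∣)))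
            taylor : ∣ (Qc - Qa) - (c k - a k) * y ∣ ≤ curvature * (D * D)
            taylor = subst₂ (λ l δ → ∣ (Qc - Qa) - (c k - a k) * y ∣ ≤ ι N * curvatureBound b l * (δ * δ)) B.len (dist-sym (c k) (a k))
              (Bounds.evalℚ-taylor 0≤b (ι-nonNeg N) q aₖ≤b cₖ≤b q-Bounded)

        separate-conjugates : Apart0 (λ k → a k - c k) → AtDistance α β
        separate-conjugates (η , 0<η , K′ , η≤) ε 0<ε =
          let (K , h) = Tends0-* (constᵇ gain) (Tends0-+ (Tends0-abs q→0)
                          (Tends0-* (constᵇ 1/η) (Tends0-+ (Tends0-abs q→0) (Tends0-abs B.vanishes)))) ε 0<ε in
          (Kα ℕ.⊔ Kβ) ℕ.⊔ (K′ ℕ.⊔ K) , λ k le →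
            let aₖ≤b = proj₂ α≤b k (ℕₚ.m⊔n≤o⇒m≤o Kα Kβ (ℕₚ.m⊔n≤o⇒m≤o (Kα ℕ.⊔ Kβ) _ le))
                cₖ≤b = proj₂ β≤b k (ℕₚ.m⊔n≤o⇒n≤o Kα Kβ (ℕₚ.m⊔n≤o⇒m≤o (Kα ℕ.⊔ Kβ) _ le))
                K′⊔K≤k = ℕₚ.m⊔n≤o⇒n≤o (Kα ℕ.⊔ Kβ) (K′ ℕ.⊔ K) le
            in conclude (subst (_≤ slope + curvature) (+-identityˡ curvature) (+-monoˡ-≤ curvature 0≤slope)) (0≤∣p∣ (a k - c k))
                 (lower-bound Mα′ q′ (DegLT-mono {q′} (ℕₚ.m≤n⇒m≤1+n B.deg≤n) q′-coeff≡0) q′-bound q′↛0 (a k) aₖ≤b)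
                 (≤-trans (+-monoʳ-≤ (∣ evalℚ q (a k) ∣)
                   (divide-≤ {C = curvature} 0<η 1/η (*-inverseˡ η {{>-nonZero 0<η}}) 0≤1/η (η≤ k (ℕₚ.m⊔n≤o⇒m≤o K′ K K′⊔K≤k)) (+-mono-≤ (0≤∣p∣ (evalℚ q (a k))) (0≤∣p∣ (evalℚ q (c k)))) (taylor-≤ k aₖ≤b cₖ≤b)))
                   (≤-reflexive (sym (+-assoc (∣ evalℚ q (a k) ∣) (1/η * (∣ evalℚ q (a k) ∣ + ∣ evalℚ q (c k) ∣)) (curvature * dist (a k) (c k))))))
                 (h k (ℕₚ.m⊔n≤o⇒n≤o K′ K K′⊔K≤k))
          where
          1/η : ℚ
          1/η = (1/ η) {{>-nonZero 0<η}}
          0≤1/η : 0ℚ ≤ 1/η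
          0≤1/η = <⇒≤ (positive⁻¹ 1/η {{1/pos⇒pos η {{positive 0<η}}}})

      -- Neither `q(α) = 0` nor the apartness of `α` and `β` is decidable; both become available
      -- because the goal is doubly negated.
      separate : Cauchy (λ k → a k - c k) → ¬ Tends0 (λ k → a k - c k) → ¬ ¬ AtDistance α β
      separate cauchy- ↛0 ¬far = ¬far (separate-distinct λ q→0 →
        ↛0 (¬Apart0⇒Tends0 cauchy- λ apart → ¬far (separate-conjugates q→0 apart)))

  -- Normalised minimal polynomials and the separation constant

  tail : Poly → Poly
  tail []      = []
  tail (_ ∷ p) = p

  resize : ℕ → Poly → Poly
  resize zero    p = []
  resize (suc l) p = coeff p 0 ∷ resize l (tail p)

  length-resize : ∀ l p → length (resize l p) ≡ l
  length-resize zero    p = refl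
  length-resize (suc l) p = cong suc (length-resize l (tail p))

  coeff-tail : ∀ p i → coeff (tail p) i ≡ coeff p (suc i)
  coeff-tail []      i = refl
  coeff-tail (a ∷ p) i = refl

  coeff-resize : ∀ l p → DegLT p l → resize l p ≈ₚ p
  coeff-resize zero    p h i       = sym (h i z≤n)
  coeff-resize (suc l) p h zero    = refl
  coeff-resize (suc l) p h (suc i) =
    trans (coeff-resize l (tail p) (λ i l≤i → trans (coeff-tail p i) (h (suc i) (s≤s l≤i))) i) (coeff-tail p i)

  -- The factorisation 0 = 0 · 0 would make 0 a unit.
  irreducible⇒¬Zero : ∀ p → Irreducible p → ¬ Zero p
  irreducible⇒¬Zero p irr p≡0 = [ no-inverse , no-inverse ]′ (Irreducible.split-∣1 irr {[]} {[]} p≡0)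
    where
    no-inverse : ¬ ([] ∣ₚ (1ℤ ∷ []))
    no-inverse (z , z*0≈1) = contradiction (trans (sym (z*0≈1 0)) (coeff-*ₚ-[] z 0)) λ ()

  algebraic⇒minimal : ∀ {n N α} → IsAlgebraic[degree≤ n ,height≤ N ] α → HasMinimalPolynomial n N α
  algebraic⇒minimal {n} {N} {α} (p , min , deg≤n , height≤N) = record
    { poly = p′ ; deg = degree p
    ; deg-bound = λ i h → trans (p′≈p i) (degree-DegLT p i h)
    ; leading = λ e → leading≢0 p (irreducible⇒¬Zero p irreducible) (trans (sym (p′≈p (degree p))) e)
    ; deg≤n = deg≤n
    ; bound = λ i → subst (λ c → ℤ.∣ c ∣ ℕ.≤ N) (sym (p′≈p i)) (ℕₚ.≤-trans (∣coeff∣≤height p i) height≤N)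
    ; len = length-resize (suc n) p
    ; splits = λ {x} {y} e → Irreducible.split-∣1 irreducible {x} {y} (λ i → trans (sym (p′≈p i)) (e i))
    ; vanishes = Tends0-cong (λ k → trans (seq-eval p α k) (sym (evalℚ-cong p′ p (seq α k) p′≈p))) (root→0 root) }
    where
    open IsMinimalPolynomial min
    p′ : Poly
    p′ = resize (suc n) p
    p′≈p : p′ ≈ₚ p
    p′≈p = coeff-resize (suc n) p (DegLT-mono {p} (s≤s deg≤n) (degree-DegLT p))
    root→0 : eval p α ≃ 0ℝ → Tends0 (seq (eval p α))
    root→0 (mk≃ h) = Tends0-cong (λ k → +-identityʳ (seq (eval p α) k)) h

  abstract
    -- The origin of `N²ⁿ`: Siegel's lemma contributes `2n − 1` factors `N`, and `slope` or
    -- `curvature` contributes one.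
    siegelBound-split : ∀ n′ N → siegelBound n′ (suc n′ ℕ.* N) ℕ.* N ≡ (4 ℕ.* (suc n′ ℕ.* suc n′)) ℕ.^ (n′ ℕ.+ suc n′) ℕ.* N ℕ.^ (2 ℕ.* suc n′)
    siegelBound-split n′ N = go (suc n′) (n′ ℕ.+ suc n′) (2 ℕ.* suc n′) (cong suc (sym (cong (n′ ℕ.+_) (ℕₚ.+-identityʳ (suc n′)))))
      where
      open ≡-Reasoning
      go : ∀ n e t → suc e ≡ t → (4 ℕ.* (n ℕ.* (n ℕ.* N))) ℕ.^ e ℕ.* N ≡ (4 ℕ.* (n ℕ.* n)) ℕ.^ e ℕ.* N ℕ.^ t
      go n e .(suc e) refl = begin
        (4 ℕ.* (n ℕ.* (n ℕ.* N))) ℕ.^ e ℕ.* N            ≡⟨ cong (λ z → z ℕ.^ e ℕ.* N) (trans (cong (4 ℕ.*_) (sym (ℕₚ.*-assoc n n N))) (sym (ℕₚ.*-assoc 4 (n ℕ.* n) N))) ⟩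
        (4 ℕ.* (n ℕ.* n) ℕ.* N) ℕ.^ e ℕ.* N              ≡⟨ cong (ℕ._* N) (^-distribʳ-* e (4 ℕ.* (n ℕ.* n)) N) ⟩
        (4 ℕ.* (n ℕ.* n)) ℕ.^ e ℕ.* N ℕ.^ e ℕ.* N        ≡⟨ trans (ℕₚ.*-assoc ((4 ℕ.* (n ℕ.* n)) ℕ.^ e) (N ℕ.^ e) N) (cong ((4 ℕ.* (n ℕ.* n)) ℕ.^ e ℕ.*_) (ℕₚ.*-comm (N ℕ.^ e) N)) ⟩
        (4 ℕ.* (n ℕ.* n)) ℕ.^ e ℕ.* N ℕ.^ suc e          ∎

  separationConstant : ℕ → ℚ → ℚ
  separationConstant n′ b = ι ((4 ℕ.* (suc n′ ℕ.* suc n′)) ℕ.^ (n′ ℕ.+ suc n′)) * (sizeBound b (suc n′) * (slopeBound b (suc (suc n′)) + curvatureBound b (suc (suc n′))))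

  rate-split : ∀ n′ N (1≤N : 1 ℕ.≤ N) {b} (0≤b : 0ℚ ≤ b) → Separation.rate n′ N 1≤N 0≤b ≡ separationConstant n′ b * ι (N ℕ.^ (2 ℕ.* suc n′))
  rate-split n′ N 1≤N {b} 0≤b = begin
    ι X * β * (ι N * σ + ι N * κ)         ≡⟨ solve 5 (λ x y n s k → x :* y :* (n :* s :+ n :* k) := x :* n :* (y :* (s :+ k))) refl (ι X) β (ι N) σ κ ⟩
    ι X * ι N * (β * (σ + κ))             ≡⟨ cong (_* (β * (σ + κ))) (trans (sym (ι-* X N)) (trans (cong ι (siegelBound-split n′ N)) (ι-* Y Z))) ⟩
    ι Y * ι Z * (β * (σ + κ))             ≡⟨ solve 3 (λ y z w → y :* z :* w := y :* w :* z) refl (ι Y) (ι Z) (β * (σ + κ)) ⟩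
    ι Y * (β * (σ + κ)) * ι Z             ∎
    where
    open ≡-Reasoning
    X = siegelBound n′ (suc n′ ℕ.* N)
    Y = (4 ℕ.* (suc n′ ℕ.* suc n′)) ℕ.^ (n′ ℕ.+ suc n′)
    Z = N ℕ.^ (2 ℕ.* suc n′)
    β = sizeBound b (suc n′)
    σ = slopeBound b (suc (suc n′))
    κ = curvatureBound b (suc (suc n′))

-- Equality, order and arithmetic of the reals

open import Defs
open RationalLemmas using (ι; ι-suc; ι-mono; ι-nonNeg; half-pos; half+half; dist; dist-sym; *-nonNeg; *-pos; p≤ι; p≤∣p∣; ≤-dist; sub≤; dist≤; dist-⊔)
open Limits using (EventuallyBounded; bounded)
open ExponentialSums using (S-*-null)
open AlgebraicNumbers using (ι-*; Tends0; Tends0-cong; Tends0-+; Tends0-*; constᵇ; module Separation; algebraic⇒minimal; separationConstant; rate-split)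
open ℚ-Solver using (solve; _:=_; _:+_; _:*_; :-_; _:-_; con)

private
  variable
    x y z w : ℝ

≡⇒≃ : (∀ k → seq x k ≡ seq y k) → x ≃ y
≡⇒≃ {x} {y} e = mk≃ λ ε 0<ε → 0 , λ k _ → subst (ℚ._< ε) (sym (cong ℚ.∣_∣ (trans (cong (ℚ._- seq y k) (e k)) (ℚₚ.+-inverseʳ (seq y k))))) 0<ε

≃-refl : x ≃ x
≃-refl = ≡⇒≃ λ _ → refl

≃-sym : x ≃ y → y ≃ x
≃-sym {x} {y} (mk≃ h) = mk≃ λ ε 0<ε → let (N , b) = h ε 0<ε in N , λ k p → subst (ℚ._< ε) (dist-sym (seq x k) (seq y k)) (b k p)

≃-trans : x ≃ y → y ≃ z → x ≃ z
≃-trans {x} {y} {z} (mk≃ h) (mk≃ h′) = mk≃ (Tends0-cong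
  (λ k → solve 3 (λ x y z → (x :- y) :+ (y :- z) := x :- z) refl (seq x k) (seq y k) (seq z k)) (Tends0-+ h h′))

*-cong : x ≃ y → z ≃ w → x * z ≃ y * w
*-cong {x} {y} {z} {w} (mk≃ h) (mk≃ h′) = mk≃ (Tends0-cong
  (λ k → solve 4 (λ x y z w → x :* (z :- w) :+ w :* (x :- y) := x :* z :- y :* w) refl (seq x k) (seq y k) (seq z k) (seq w k))
  (Tends0-+ (Tends0-* (bounded (seq x) (cauchy x)) h′) (Tends0-* (bounded (seq w) (cauchy w)) h)))

+-cong : x ≃ y → z ≃ w → x + z ≃ y + w
+-cong {x} {y} {z} {w} (mk≃ h) (mk≃ h′) = mk≃ (Tends0-cong
  (λ k → solve 4 (λ x y z w → (x :- y) :+ (z :- w) := (x :+ z) :- (y :+ w)) refl (seq x k) (seq y k) (seq z k) (seq w k))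
  (Tends0-+ h h′))

∣-∣-cong : x ≃ y → ∣ x ∣ ≃ ∣ y ∣
∣-∣-cong {x} {y} (mk≃ h) = mk≃ λ ε 0<ε → let (N , b) = h ε 0<ε in
  N , λ k p → ℚₚ.≤-<-trans (RationalLemmas.dist-∣∣ (seq x k) (seq y k)) (b k p)

⊔-cong : x ≃ y → z ≃ w → x ⊔ z ≃ y ⊔ w
⊔-cong {x} {y} {z} {w} (mk≃ h) (mk≃ h′) = mk≃ λ ε 0<ε →
  let (N , b) = h (ε ℚ.* ½) (half-pos 0<ε); (N′ , b′) = h′ (ε ℚ.* ½) (half-pos 0<ε) in
  N ℕ.⊔ N′ , λ k p → ℚₚ.≤-<-trans (dist-⊔ (seq x k) (seq z k) (seq y k) (seq w k)) (subst (_ ℚ.<_) (half+half ε)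
    (ℚₚ.+-mono-< (b k (ℕₚ.m⊔n≤o⇒m≤o N N′ p)) (b′ k (ℕₚ.m⊔n≤o⇒n≤o N N′ p))))

≃⇒≤ : x ≃ y → x ≤ y
≃⇒≤ {x} {y} (mk≃ h) = mk≤ λ ε 0<ε → let (N , b) = h ε 0<ε in
  N , λ k p → ℚₚ.≤-trans (≤-dist (seq x k) (seq y k)) (ℚₚ.+-monoʳ-≤ (seq y k) (ℚₚ.<⇒≤ (b k p)))

eventually≤⇒≤ : ∀ N → (∀ k → N ℕ.≤ k → seq x k ℚ.≤ seq y k) → x ≤ y
eventually≤⇒≤ {x} {y} N h = mk≤ λ ε 0<ε → N , λ k p →
  ℚₚ.≤-trans (h k p) (subst (ℚ._≤ seq y k ℚ.+ ε) (ℚₚ.+-identityʳ (seq y k)) (ℚₚ.+-monoʳ-≤ (seq y k) (ℚₚ.<⇒≤ 0<ε)))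

≤-trans : x ≤ y → y ≤ z → x ≤ z
≤-trans {x} {y} {z} (mk≤ h) (mk≤ h′) = mk≤ λ ε 0<ε →
  let (N , b) = h (ε ℚ.* ½) (half-pos 0<ε); (N′ , b′) = h′ (ε ℚ.* ½) (half-pos 0<ε) in
  N ℕ.⊔ N′ , λ k p → ℚₚ.≤-trans (b k (ℕₚ.m⊔n≤o⇒m≤o N N′ p))
    (ℚₚ.≤-trans (ℚₚ.+-monoˡ-≤ (ε ℚ.* ½) (b′ k (ℕₚ.m⊔n≤o⇒n≤o N N′ p)))
    (ℚₚ.≤-reflexive (trans (ℚₚ.+-assoc (seq z k) _ _) (cong (seq z k ℚ.+_) (half+half ε)))))

≤-refl : x ≤ x
≤-refl = ≃⇒≤ ≃-refl

≤-respˡ-≃ : x ≃ y → y ≤ z → x ≤ z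
≤-respˡ-≃ e = ≤-trans (≃⇒≤ e)

≤-respʳ-≃ : y ≃ z → x ≤ y → x ≤ z
≤-respʳ-≃ e h = ≤-trans h (≃⇒≤ e)

+-mono-≤ : x ≤ y → z ≤ w → x + z ≤ y + w
+-mono-≤ {x} {y} {z} {w} (mk≤ h) (mk≤ h′) = mk≤ λ ε 0<ε →
  let (N , b) = h (ε ℚ.* ½) (half-pos 0<ε); (N′ , b′) = h′ (ε ℚ.* ½) (half-pos 0<ε) in
  N ℕ.⊔ N′ , λ k p → ℚₚ.≤-trans (ℚₚ.+-mono-≤ (b k (ℕₚ.m⊔n≤o⇒m≤o N N′ p)) (b′ k (ℕₚ.m⊔n≤o⇒n≤o N N′ p)))
    (ℚₚ.≤-reflexive (trans (solve 3 (λ y w e → (y :+ e) :+ (w :+ e) := (y :+ w) :+ (e :+ e)) refl (seq y k) (seq w k) (ε ℚ.* ½))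
      (cong (seq y k ℚ.+ seq w k ℚ.+_) (half+half ε))))

module _ where
  private
    scaled : ∀ {ε K} → 0ℚ ℚ.< ε → 0ℚ ℚ.< K → ∃[ δ ] 0ℚ ℚ.< δ × K ℚ.* δ ≡ ε
    scaled {ε} {K} 0<ε 0<K = 1/K ℚ.* ε , *-pos (ℚₚ.positive⁻¹ 1/K {{ℚₚ.1/pos⇒pos K {{ℚ.positive 0<K}}}}) 0<ε ,
      trans (sym (ℚₚ.*-assoc K 1/K ε)) (trans (cong (ℚ._* ε) (ℚₚ.*-inverseʳ K {{ℚ.>-nonZero 0<K}})) (ℚₚ.*-identityˡ ε))
      where
      1/K : ℚ
      1/K = (ℚ.1/ K) {{ℚ.>-nonZero 0<K}}

    -- The approximations of non-negative reals are only known to be at least `−δ`. The sign of `a`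
    -- decides which non-negative products are combined.
    product-≥ : ∀ {a b δ A B} → 0ℚ ℚ.≤ δ → 0ℚ ℚ.≤ a ℚ.+ δ → 0ℚ ℚ.≤ b ℚ.+ δ → ℚ.∣ a ∣ ℚ.≤ A → ℚ.∣ b ∣ ℚ.≤ B → 0ℚ ℚ.≤ a ℚ.* b ℚ.+ (A ℚ.+ B) ℚ.* δ
    product-≥ {a} {b} {δ} {A} {B} 0≤δ ha hb hA hB with ℚₚ.≤-total 0ℚ a
    ... | inj₁ 0≤a = begin
      0ℚ                                        ≤⟨ ℚₚ.+-mono-≤ (*-nonNeg 0≤a hb) (ℚₚ.+-mono-≤ (*-nonNeg 0≤A-a 0≤δ) (*-nonNeg 0≤B 0≤δ)) ⟩
      a ℚ.* (b ℚ.+ δ) ℚ.+ ((A ℚ.- a) ℚ.* δ ℚ.+ B ℚ.* δ)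
        ≡⟨ solve 5 (λ a b δ A B → a :* (b :+ δ) :+ ((A :- a) :* δ :+ B :* δ) := a :* b :+ (A :+ B) :* δ) refl a b δ A B ⟩
      a ℚ.* b ℚ.+ (A ℚ.+ B) ℚ.* δ               ∎
      where
      open ℚₚ.≤-Reasoning
      0≤A-a : 0ℚ ℚ.≤ A ℚ.- a
      0≤A-a = subst (ℚ._≤ A ℚ.- a) (ℚₚ.+-inverseʳ a) (ℚₚ.+-monoˡ-≤ (ℚ.- a) (ℚₚ.≤-trans (p≤∣p∣ a) hA))
      0≤B : 0ℚ ℚ.≤ B
      0≤B = ℚₚ.≤-trans (ℚₚ.0≤∣p∣ b) hB
    ... | inj₂ a≤0 = begin
      0ℚ                                        ≤⟨ ℚₚ.+-mono-≤ (*-nonNeg 0≤-a 0≤B-b) (ℚₚ.+-mono-≤ (*-nonNeg 0≤B ha) (*-nonNeg 0≤A 0≤δ)) ⟩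
      (ℚ.- a) ℚ.* (B ℚ.- b) ℚ.+ (B ℚ.* (a ℚ.+ δ) ℚ.+ A ℚ.* δ)
        ≡⟨ solve 5 (λ a b δ A B → (:- a) :* (B :- b) :+ (B :* (a :+ δ) :+ A :* δ) := a :* b :+ (A :+ B) :* δ) refl a b δ A B ⟩
      a ℚ.* b ℚ.+ (A ℚ.+ B) ℚ.* δ               ∎
      where
      open ℚₚ.≤-Reasoning
      0≤-a : 0ℚ ℚ.≤ ℚ.- a
      0≤-a = ℚₚ.neg-antimono-≤ a≤0
      0≤B-b : 0ℚ ℚ.≤ B ℚ.- b
      0≤B-b = subst (ℚ._≤ B ℚ.- b) (ℚₚ.+-inverseʳ b) (ℚₚ.+-monoˡ-≤ (ℚ.- b) (ℚₚ.≤-trans (p≤∣p∣ b) hB))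
      0≤A : 0ℚ ℚ.≤ A
      0≤A = ℚₚ.≤-trans (ℚₚ.0≤∣p∣ a) hA
      0≤B : 0ℚ ℚ.≤ B
      0≤B = ℚₚ.≤-trans (ℚₚ.0≤∣p∣ b) hB

  0≤*0≤ : 0ℝ ≤ x → 0ℝ ≤ y → 0ℝ ≤ x * y
  0≤*0≤ {x} {y} (mk≤ hx) (mk≤ hy) = mk≤ λ ε 0<ε →
    let (A , 0<A , N₁ , bx) = bounded (seq x) (cauchy x)
        (B , 0<B , N₂ , by) = bounded (seq y) (cauchy y)
        (δ , 0<δ , e) = scaled 0<ε (ℚₚ.+-mono-< 0<A 0<B)
        (N₃ , ax) = hx δ 0<δ
        (N₄ , ay) = hy δ 0<δ
    in (N₁ ℕ.⊔ N₂) ℕ.⊔ (N₃ ℕ.⊔ N₄) , λ k p →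
      let p₁ = ℕₚ.m⊔n≤o⇒m≤o (N₁ ℕ.⊔ N₂) (N₃ ℕ.⊔ N₄) p
          p₂ = ℕₚ.m⊔n≤o⇒n≤o (N₁ ℕ.⊔ N₂) (N₃ ℕ.⊔ N₄) p
      in subst (λ r → 0ℚ ℚ.≤ seq x k ℚ.* seq y k ℚ.+ r) e
        (product-≥ {seq x k} {seq y k} (ℚₚ.<⇒≤ 0<δ) (ax k (ℕₚ.m⊔n≤o⇒m≤o N₃ N₄ p₂)) (ay k (ℕₚ.m⊔n≤o⇒n≤o N₃ N₄ p₂))
          (bx k (ℕₚ.m⊔n≤o⇒m≤o N₁ N₂ p₁)) (by k (ℕₚ.m⊔n≤o⇒n≤o N₁ N₂ p₁)))

x≤y⇒0≤y-x : x ≤ y → 0ℝ ≤ y - x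
x≤y⇒0≤y-x {x} {y} h = ≤-respˡ-≃ (≡⇒≃ λ k → sym (ℚₚ.+-inverseʳ (seq x k))) (+-mono-≤ {x} {y} { - x} h ≤-refl)

0≤y-x⇒x≤y : 0ℝ ≤ y - x → x ≤ y
0≤y-x⇒x≤y {y} {x} h = ≤-respˡ-≃ (≡⇒≃ λ k → sym (ℚₚ.+-identityˡ (seq x k))) (≤-respʳ-≃ (≡⇒≃ λ k →
  solve 2 (λ x y → (y :- x) :+ x := y) refl (seq x k) (seq y k)) (+-mono-≤ {0ℝ} {y - x} {x} h ≤-refl))

*-monoˡ-≤ : 0ℝ ≤ z → x ≤ y → z * x ≤ z * y
*-monoˡ-≤ {z} {x} {y} 0≤z x≤y = 0≤y-x⇒x≤y (≤-respʳ-≃ (≡⇒≃ λ k →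
  solve 3 (λ x y z → z :* (y :- x) := z :* y :- z :* x) refl (seq x k) (seq y k) (seq z k)) (0≤*0≤ 0≤z (x≤y⇒0≤y-x x≤y)))

*-comm : ∀ x y → x * y ≃ y * x
*-comm x y = ≡⇒≃ λ k → ℚₚ.*-comm (seq x k) (seq y k)

*-monoʳ-≤ : 0ℝ ≤ z → x ≤ y → x * z ≤ y * z
*-monoʳ-≤ {z} {x} {y} 0≤z x≤y = ≤-respˡ-≃ (*-comm x z) (≤-respʳ-≃ (*-comm z y) (*-monoˡ-≤ 0≤z x≤y))

*-identityˡ : ∀ x → 1ℝ * x ≃ x
*-identityˡ x = ≡⇒≃ λ k → ℚₚ.*-identityˡ (seq x k)

<⇒≤ : x < y → x ≤ y
<⇒≤ {x} {y} (mk< δ 0<δ N h) = eventually≤⇒≤ N λ k p →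
  ℚₚ.≤-trans (subst (ℚ._≤ seq x k ℚ.+ δ) (ℚₚ.+-identityʳ (seq x k)) (ℚₚ.+-monoʳ-≤ (seq x k) (ℚₚ.<⇒≤ 0<δ))) (h k p)

-- Cauchy approximations decide the inequality up to ε, so this needs no classical principle and ≤ and ≃ are ¬¬-stable.
≮⇒≥ : ¬ (y < x) → x ≤ y
≮⇒≥ {y} {x} y≮x = mk≤ λ ε 0<ε → attempt ε 0<ε (cauchy y (ε ℚ.* ½ ℚ.* ½) (half-pos (half-pos 0<ε))) (cauchy x (ε ℚ.* ½ ℚ.* ½) (half-pos (half-pos 0<ε)))
  where
  attempt : ∀ ε → 0ℚ ℚ.< ε → ∃[ N ] (∀ m n → N ℕ.≤ m → N ℕ.≤ n → dist (seq y m) (seq y n) ℚ.< ε ℚ.* ½ ℚ.* ½) →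
    ∃[ N ] (∀ m n → N ℕ.≤ m → N ℕ.≤ n → dist (seq x m) (seq x n) ℚ.< ε ℚ.* ½ ℚ.* ½) →
    ∃[ N ] (∀ n → N ℕ.≤ n → seq x n ℚ.≤ seq y n ℚ.+ ε)
  attempt ε 0<ε (N , cy) (N′ , cx) = M , λ n p → by-cases n p (seq x n ℚₚ.≤? seq y n ℚ.+ ε)
    where
    open ℚₚ.≤-Reasoning
    M : ℕ
    M = N ℕ.⊔ N′
    δ : ℚ
    δ = ε ℚ.* ½ ℚ.* ½
    by-cases : ∀ n → M ℕ.≤ n → _ → seq x n ℚ.≤ seq y n ℚ.+ ε
    by-cases n p (yes le) = le
    by-cases n p (no ¬le) = contradiction (mk< (ε ℚ.* ½) (half-pos 0<ε) M λ m q → begin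
      seq y m ℚ.+ ε ℚ.* ½                   ≤⟨ ℚₚ.+-monoˡ-≤ (ε ℚ.* ½) (ℚₚ.≤-trans (≤-dist (seq y m) (seq y n)) (ℚₚ.+-monoʳ-≤ (seq y n) (ℚₚ.<⇒≤ (cy m n (ℕₚ.m⊔n≤o⇒m≤o N N′ q) (ℕₚ.m⊔n≤o⇒m≤o N N′ p))))) ⟩
      seq y n ℚ.+ δ ℚ.+ ε ℚ.* ½             ≡⟨ cong₂ (λ u v → seq y n ℚ.+ u ℚ.+ v) refl (sym (half+half (ε ℚ.* ½))) ⟩
      seq y n ℚ.+ δ ℚ.+ (δ ℚ.+ δ)           ≡⟨ solve 2 (λ y δ → y :+ δ :+ (δ :+ δ) := (y :+ ((δ :+ δ) :+ (δ :+ δ))) :- δ) refl (seq y n) δ ⟩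
      (seq y n ℚ.+ ((δ ℚ.+ δ) ℚ.+ (δ ℚ.+ δ))) ℚ.- δ ≡⟨ cong (λ e → (seq y n ℚ.+ e) ℚ.- δ) (trans (cong₂ ℚ._+_ (half+half (ε ℚ.* ½)) (half+half (ε ℚ.* ½))) (half+half ε)) ⟩
      (seq y n ℚ.+ ε) ℚ.- δ                 ≤⟨ sub≤ (ℚₚ.≤-trans (ℚₚ.<⇒≤ (ℚₚ.≰⇒> ¬le)) (ℚₚ.≤-trans (≤-dist (seq x n) (seq x m))
                                                (ℚₚ.≤-trans (ℚₚ.+-monoʳ-≤ (seq x m) (ℚₚ.<⇒≤ (cx n m (ℕₚ.m⊔n≤o⇒n≤o N N′ p) (ℕₚ.m⊔n≤o⇒n≤o N N′ q)))) (ℚₚ.≤-reflexive (ℚₚ.+-comm (seq x m) δ))))) ⟩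
      seq x m                               ∎) y≮x

≤-stable : ¬ ¬ (x ≤ y) → x ≤ y
≤-stable {x} {y} h = ≮⇒≥ λ { (mk< δ 0<δ N y<x) → h λ { (mk≤ x≤y) →
  let (N′ , b) = x≤y (δ ℚ.* ½) (half-pos 0<δ)
      k = N ℕ.⊔ N′
  in ℚₚ.<-irrefl refl (ℚₚ.<-≤-trans (ℚₚ.+-monoʳ-< (seq y k) (half< 0<δ)) (ℚₚ.≤-trans (y<x k (ℕₚ.m≤m⊔n N N′)) (b k (ℕₚ.m≤n⊔m N N′)))) } }
  where
  half< : ∀ {δ} → 0ℚ ℚ.< δ → δ ℚ.* ½ ℚ.< δ
  half< {δ} 0<δ = subst₂ ℚ._<_ (ℚₚ.+-identityʳ (δ ℚ.* ½)) (half+half δ) (ℚₚ.+-monoʳ-< (δ ℚ.* ½) (half-pos 0<δ))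

≤-antisym : x ≤ y → y ≤ x → x ≃ y
≤-antisym {x} {y} (mk≤ h) (mk≤ h′) = mk≃ λ ε 0<ε →
  let (N , b) = h (ε ℚ.* ½) (half-pos 0<ε); (N′ , b′) = h′ (ε ℚ.* ½) (half-pos 0<ε) in
  N ℕ.⊔ N′ , λ k p → ℚₚ.≤-<-trans (dist≤ (b k (ℕₚ.m⊔n≤o⇒m≤o N N′ p)) (b′ k (ℕₚ.m⊔n≤o⇒n≤o N N′ p)))
    (subst₂ ℚ._<_ (ℚₚ.+-identityʳ (ε ℚ.* ½)) (half+half ε) (ℚₚ.+-monoʳ-< (ε ℚ.* ½) (half-pos 0<ε)))

≃-stable : ¬ ¬ (x ≃ y) → x ≃ y
≃-stable h = ≤-antisym (≤-stable λ k → h λ e → k (≃⇒≤ e)) (≤-stable λ k → h λ e → k (≃⇒≤ (≃-sym e)))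

ℚtoℝ-mono : ∀ {p q} → p ℚ.≤ q → ℚtoℝ p ≤ ℚtoℝ q
ℚtoℝ-mono h = eventually≤⇒≤ 0 λ _ _ → h

ℚtoℝ-cancel : ∀ {p q} → ℚtoℝ p ≤ ℚtoℝ q → p ℚ.≤ q
ℚtoℝ-cancel {p} {q} (mk≤ h) = ℚₚ.≮⇒≥ λ q<p →
  let 0<d = subst (ℚ._< p ℚ.- q) (ℚₚ.+-inverseʳ q) (ℚₚ.+-monoˡ-< (ℚ.- q) q<p)
      (N , b) = h ((p ℚ.- q) ℚ.* ½) (half-pos 0<d)
  in ℚₚ.<-irrefl refl (ℚₚ.≤-<-trans (b N ℕₚ.≤-refl) (ℚₚ.<-≤-trans (ℚₚ.+-monoʳ-< q
       (subst₂ ℚ._<_ (ℚₚ.+-identityʳ _) (half+half (p ℚ.- q)) (ℚₚ.+-monoʳ-< ((p ℚ.- q) ℚ.* ½) (half-pos 0<d))))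
       (ℚₚ.≤-reflexive (solve 2 (λ p q → q :+ (p :- q) := p) refl p q))))

upper-bound : ∀ x → ∃[ n ] x ≤ ℕtoℝ (suc n)
upper-bound x = let (B , _ , N , h) = bounded (seq x) (cauchy x)
                    n = ℤ.∣ ℚ.↥ B ∣ in
  n , eventually≤⇒≤ N λ k p → ℚₚ.≤-trans (p≤∣p∣ (seq x k)) (ℚₚ.≤-trans (h k p) (ℚₚ.≤-trans (p≤ι B) (ι-mono (ℕₚ.n≤1+n n))))

-- The exact ceiling is not computable. A rational approximation within ½ is raised by ½ and rounded
-- up, which overshoots `x` by at most ½ + ½ + 1 = 2.
ceiling : ∀ x → 0ℝ ≤ x → ∃[ k ] x ≤ ℕtoℝ k × ℕtoℝ k ≤ x + ℕtoℝ 2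
ceiling x (mk≤ 0≤x) = k , eventually≤⇒≤ M (λ m p → ℚₚ.≤-trans (near m p) (proj₁ (proj₂ bracketed))) ,
  eventually≤⇒≤ M (λ m p → ℚₚ.≤-trans (proj₂ (proj₂ bracketed)) (ℚₚ.≤-trans
    (ℚₚ.+-monoˡ-≤ 1ℚ (ℚₚ.+-monoˡ-≤ ½ (ℚₚ.≤-trans (≤-dist (seq x M) (seq x m)) (ℚₚ.+-monoʳ-≤ (seq x m) (ℚₚ.<⇒≤ (cx M m ℕₚ.≤-refl p))))))
    (ℚₚ.≤-reflexive (trans (solve 1 (λ x → x :+ con ½ :+ con ½ :+ con 1ℚ := x :+ con (1ℚ ℚ.+ 1ℚ)) refl (seq x m)) (cong (seq x m ℚ.+_) refl)))))
  where
  0<½ : 0ℚ ℚ.< ½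
  0<½ = RationalLemmas.0<½
  N N′ M : ℕ
  N  = proj₁ (cauchy x ½ 0<½)
  N′ = proj₁ (0≤x ½ 0<½)
  M  = N ℕ.⊔ N′
  cx : ∀ m n → M ℕ.≤ m → M ℕ.≤ n → dist (seq x m) (seq x n) ℚ.< ½
  cx m n p q = proj₂ (cauchy x ½ 0<½) m n (ℕₚ.m⊔n≤o⇒m≤o N N′ p) (ℕₚ.m⊔n≤o⇒m≤o N N′ q)
  near : ∀ m → M ℕ.≤ m → seq x m ℚ.≤ seq x M ℚ.+ ½
  near m p = ℚₚ.≤-trans (≤-dist (seq x m) (seq x M)) (ℚₚ.+-monoʳ-≤ (seq x M) (ℚₚ.<⇒≤ (cx m M p ℕₚ.≤-refl)))
  bracket : ∀ q → 0ℚ ℚ.≤ q → ∀ K → q ℚ.≤ ι K → ∃[ k ] q ℚ.≤ ι k × ι k ℚ.≤ q ℚ.+ 1ℚ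
  bracket q 0≤q zero    q≤ = 0 , q≤ , ℚₚ.+-mono-≤ 0≤q RationalLemmas.0≤1
  bracket q 0≤q (suc K) q≤ with q ℚₚ.≤? ι K
  ... | yes q≤K = bracket q 0≤q K q≤K
  ... | no q≰K  = suc K , q≤ , subst₂ ℚ._≤_ (sym (ι-suc K)) (ℚₚ.+-comm 1ℚ q) (ℚₚ.+-monoʳ-≤ 1ℚ (ℚₚ.<⇒≤ (ℚₚ.≰⇒> q≰K)))
  bracketed : ∃[ k ] (seq x M ℚ.+ ½) ℚ.≤ ι k × ι k ℚ.≤ (seq x M ℚ.+ ½) ℚ.+ 1ℚ
  bracketed = bracket (seq x M ℚ.+ ½) (proj₂ (0≤x ½ 0<½) M (ℕₚ.m≤n⊔m N N′)) ℤ.∣ ℚ.↥ (seq x M ℚ.+ ½) ∣ (p≤ι (seq x M ℚ.+ ½))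
  k : ℕ
  k = proj₁ bracketed

-- Exponential, logarithm and powers

private
  S = ExpLemmas.S

exp-cong : x ≃ y → exp x ≃ exp y
exp-cong {x} {y} (mk≃ h) = go (bounded (seq x) (cauchy x)) (bounded (seq y) (cauchy y))
  where
  go : EventuallyBounded (seq x) → EventuallyBounded (seq y) → exp x ≃ exp y
  go (A , 0<A , N , hx) (B , 0<B , N′ , hy) = mk≃ λ ε 0<ε →
      let (N″ , b) = Tends0-* (constᵇ K) h ε 0<ε in
      (N ℕ.⊔ N′) ℕ.⊔ (suc M ℕ.⊔ N″) , λ k p →
        let p₁ = ℕₚ.m⊔n≤o⇒m≤o (N ℕ.⊔ N′) (suc M ℕ.⊔ N″) p
            p₂ = ℕₚ.m⊔n≤o⇒n≤o (N ℕ.⊔ N′) (suc M ℕ.⊔ N″) p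
        in ℚₚ.≤-<-trans (S-lip (ℚₚ.≤-trans (hx k (ℕₚ.m⊔n≤o⇒m≤o N N′ p₁)) (ℚₚ.p≤p⊔q A B)) (ℚₚ.≤-trans (hy k (ℕₚ.m⊔n≤o⇒n≤o N N′ p₁)) (ℚₚ.p≤q⊔p A B)) k (ℕₚ.m⊔n≤o⇒m≤o (suc M) N″ p₂))
          (subst (ℚ._< ε) (trans (ℚₚ.∣p*q∣≡∣p∣*∣q∣ K (seq x k ℚ.- seq y k)) (cong (ℚ._* dist (seq x k) (seq y k)) (ℚₚ.0≤p⇒∣p∣≡p (ℚₚ.<⇒≤ 0<K)))) (b k (ℕₚ.m⊔n≤o⇒n≤o (suc M) N″ p₂)))
    where
    open ExpLemmas.Bound (A ℚ.⊔ B) (ℚₚ.≤-trans (ℚₚ.<⇒≤ 0<A) (ℚₚ.p≤p⊔q A B))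

exp-+ : ∀ x y → exp (x + y) ≃ exp x * exp y
exp-+ x y = go (bounded (seq x) (cauchy x)) (bounded (seq y) (cauchy y))
  where
  go : EventuallyBounded (seq x) → EventuallyBounded (seq y) → exp (x + y) ≃ exp x * exp y
  go (A , _ , N , hx) (B , _ , N′ , hy) = ≃-sym {exp x * exp y} (mk≃ (S-*-null (seq x) (seq y) {A} {B} (N ℕ.⊔ N′)
    (λ n p → hx n (ℕₚ.m⊔n≤o⇒m≤o N N′ p)) (λ n p → hy n (ℕₚ.m⊔n≤o⇒n≤o N N′ p))))

exp-0 : exp 0ℝ ≃ 1ℝ
exp-0 = ≡⇒≃ λ k → LogLemmas.S-zero k

1+ι≤exp : ∀ n → ℕtoℝ (suc n) ≤ exp (ℕtoℝ n)
1+ι≤exp n = eventually≤⇒≤ 1 λ { (suc k) _ → subst (ℚ._≤ S (ι n) (suc k))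
  (trans (cong₂ (λ u v → u ℚ.+ v) (LogLemmas.S-zero (suc k)) (solve 1 (λ q → q :- con 0ℚ := q) refl (ι n))) (sym (ι-suc n)))
  (ExpLemmas.S-slope ℚₚ.≤-refl (ι-nonNeg n) k) }

0≤q*q : ∀ q → 0ℚ ℚ.≤ q ℚ.* q
0≤q*q q with ℚₚ.≤-total 0ℚ q
... | inj₁ 0≤q = *-nonNeg 0≤q 0≤q
... | inj₂ q≤0 = subst (0ℚ ℚ.≤_) (solve 1 (λ q → (:- q) :* (:- q) := q :* q) refl q) (*-nonNeg (ℚₚ.neg-antimono-≤ q≤0) (ℚₚ.neg-antimono-≤ q≤0))

-- Partial sums at negative arguments can be negative, so `exp x` is written as the square of
-- `exp (x/2)`.
0≤exp : ∀ x → 0ℝ ≤ exp x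
0≤exp x = ≤-respʳ-≃ (≃-trans (≃-sym (exp-+ (½ℝ * x) (½ℝ * x))) (exp-cong {½ℝ * x + ½ℝ * x} {x} (≡⇒≃ λ k →
    trans (cong₂ ℚ._+_ (ℚₚ.*-comm ½ (seq x k)) (ℚₚ.*-comm ½ (seq x k))) (RationalLemmas.half+half (seq x k)))))
  (eventually≤⇒≤ {0ℝ} {exp (½ℝ * x) * exp (½ℝ * x)} 0 λ k _ → 0≤q*q (S (½ ℚ.* seq x k) k))
  where
  ½ℝ : ℝ
  ½ℝ = ℚtoℝ ½

-- The approximations of `x` may be slightly negative; those of the equal real `x ⊔ 0ℝ` are not, and
-- there the partial sums are monotone.
0≤⇒1≤exp : 0ℝ ≤ x → 1ℝ ≤ exp x
0≤⇒1≤exp {x} 0≤x = ≤-respʳ-≃ (exp-cong {x ⊔ 0ℝ} {x} (≃-sym x≃x⊔0)) (eventually≤⇒≤ {1ℝ} {exp (x ⊔ 0ℝ)} 0 λ k _ →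
    subst (ℚ._≤ S (seq x k ℚ.⊔ 0ℚ) k) (LogLemmas.S-zero k) (LogLemmas.S-mono ℚₚ.≤-refl (ℚₚ.p≤q⊔p (seq x k) 0ℚ) k))
  where
  x≃x⊔0 : x ≃ x ⊔ 0ℝ
  x≃x⊔0 = ≤-antisym (eventually≤⇒≤ 0 λ k _ → ℚₚ.p≤p⊔q (seq x k) 0ℚ) (⊔≤ 0≤x)
    where
    ⊔≤ : 0ℝ ≤ x → (x ⊔ 0ℝ) ≤ x
    ⊔≤ (mk≤ h) = mk≤ λ ε 0<ε → let (N , b) = h ε 0<ε in N , λ k p → ℚₚ.⊔-lub
      (subst (ℚ._≤ seq x k ℚ.+ ε) (ℚₚ.+-identityʳ (seq x k)) (ℚₚ.+-monoʳ-≤ (seq x k) (ℚₚ.<⇒≤ 0<ε))) (b k p)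

exp-mono : x ≤ y → exp x ≤ exp y
exp-mono {x} {y} x≤y = ≤-respˡ-≃ (≃-sym (*-identityˡ (exp x))) (≤-respʳ-≃
  (≃-trans (≃-sym (exp-+ (y - x) x)) (exp-cong {(y - x) + x} {y} (≡⇒≃ λ k → solve 2 (λ x y → (y :- x) :+ x := y) refl (seq x k) (seq y k))))
  (*-monoʳ-≤ (0≤exp x) (0≤⇒1≤exp (x≤y⇒0≤y-x x≤y))))

-- As `log x = log (k x) − log k`, the functional equation gives `k * exp (log x) ≃ k * x`, and `k`
-- is cancelled by its rational inverse.
exp-log : ∀ x (0<x : 0ℝ < x) → exp (log x 0<x) ≃ x
exp-log x 0<x = ≃-trans (≃-sym (*-identityˡ E)) (≃-trans (*-cong (≃-sym ι⁻¹k≃1) (≃-refl {E})) (≃-trans assoc (≃-trans (*-cong (≃-refl {ι⁻¹}) k*E≃) assoc′)))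
  where
  k : ℕ
  k = scale x 0<x
  1≤k : 1ℝ ≤ ℕtoℝ k
  1≤k = 1≤ℕtoℝ k (0<scale x 0<x)
  1≤kx : 1ℝ ≤ ℕtoℝ k * x
  1≤kx = 1≤scale*x x 0<x
  lk lkx E : ℝ
  lk  = log≥1 (ℕtoℝ k) 1≤k
  lkx = log≥1 (ℕtoℝ k * x) 1≤kx
  E = exp (lkx - lk)
  ιk-nonZero : ℚ.NonZero (ι k)
  ιk-nonZero = ℚ.>-nonZero (ℚₚ.<-≤-trans Limits.0<1 (1≤ℕtoℚ k (0<scale x 0<x)))
  ι⁻¹ : ℝ
  ι⁻¹ = ℚtoℝ ((ℚ.1/ ι k) {{ιk-nonZero}})
  ι⁻¹k≃1 : ι⁻¹ * ℕtoℝ k ≃ 1ℝ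
  ι⁻¹k≃1 = ≡⇒≃ λ _ → ℚₚ.*-inverseˡ (ι k) {{ιk-nonZero}}
  assoc : (ι⁻¹ * ℕtoℝ k) * E ≃ ι⁻¹ * (ℕtoℝ k * E)
  assoc = ≡⇒≃ λ n → ℚₚ.*-assoc (seq ι⁻¹ n) (ι k) (seq E n)
  k*E≃ : ℕtoℝ k * E ≃ ℕtoℝ k * x
  k*E≃ = ≃-trans (*-cong (≃-sym (exp-log≥1 (ℕtoℝ k) 1≤k)) (≃-refl {E})) (≃-trans (≃-sym (exp-+ lk (lkx - lk)))
    (≃-trans (exp-cong {lk + (lkx - lk)} {lkx} (≡⇒≃ λ n → solve 2 (λ a b → a :+ (b :- a) := b) refl (seq lk n) (seq lkx n))) (exp-log≥1 (ℕtoℝ k * x) 1≤kx)))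
  assoc′ : ι⁻¹ * (ℕtoℝ k * x) ≃ x
  assoc′ = ≃-trans (≡⇒≃ λ n → sym (ℚₚ.*-assoc (seq ι⁻¹ n) (ι k) (seq x n))) (≃-trans (*-cong ι⁻¹k≃1 (≃-refl {x})) (*-identityˡ x))

-- Otherwise x ≤ −ε eventually, and 1 ≤ exp x would contradict exp ε ≥ 1 + ε.
1≤exp⇒0≤ : 1ℝ ≤ exp x → 0ℝ ≤ x
1≤exp⇒0≤ {x} h = ≮⇒≥ λ { (mk< ε 0<ε N x+ε≤0) →
  let x≤-ε : x ≤ - ℚtoℝ ε
      x≤-ε = eventually≤⇒≤ N λ k p → subst₂ ℚ._≤_ (solve 2 (λ x e → (x :+ e) :- e := x) refl (seq x k) ε) (ℚₚ.+-identityˡ (ℚ.- ε)) (ℚₚ.+-monoˡ-≤ (ℚ.- ε) (x+ε≤0 k p))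
      1+ε≤exp : ℚtoℝ (1ℚ ℚ.+ ε) ≤ exp (ℚtoℝ ε)
      1+ε≤exp = eventually≤⇒≤ 1 λ { (suc k) _ → subst (ℚ._≤ S ε (suc k))
        (cong₂ (λ u v → u ℚ.+ v) (LogLemmas.S-zero (suc k)) (solve 1 (λ q → q :- con 0ℚ := q) refl ε)) (ExpLemmas.S-slope ℚₚ.≤-refl (ℚₚ.<⇒≤ 0<ε) k) }
      expε≤1 : exp (ℚtoℝ ε) ≤ 1ℝ
      expε≤1 = ≤-respˡ-≃ (≃-sym (*-identityˡ (exp (ℚtoℝ ε)))) (≤-respʳ-≃
        (≃-trans (≃-sym (exp-+ (- ℚtoℝ ε) (ℚtoℝ ε))) (≃-trans (exp-cong {(- ℚtoℝ ε) + ℚtoℝ ε} {0ℝ} (≡⇒≃ λ _ → ℚₚ.+-inverseˡ ε)) exp-0))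
        (*-monoʳ-≤ (0≤exp (ℚtoℝ ε)) (≤-trans h (exp-mono x≤-ε))))
  in ℚₚ.<-irrefl refl (ℚₚ.<-≤-trans (subst (ℚ._< 1ℚ ℚ.+ ε) (ℚₚ.+-identityʳ 1ℚ) (ℚₚ.+-monoʳ-< 1ℚ 0<ε)) (ℚtoℝ-cancel (≤-trans 1+ε≤exp expε≤1))) }

power : ℝ → ℕ → ℝ
power x zero    = 1ℝ
power x (suc k) = x * power x k

0≤power : 0ℝ ≤ x → ∀ k → 0ℝ ≤ power x k
0≤power 0≤x zero    = ℚtoℝ-mono RationalLemmas.0≤1
0≤power 0≤x (suc k) = 0≤*0≤ 0≤x (0≤power 0≤x k)

power-cong : x ≃ y → ∀ k → power x k ≃ power y k
power-cong e zero    = ≃-refl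
power-cong e (suc k) = *-cong e (power-cong e k)

power-exp : ∀ x k → power (exp x) k ≃ exp (ℕtoℝ k * x)
power-exp x zero    = ≃-sym (≃-trans (exp-cong {ℕtoℝ 0 * x} {0ℝ} (≡⇒≃ λ k → ℚₚ.*-zeroˡ (seq x k))) exp-0)
power-exp x (suc k) = ≃-trans (*-cong (≃-refl {exp x}) (power-exp x k)) (≃-trans (≃-sym (exp-+ x (ℕtoℝ k * x)))
  (exp-cong {x + ℕtoℝ k * x} {ℕtoℝ (suc k) * x} (≡⇒≃ λ n → sym (trans (cong (ℚ._* seq x n) (ι-suc k))
    (solve 2 (λ n x → (con 1ℚ :+ n) :* x := x :+ n :* x) refl (ι k) (seq x n))))))

power-ℕtoℝ : ∀ m k → power (ℕtoℝ m) k ≃ ℕtoℝ (m ℕ.^ k)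
power-ℕtoℝ m zero    = ≃-refl
power-ℕtoℝ m (suc k) = ≃-trans (*-cong (≃-refl {ℕtoℝ m}) (power-ℕtoℝ m k)) (≡⇒≃ λ _ → sym (ι-* m (m ℕ.^ k)))

ℕtoℝ-^ : ∀ m (0<m : 0ℝ < ℕtoℝ m) k → ℕtoℝ (m ℕ.^ k) ≃ exp (ℕtoℝ k * log (ℕtoℝ m) 0<m)
ℕtoℝ-^ m 0<m k = ≃-trans (≃-sym (power-ℕtoℝ m k)) (≃-trans (power-cong (≃-sym (exp-log (ℕtoℝ m) 0<m)) k) (power-exp (log (ℕtoℝ m) 0<m) k))

-- `inverse` inverts the shifted terms `seq y (N + n)`, so the product differs from 1 by a bounded
-- multiple of `seq y n − seq y (N + n)`.
*-inverse : ∀ y (y#0 : 0ℝ < ∣ y ∣) → y * inverse y y#0 ≃ 1ℝ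
*-inverse y y#0@(mk< ε 0<ε N ε≤∣y∣) = mk≃ (Tends0-cong rearrange
  (Tends0-* (bounded (seq (inverse y y#0)) (cauchy (inverse y y#0))) tail→0))
  where
  open Limits.Inverse (λ n → seq y (N ℕ.+ n)) (Limits.shift-cauchy {seq y} N (cauchy y)) 0<ε
    (λ n → subst (ℚ._≤ ℚ.∣ seq y (N ℕ.+ n) ∣) (ℚₚ.+-identityˡ ε) (ε≤∣y∣ (N ℕ.+ n) (ℕₚ.m≤m+n N n)))
  tail→0 : Tends0 (λ n → seq y n ℚ.- seq y (N ℕ.+ n))
  tail→0 δ 0<δ = let (M , h) = cauchy y δ 0<δ in M , λ n p → h n (N ℕ.+ n) p (ℕₚ.m≤n⇒m≤o+n N p)
  rearrange : ∀ n → inv n ℚ.* (seq y n ℚ.- seq y (N ℕ.+ n)) ≡ seq y n ℚ.* inv n ℚ.- 1ℚ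
  rearrange n = trans (solve 3 (λ i a b → i :* (a :- b) := a :* i :- b :* i) refl (inv n) (seq y n) (seq y (N ℕ.+ n)))
    (cong (λ z → seq y n ℚ.* inv n ℚ.- z) (ℚₚ.*-inverseʳ (seq y (N ℕ.+ n)) {{s≢0 n}}))

-- Maxima, the supremum norm and bounded sets

private
  variable
    d m : ℕ

maximum-cong : (x y : Vector ℝ m) → (∀ i → x i ≃ y i) → maximum x ≃ maximum y
maximum-cong {zero}  x y e = ≃-refl
maximum-cong {suc m} x y e = ⊔-cong (e zero) (maximum-cong (λ i → x (suc i)) (λ i → y (suc i)) (λ i → e (suc i)))

seq≤maximum : ∀ (x : Vector ℝ m) i k → seq (x i) k ℚ.≤ seq (maximum x) k
seq≤maximum x zero    k = ℚₚ.p≤p⊔q (seq (x zero) k) _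
seq≤maximum x (suc i) k = ℚₚ.≤-trans (seq≤maximum (λ i → x (suc i)) i k) (ℚₚ.p≤q⊔p (seq (x zero) k) _)

≤maximum : ∀ (x : Vector ℝ m) i → x i ≤ maximum x
≤maximum x i = eventually≤⇒≤ 0 λ k _ → seq≤maximum x i k

⊔-lub : ∀ {x y z} → x ≤ z → y ≤ z → (x ⊔ y) ≤ z
⊔-lub (mk≤ h) (mk≤ h′) = mk≤ λ ε 0<ε → let (N , b) = h ε 0<ε; (N′ , b′) = h′ ε 0<ε in
  N ℕ.⊔ N′ , λ k p → ℚₚ.⊔-lub (b k (ℕₚ.m⊔n≤o⇒m≤o N N′ p)) (b′ k (ℕₚ.m⊔n≤o⇒n≤o N N′ p))

maximum-lub : ∀ (x : Vector ℝ m) {z} → 0ℝ ≤ z → (∀ i → x i ≤ z) → maximum x ≤ z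
maximum-lub {zero}  x 0≤z h = 0≤z
maximum-lub {suc m} x 0≤z h = ⊔-lub (h zero) (maximum-lub (λ i → x (suc i)) 0≤z (λ i → h (suc i)))

0≤maximum : ∀ (x : Vector ℝ m) → 0ℝ ≤ maximum x
0≤maximum {zero}  x = ≤-refl
0≤maximum {suc m} x = ≤-trans (0≤maximum (λ i → x (suc i))) (eventually≤⇒≤ {y = maximum x} 0 λ k _ → ℚₚ.p≤q⊔p (seq (x zero) k) _)

-ᵥ-cong : {x x′ y y′ : ℝ^ d} → x ≋ x′ → y ≋ y′ → ‖ x -ᵥ y ‖ ≃ ‖ x′ -ᵥ y′ ‖
-ᵥ-cong {x = x} {x′} {y} {y′} e e′ = maximum-cong _ _ λ i → ∣-∣-cong (+-cong (e i) (neg-cong (e′ i)))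
  where
  neg-cong : ∀ {x y} → x ≃ y → (- x) ≃ (- y)
  neg-cong {x} {y} (mk≃ h) = mk≃ λ ε 0<ε → let (N , b) = h ε 0<ε in
    N , λ k p → subst (ℚ._< ε) (sym (RationalLemmas.dist-neg (seq x k) (seq y k))) (b k p)

EventuallyBoundedBy : ℚ → ℝ^ d → Set
EventuallyBoundedBy b x = ∀ i → ∃[ K ] (∀ k → K ℕ.≤ k → ℚ.∣ seq (x i) k ∣ ℚ.≤ b)

near⇒bounded : ∀ {x y : ℝ^ d} {B} → ‖ x -ᵥ y ‖ < 1ℝ → ∃[ K ] (∀ k → K ℕ.≤ k → ℚ.∣ seq ‖ y ‖ k ∣ ℚ.≤ B) → EventuallyBoundedBy (1ℚ ℚ.+ B) x
near⇒bounded {x = x} {y} {B} (mk< δ 0<δ N near) (K , y≤B) i = N ℕ.⊔ K , λ k p → begin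
  ℚ.∣ seq (x i) k ∣                                          ≡⟨ cong ℚ.∣_∣ (solve 2 (λ x y → x := (x :- y) :+ y) refl (seq (x i) k) (seq (y i) k)) ⟩
  ℚ.∣ (seq (x i) k ℚ.- seq (y i) k) ℚ.+ seq (y i) k ∣        ≤⟨ ℚₚ.∣p+q∣≤∣p∣+∣q∣ (seq (x i) k ℚ.- seq (y i) k) (seq (y i) k) ⟩
  dist (seq (x i) k) (seq (y i) k) ℚ.+ ℚ.∣ seq (y i) k ∣
    ≤⟨ ℚₚ.+-mono-≤ (ℚₚ.≤-trans (seq≤maximum (λ i → ∣ (x -ᵥ y) i ∣) i k) (ℚₚ.≤-trans (≤+δ (seq ‖ x -ᵥ y ‖ k)) (near k (ℕₚ.m⊔n≤o⇒m≤o N K p))))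
         (ℚₚ.≤-trans (seq≤maximum (λ i → ∣ y i ∣) i k) (ℚₚ.≤-trans (p≤∣p∣ (seq ‖ y ‖ k)) (y≤B k (ℕₚ.m⊔n≤o⇒n≤o N K p)))) ⟩
  1ℚ ℚ.+ B                                                   ∎
  where
  open ℚₚ.≤-Reasoning
  ≤+δ : ∀ q → q ℚ.≤ q ℚ.+ δ
  ≤+δ q = subst (ℚ._≤ q ℚ.+ δ) (ℚₚ.+-identityʳ q) (ℚₚ.+-monoʳ-≤ q (ℚₚ.<⇒≤ 0<δ))

-- Only the rational `b` is uniform; the index from which it bounds the approximations may depend on
-- the point.
net-bound : ∀ (ys : List (ℝ^ d)) → ∃[ b ] 0ℚ ℚ.≤ b × (∀ x → Any (λ y → ‖ x -ᵥ y ‖ < 1ℝ) ys → EventuallyBoundedBy b x)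
net-bound []       = 0ℚ , ℚₚ.≤-refl , λ _ ()
net-bound (y ∷ ys) = let (B , _ , y≤B) = bounded (seq ‖ y ‖) (cauchy ‖ y ‖); (b , 0≤b , h) = net-bound ys in
  (1ℚ ℚ.+ B) ℚ.⊔ b , ℚₚ.≤-trans 0≤b (ℚₚ.p≤q⊔p (1ℚ ℚ.+ B) b) , λ
    { x (here near) i → let (K , x≤) = near⇒bounded {x = x} {y} near y≤B i in K , λ k p → ℚₚ.≤-trans (x≤ k p) (ℚₚ.p≤p⊔q (1ℚ ℚ.+ B) b)
    ; x (there any) i → let (K , x≤) = h x any i in K , λ k p → ℚₚ.≤-trans (x≤ k p) (ℚₚ.p≤q⊔p (1ℚ ℚ.+ B) b) }

-- Double negation commutes with a finite conjunction.
¬¬-choice : ∀ {p} {P : Fin m → Set p} → (∀ i → ¬ ¬ P i) → ¬ ¬ (∀ i → P i)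
¬¬-choice {zero}  h k = k λ ()
¬¬-choice {suc m} h k = h zero λ p₀ → ¬¬-choice (λ i → h (suc i)) λ ps → k λ { zero → p₀ ; (suc i) → ps i }

-- The depth of the pieces

-- The logarithm of the implied constant, for `i = 1/log τ` and `g = log J`: the extra depth `a`
-- costs `a/(−log τ)` levels and the rounding in `ceiling` at most 2, each level a factor `J`.
constantExponent : ℝ → ℝ → ℕ → ℝ
constantExponent i g a = (ℕtoℝ a * (- i) + ℕtoℝ 2) * g

-- For l = log τ, i = 1/log τ, g = log J, u = 2n log N: a depth k with τᵏ N²ⁿ ≤ e⁻ᵃ and Jᵏ ≪ N²ⁿᴰ, namely k ≈ (u + a)/(−log τ).
module Depth (l i g u : ℝ) (a : ℕ) (0≤-l : 0ℝ ≤ - l) (l*i≃1 : l * i ≃ 1ℝ) (0≤g : 0ℝ ≤ g) (0≤u : 0ℝ ≤ u) where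

  -- −1/l = (−l)(1/l)²
  0≤-i : 0ℝ ≤ - i
  0≤-i = ≤-respʳ-≃ (≃-trans (≡⇒≃ λ k → solve 2 (λ l i → (:- l) :* (i :* i) := (l :* i) :* (:- i)) refl (seq l k) (seq i k))
      (≃-trans (*-cong l*i≃1 (≃-refl { - i})) (*-identityˡ (- i))))
    (0≤*0≤ 0≤-l (eventually≤⇒≤ {0ℝ} {i * i} 0 λ k _ → 0≤q*q (seq i k)))

  depth : ℝ
  depth = (u + ℕtoℝ a) * (- i)

  0≤u+a : 0ℝ ≤ u + ℕtoℝ a
  0≤u+a = ≤-respˡ-≃ {0ℝ} {0ℝ + 0ℝ} (≡⇒≃ λ _ → refl) (+-mono-≤ {0ℝ} {u} {0ℝ} 0≤u (ℚtoℝ-mono (ι-nonNeg a)))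

  exponent≤0 : ∀ k → depth ≤ ℕtoℝ k → (ℕtoℝ k * l + u) + ℕtoℝ a ≤ 0ℝ
  exponent≤0 k depth≤k = ≤-respˡ-≃ (≡⇒≃ λ n → ℚₚ.+-assoc (seq (ℕtoℝ k * l) n) (seq u n) (ι a))
    (≤-trans (+-mono-≤ {ℕtoℝ k * l} {ℕtoℝ k * l} {u + ℕtoℝ a} ≤-refl u+a≤) (≃⇒≤ (≡⇒≃ λ n →
      solve 2 (λ k l → k :* l :+ (:- l) :* k := con 0ℚ) refl (ι k) (seq l n))))
    where
    u+a≤ : u + ℕtoℝ a ≤ (- l) * ℕtoℝ k
    u+a≤ = ≤-respˡ-≃ (≃-trans (≃-sym (*-identityˡ (u + ℕtoℝ a))) (≃-trans (*-cong (≃-sym l*i≃1) (≃-refl {u + ℕtoℝ a}))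
        (≡⇒≃ λ n → solve 3 (λ l i y → (l :* i) :* y := (:- l) :* (y :* (:- i))) refl (seq l n) (seq i n) (seq (u + ℕtoℝ a) n))))
      (*-monoˡ-≤ 0≤-l depth≤k)

  growth≤ : ∀ k → ℕtoℝ k ≤ depth + ℕtoℝ 2 → ℕtoℝ k * g ≤ constantExponent i g a + ((- g) * i) * u
  growth≤ k k≤ = ≤-respʳ-≃ (≡⇒≃ λ n → solve 5 (λ u a i two g → ((u :+ a) :* (:- i) :+ two) :* g := (a :* (:- i) :+ two) :* g :+ ((:- g) :* i) :* u)
      refl (seq u n) (ι a) (seq i n) (ι 2) (seq g n))
    (*-monoʳ-≤ 0≤g k≤)

  depth-exists : ∃[ k ] (ℕtoℝ k * l + u) + ℕtoℝ a ≤ 0ℝ × ℕtoℝ k * g ≤ constantExponent i g a + ((- g) * i) * u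
  depth-exists = let (k , depth≤k , k≤depth+2) = ceiling depth (0≤*0≤ 0≤u+a 0≤-i) in k , exponent≤0 k depth≤k , growth≤ k k≤depth+2

-- From `x ≤ −a` and `1 + a ≤ exp a` follows `a * exp x < 1`. This allows an integer `a` in the
-- depth where a logarithm would be expected.
exponential-gap : ∀ x a → x + ℕtoℝ a ≤ 0ℝ → ¬ (1ℝ ≤ ℕtoℝ a * exp x)
exponential-gap x a x+a≤0 h = ℚₚ.<-irrefl refl (ℚₚ.<-≤-trans ι<ι-suc (ℚtoℝ-cancel (≤-trans (1+ι≤exp a) exp≤)))
  where
  ι<ι-suc : ι a ℚ.< ι (suc a)
  ι<ι-suc = subst₂ ℚ._<_ (ℚₚ.+-identityˡ (ι a)) (sym (ι-suc a)) (ℚₚ.+-monoˡ-< (ι a) Limits.0<1)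
  exp≤ : exp (ℕtoℝ a) ≤ ℕtoℝ a
  exp≤ = ≤-respˡ-≃ (≃-sym (*-identityˡ (exp (ℕtoℝ a))))
    (≤-trans (*-monoʳ-≤ (0≤exp (ℕtoℝ a)) h)
    (≤-respˡ-≃ (≃-trans (≡⇒≃ λ n → ℚₚ.*-assoc (ι a) (seq (exp x) n) (seq (exp (ℕtoℝ a)) n))
        (*-cong (≃-refl {ℕtoℝ a}) (≃-sym (exp-+ x (ℕtoℝ a)))))
    (≤-respʳ-≃ (≡⇒≃ λ _ → ℚₚ.*-identityʳ (ι a))
      (*-monoˡ-≤ (ℚtoℝ-mono (ι-nonNeg a)) (≤-respʳ-≃ exp-0 (exp-mono x+a≤0))))))

0≤log : ∀ m (0<m : 0 ℕ.< m) → 0ℝ ≤ log (ℕtoℝ m) (0<ℕtoℝ m 0<m)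
0≤log m 0<m = 1≤exp⇒0≤ (≤-respʳ-≃ (≃-sym (exp-log (ℕtoℝ m) (0<ℕtoℝ m 0<m))) (1≤ℕtoℝ m 0<m))

power-log : ∀ x (0<x : 0ℝ < x) k → power x k ≃ exp (ℕtoℝ k * log x 0<x)
power-log x 0<x k = ≃-trans (power-cong (≃-sym (exp-log x 0<x)) k) (power-exp (log x 0<x) k)

-- Pieces of the attractor and the count

module _ {d J} (F : IFS d J) where
  open IFS F

  rate≤maxRate : ∀ j → rate j ≤ maxRate
  rate≤maxRate = ≤maximum rate

  0≤maxRate : 0ℝ ≤ maxRate
  0≤maxRate = <⇒≤ 0<maxRate

  module _ {ℓ} (C : Pred (ℝ^ d) ℓ) where

    -- w < Jᵏ encodes a word of length k, and Piece k w is the image of C under the composition it names.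
    Piece : ∀ k → Fin (J ℕ.^ k) → Pred (ℝ^ d) ℓ
    Piece zero    w x = x ∈ C
    Piece (suc k) w x = ∃[ j ] ∃[ v ] ∃[ y ] w ≡ combine j v × y ∈ Piece k v × x ≋ map j y

    module _ (A : IsAttractor F C) where
      open IsAttractor A

      -- Iterates the inclusion of `C` in the union of its images, and inherits the double negation
      -- of that union.
      covered : ∀ k x → x ∈ C → ¬ ¬ (∃[ w ] x ∈ Piece k w)
      covered zero    x x∈C h = h (zero , x∈C)
      covered (suc k) x x∈C h = proj₂ invariant x∈C λ (j , y , y∈C , x≋) →
        covered k y y∈C λ (v , y∈v) → h (combine j v , j , v , y , refl , y∈v , x≋)

      private
        net = IsCompact.totallyBounded compact 1ℝ (mk< 1ℚ Limits.0<1 0 λ _ _ → ℚₚ.≤-refl)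
        net-bounded = net-bound (proj₁ net)

      bound : ℚ
      bound = proj₁ net-bounded

      0≤bound : 0ℚ ℚ.≤ bound
      0≤bound = proj₁ (proj₂ net-bounded)

      C-bounded : ∀ x → x ∈ C → EventuallyBoundedBy bound x
      C-bounded x x∈C = proj₂ (proj₂ net-bounded) x (proj₂ (proj₂ net) x x∈C)

      diameter : ∀ x x′ → x ∈ C → x′ ∈ C → ‖ x -ᵥ x′ ‖ ≤ ℚtoℝ (bound ℚ.+ bound)
      diameter x x′ x∈C x′∈C = maximum-lub (λ i → ∣ (x -ᵥ x′) i ∣) (ℚtoℝ-mono (ℚₚ.+-mono-≤ 0≤bound 0≤bound)) λ i →
        let (K , h) = C-bounded x x∈C i; (K′ , h′) = C-bounded x′ x′∈C i in
        eventually≤⇒≤ {∣ (x -ᵥ x′) i ∣} (K ℕ.⊔ K′) λ k p → ℚₚ.≤-trans (ℚₚ.∣p+q∣≤∣p∣+∣q∣ (seq (x i) k) (ℚ.- seq (x′ i) k))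
          (ℚₚ.+-mono-≤ (h k (ℕₚ.m⊔n≤o⇒m≤o K K′ p)) (subst (ℚ._≤ bound) (sym (ℚₚ.∣-p∣≡∣p∣ (seq (x′ i) k))) (h′ k (ℕₚ.m⊔n≤o⇒n≤o K K′ p))))

      piece-diameter : ∀ k w x x′ → x ∈ Piece k w → x′ ∈ Piece k w → ‖ x -ᵥ x′ ‖ ≤ power maxRate k * ℚtoℝ (bound ℚ.+ bound)
      piece-diameter zero w x x′ x∈ x′∈ = ≤-respʳ-≃ (≃-sym (*-identityˡ _)) (diameter x x′ x∈ x′∈)
      piece-diameter (suc k) w x x′ (j , v , y , w≡ , y∈ , x≋) (j′ , v′ , y′ , w≡′ , y′∈ , x′≋)
        -- Equal codes have the same first letter, so both points are images under the same
        -- contraction.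
        with refl , refl ← Finₚ.combine-injective j v j′ v′ (trans (sym w≡) w≡′) =
        ≤-respˡ-≃ (-ᵥ-cong {x = x} {map j y} {x′} {map j y′} x≋ x′≋) (≤-trans (proj₂ (proj₂ (contraction j)) y y′)
          (≤-trans (*-monoʳ-≤ (0≤maximum (λ i → ∣ (y -ᵥ y′) i ∣)) (rate≤maxRate j))
          (≤-respʳ-≃ (≡⇒≃ λ n → sym (ℚₚ.*-assoc (seq maxRate n) (seq (power maxRate k) n) (bound ℚ.+ bound)))
            (*-monoˡ-≤ 0≤maxRate (piece-diameter k v y y′ y∈ y′∈)))))

      logτ 1/logτ logJ : ℝ
      logτ   = log maxRate 0<maxRate
      1/logτ = inverse logτ (<0⇒#0 logτ log-maxRate<0)
      logJ   = log (ℕtoℝ J) (0<ℕtoℝ J 0<J)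

      0≤-logτ : 0ℝ ≤ - logτ
      0≤-logτ = ≤-respʳ-≃ (≡⇒≃ λ k → ℚₚ.+-identityˡ (ℚ.- seq logτ k)) (x≤y⇒0≤y-x (<⇒≤ log-maxRate<0))

      logN : ∀ N → 0 ℕ.< N → ℝ
      logN N 0<N = log (ℕtoℝ N) (0<ℕtoℝ N 0<N)

      module _ (n′ : ℕ) where
        private
          n = suc n′
          T = 2 ℕ.* n
          sc = separationConstant n′ bound ℚ.* (bound ℚ.+ bound)

        -- A natural number at least `sc`, the separation constant times the diameter bound; it
        -- depends on neither `N` nor the depth.
        A₀ : ℕ
        A₀ = ℤ.∣ ℚ.↥ sc ∣

        module _ (N : ℕ) (0<N : 0 ℕ.< N) where
          open Separation n′ N 0<N 0≤bound using (AtDistance; separate; 0≤rate) renaming (rate to κ)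

          module Count (k : ℕ) (small : (ℕtoℝ k * logτ + ℕtoℝ T * logN N 0<N) + ℕtoℝ A₀ ≤ 0ℝ) where
            private
              P Q : ℝ
              P = power maxRate k
              Q = ℕtoℝ (N ℕ.^ T)

            P*Q≃exp : P * Q ≃ exp (ℕtoℝ k * logτ + ℕtoℝ T * logN N 0<N)
            P*Q≃exp = ≃-trans (*-cong (power-log maxRate 0<maxRate k) (ℕtoℝ-^ N (0<ℕtoℝ N 0<N) T))
              (≃-sym (exp-+ (ℕtoℝ k * logτ) (ℕtoℝ T * logN N 0<N)))

            -- Separation would give `1 ≤ κ * ∣ α − β ∣ ≤ sc * P * Q ≤ A₀ * exp (k log τ + 2n log
            -- N)`, which the depth excludes.
            ¬far : ∀ {α β} → ∣ α - β ∣ ≤ P * ℚtoℝ (bound ℚ.+ bound) → ¬ AtDistance α β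
            ¬far {α} {β} near far = exponential-gap (ℕtoℝ k * logτ + ℕtoℝ T * logN N 0<N) A₀ small
              (≤-respʳ-≃ (*-cong (≃-refl {ℕtoℝ A₀}) P*Q≃exp)
                (≤-trans 1≤ (≤-trans (*-monoˡ-≤ 0≤κ near) (≤-respˡ-≃ rearrange (*-monoʳ-≤ 0≤PQ (ℚtoℝ-mono (p≤ι sc)))))))
              where
              1≤ : 1ℝ ≤ ℚtoℝ κ * ∣ α - β ∣
              1≤ = mk≤ far
              0≤κ : 0ℝ ≤ ℚtoℝ κ
              0≤κ = ℚtoℝ-mono 0≤rate
              0≤PQ : 0ℝ ≤ P * Q
              0≤PQ = 0≤*0≤ (0≤power 0≤maxRate k) (ℚtoℝ-mono (ι-nonNeg (N ℕ.^ T)))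
              rearrange : ℚtoℝ κ * (P * ℚtoℝ (bound ℚ.+ bound)) ≃ ℚtoℝ sc * (P * Q)
              rearrange = ≡⇒≃ λ i → trans (cong (ℚ._* (seq P i ℚ.* (bound ℚ.+ bound))) (rate-split n′ N 0<N 0≤bound))
                (solve 4 (λ s q p δ → s :* q :* (p :* δ) := s :* δ :* (p :* q)) refl (separationConstant n′ bound) (ι (N ℕ.^ T)) (seq P i) (bound ℚ.+ bound))

            -- Distinct coordinates would be separated by `separate`, against `¬far`; its double
            -- negation is harmless as `≃` is stable.
            piece-unique : ∀ w x x′ → x ∈ 𝒮 C N n → x′ ∈ 𝒮 C N n → x ∈ Piece k w → x′ ∈ Piece k w → x ≋ x′
            piece-unique w x x′ (x∈C , x-alg) (x′∈C , x′-alg) x∈w x′∈w i = ≃-stable λ x≄x′ →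
              separate (algebraic⇒minimal (x-alg i)) (algebraic⇒minimal (x′-alg i)) (C-bounded x x∈C i) (C-bounded x′ x′∈C i)
                (cauchy (x i - x′ i)) (λ →0 → x≄x′ (mk≃ →0))
                (¬far {x i} {x′ i} (≤-trans (≤maximum (λ i → ∣ (x -ᵥ x′) i ∣) i) (piece-diameter k w x x′ x∈w x′∈w)))

            -- The words of the points exist only under double negation, but the goal is stable, so
            -- they may be chosen for the finite family before the pigeonhole principle is applied.
            at-most-Jᵏ : ∀ m (s : Fin m → ℝ^ d) → (∀ i → s i ∈ 𝒮 C N n) → Injective _≡_ _≋_ s → m ℕ.≤ J ℕ.^ k
            at-most-Jᵏ m s s∈ s-inj = ℕₚ.≮⇒≥ λ Jᵏ<m → ¬¬-choice (λ i → covered k (s i) (proj₁ (s∈ i))) λ word →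
              let (i , j , i<j , e) = Finₚ.pigeonhole Jᵏ<m (λ i → proj₁ (word i)) in
              Finₚ.<⇒≢ i<j (s-inj (piece-unique (proj₁ (word i)) (s i) (s j) (s∈ i) (s∈ j) (proj₂ (word i))
                (subst (λ w → s j ∈ Piece k w) (sym e) (proj₂ (word j)))))

            -- `(- logJ) * 1/logτ` is `D` unfolded, so the second summand of the exponent is the
            -- logarithm of `N²ⁿᴰ`.
            Jᵏ≤ : ∀ {c} → exp (constantExponent 1/logτ logJ A₀) ≤ c → ℕtoℝ k * logJ ≤ constantExponent 1/logτ logJ A₀ + ((- logJ) * 1/logτ) * (ℕtoℝ T * logN N 0<N) →
              ℕtoℝ (J ℕ.^ k) ≤ c * exp ((ℕtoℝ T * D) * logN N 0<N)
            Jᵏ≤ {c} exp≤c growth = ≤-respˡ-≃ (ℕtoℝ-^ J (0<ℕtoℝ J 0<J) k) (≤-trans (exp-mono growth)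
              (≤-respˡ-≃ (≃-trans (exp-+ (constantExponent 1/logτ logJ A₀) (((- logJ) * 1/logτ) * (ℕtoℝ T * logN N 0<N)))
                  (*-cong (≃-refl {exp (constantExponent 1/logτ logJ A₀)}) (exp-cong {((- logJ) * 1/logτ) * (ℕtoℝ T * logN N 0<N)} {(ℕtoℝ T * D) * logN N 0<N}
                    (≡⇒≃ λ m → solve 3 (λ δ t l → δ :* (t :* l) := (t :* δ) :* l) refl (seq ((- logJ) * 1/logτ) m) (ι T) (seq (logN N 0<N) m)))))
                (*-monoʳ-≤ (0≤exp ((ℕtoℝ T * D) * logN N 0<N)) exp≤c)))

        IsDepth : ∀ N → 0 ℕ.< N → ℕ → Set
        IsDepth N 0<N k = (ℕtoℝ k * logτ + ℕtoℝ T * logN N 0<N) + ℕtoℝ A₀ ≤ 0ℝ ×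
          ℕtoℝ k * logJ ≤ constantExponent 1/logτ logJ A₀ + ((- logJ) * 1/logτ) * (ℕtoℝ T * logN N 0<N)

        depth-at : ∀ N (0<N : 0 ℕ.< N) → ∃[ k ] IsDepth N 0<N k
        depth-at N 0<N = Depth.depth-exists logτ 1/logτ logJ (ℕtoℝ T * logN N 0<N) A₀ 0≤-logτ (*-inverse logτ (<0⇒#0 logτ log-maxRate<0))
          (0≤log J 0<J) (0≤*0≤ (ℚtoℝ-mono (ι-nonNeg T)) (0≤log N 0<N))

        cardinality≤ : ∀ c → exp (constantExponent 1/logτ logJ A₀) ≤ c → ∀ N (0<N : 0 ℕ.< N) →
          CardinalityAtMost (𝒮 C N n) (c * ℕtoℝ N ^ (ℕtoℝ T * D) [ 0<ℕtoℝ N 0<N ])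
        cardinality≤ c exp≤c N 0<N m s s∈ s-inj = from (depth-at N 0<N)
          where
          from : ∃[ k ] IsDepth N 0<N k → ℕtoℝ m ≤ c * ℕtoℝ N ^ (ℕtoℝ T * D) [ 0<ℕtoℝ N 0<N ]
          from (k , small , growth) = ≤-trans {y = ℕtoℝ (J ℕ.^ k)} (ℚtoℝ-mono (ι-mono (at-most-Jᵏ m s s∈ s-inj))) (Jᵏ≤ {c} exp≤c growth)
            where open Count N 0<N k small

theorem4p2 :
    ∀ {ℓ} {d J : ℕ} (F : IFS d J) (C : Pred (ℝ^ d) ℓ) → IsAttractor F C →
    ∀ (n : ℕ) → 0 ℕ.< n →
    ∃[ c ] 0ℝ < c ×
      (∀ (N : ℕ) (0<N : 0 ℕ.< N) →
        CardinalityAtMost (𝒮 C N n) (c * ℕtoℝ N ^ (ℕtoℝ (2 ℕ.* n) * IFS.D F) [ 0<ℕtoℝ N 0<N ]))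
-- An integer above the exponential of `constantExponent` serves as the implied constant: it is
-- positive and chosen before `N`.
theorem4p2 F C A (suc n′) _ = let (c , exp≤c) = upper-bound (exp (constantExponent (1/logτ F C A) (logJ F C A) (A₀ F C A n′))) in
  ℕtoℝ (suc c) , 0<ℕtoℝ (suc c) (s≤s z≤n) , cardinality≤ F C A n′ (ℕtoℝ (suc c)) exp≤c
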